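{- Let $F$ be a finite field of characteristic $p$ and order $q=p^n$ (so $n=[F:\mathbb{F}_p]$), and let $d$ be a positive integer with $\gcd(d,q-1)=1$. Define $W_{F,d}(a)=\sum_{x\in F}\psi(x^d-ax)$ for $a\in F$ and $V_{F,d}=\min_{a\in F}\operatorname{val}_p(W_{F,d}(a))$. (i) If $d$ is degenerate over $F$, then $V_{F,d}=[F:\mathbb{F}_p]$. (ii) Suppose $d$ is nondegenerate over $F$ but degenerate over $\mathbb{F}_p$. (a) If $[F:\mathbb{F}_p]$ is a power of $2$, then $V_{F,d}\le \frac12[F:\mathbb{F}_p]$. (b) Otherwise $V_{F,d}\le\frac23[F:\mathbb{F}_p]$. (iii) Suppose $d$ is nondegenerate over $\mathbb{F}_p$ (so $p\ge 5$). (a) If $p\equiv 1\pmod 4$ and $[F:\mathbb{F}_p]$ is odd, then $V_{F,d}\le\frac12[F:\mathbb{F}_p]$. (b) Otherwise $V_{F,d}\le \frac{1}{p-1}\left\lceil\frac{p-1}{3}\right\rceil[F:\mathbb{F}_p]$.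
   Context: $\psi$ is the canonical additive character of $F$: $\psi(x)=e^{2\pi i\operatorname{Tr}(x)/p}$, where $\operatorname{Tr}(x)=x+x^p+\cdots+x^{p^{n-1}}$ is the absolute trace $F\to\mathbb{F}_p$. The $p$-adic valuation $\operatorname{val}_p$ is extended from $\mathbb{Q}$ to $\mathbb{Q}(e^{2\pi i/p})$ so that $\operatorname{val}_p(1-e^{2\pi i/p})=1/(p-1)$ (so $\operatorname{val}_p(p)=1$, and $\operatorname{val}_p(0)=+\infty$). For a subfield $K$ of $F$, the exponent $d$ is called degenerate over $K$ if $d$ is congruent to a power of $p$ modulo $|K|-1$, and nondegenerate over $K$ otherwise. -}

module Defs where

open import Level using (0ℓ)
open import Data.Nat using (ℕ; zero; suc; _^_; _∸_)
open import Data.Integer as ℤ using (ℤ; +_)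
open import Data.Integer.Divisibility using () renaming (_∣_ to _∣ℤ_)
open import Data.List using (List; []; _∷_; length; map; foldr; replicate; upTo; _++_)
open import Data.List.Relation.Unary.Any using (Any)
open import Data.List.Relation.Unary.AllPairs using (AllPairs)
open import Data.Product using (∃-syntax; _×_)
open import Data.Bool using (if_then_else_)
open import Relation.Nullary using (¬_; does)
open import Relation.Binary using (Decidable)
open import Relation.Binary.PropositionalEquality using (_≡_)
open import Algebra.Bundles using (CommutativeRing)

-- Integer polynomials (coefficient lists, lowest degree first) and the
-- ring ℤ[ζ_p] ≅ ℤ[X]/(Φ_p), Φ_p = 1 + X + ... + X^(p-1).

Poly : Set
Poly = List ℤ

coeff : Poly → ℕ → ℤ
coeff []       _       = + 0
coeff (a ∷ f)  zero    = a
coeff (a ∷ f)  (suc i) = coeff f i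

_⊕_ : Poly → Poly → Poly
[]      ⊕ g       = g
(a ∷ f) ⊕ []      = a ∷ f
(a ∷ f) ⊕ (b ∷ g) = (a ℤ.+ b) ∷ (f ⊕ g)

_⊛_ : Poly → Poly → Poly
[]      ⊛ g = []
(a ∷ f) ⊛ g = map (a ℤ.*_) g ⊕ (+ 0 ∷ (f ⊛ g))

monomial : ℕ → Poly
monomial k = replicate k (+ 0) ++ (+ 1 ∷ [])

Φ : ℕ → Poly
Φ p = replicate p (+ 1)

π : Poly
π = + 1 ∷ ℤ.- (+ 1) ∷ []

πpow : ℕ → Poly
πpow zero    = + 1 ∷ []
πpow (suc k) = π ⊛ πpow k

-- Equality in ℤ[ζ_p]: w ≡ v modulo Φ_p.
-- πDiv p k w : π^k divides w in ℤ[ζ_p], i.e. w = π^k y + Φ_p z in ℤ[X].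
πDiv : ℕ → ℕ → Poly → Set
πDiv p k w = ∃[ y ] ∃[ z ] (∀ i → coeff w i ≡ coeff ((πpow k ⊛ y) ⊕ (Φ p ⊛ z)) i)

-- Since val_p(π) = 1/(p-1), for w ∈ ℤ[ζ_p]:
--   val_p(w) ≥ k/(p-1)  ⇔  πDiv p k w
--   val_p(w) ≤ k/(p-1)  ⇔  ¬ πDiv p (k+1) w     (val_p(0) = ∞ never satisfies this)
ValGe : ℕ → Poly → ℕ → Set
ValGe p w k = πDiv p k w

ValLe : ℕ → Poly → ℕ → Set
ValLe p w k = ¬ πDiv p (suc k) w

record FiniteField : Set₁ where
  field
    commRing : CommutativeRing 0ℓ 0ℓ
  open CommutativeRing commRing public
  field
    _≟_      : Decidable _≈_
    0≉1      : ¬ (0# ≈ 1#)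
    inverse  : ∀ x → ¬ (x ≈ 0#) → ∃[ y ] (x * y ≈ 1#)
    elems    : List Carrier
    complete : ∀ x → Any (x ≈_) elems
    distinct : AllPairs (λ a b → ¬ (a ≈ b)) elems

module _ (F : FiniteField) where
  open FiniteField F

  pow : Carrier → ℕ → Carrier
  pow x zero    = 1#
  pow x (suc d) = x * pow x d

  natF : ℕ → Carrier
  natF zero    = 0#
  natF (suc k) = 1# + natF k

  order : ℕ
  order = length elems

  trace : ℕ → ℕ → Carrier → Carrier
  trace p zero    x = 0#
  trace p (suc i) x = pow x (p ^ i) + trace p i x

  primeIdx : Carrier → List ℕ → ℕ
  primeIdx t []       = 0
  primeIdx t (k ∷ ks) = if does (natF k ≟ t) then k else primeIdx t ks

  -- Tr(x) ∈ 𝔽_p as a number in {0,..,p-1}, so ψ(x) = ζ_p ^ trIdx x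
  trIdx : ℕ → ℕ → Carrier → ℕ
  trIdx p n x = primeIdx (trace p n x) (upTo p)

  W : ℕ → ℕ → ℕ → Carrier → Poly
  W p n d a = foldr _⊕_ [] (map (λ x → monomial (trIdx p n (pow x d - a * x))) elems)

-- d is degenerate over a field K with |K| = m+1 (characteristic p):
-- d ≡ p^i (mod m) for some i ≥ 0.
Degenerate : ℕ → ℕ → ℕ → Set
Degenerate p m d = ∃[ i ] ((+ m) ∣ℤ ((+ d) ℤ.- (+ (p ^ i))))

{-# OPTIONS --safe #-}
-- Let N = n (p - 1), so that q is π^N times a unit at π = 1 - ζ_p, and suppose that π^K divides
-- every W(a). As d is invertible modulo q - 1 and K ≤ N, then π^K divides every sum of
-- ψ(c x^d + b x) over x. Two consequences replace Gauss sums and Stickelberger's theorem.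
--
-- Digit sums. π^K divides the sum over x of any product of factors 1 - ψ(c x^d + b x), and
-- 1 - ψ(y) = π [Tr y] with [t] ≡ t (mod π). So a product of fewer than K forms Tr(c x^d + b x) sums
-- to zero in F. Each Frobenius power is a combination of traces, hence x^E sums to zero as soon as
-- E is a sum of fewer than K terms d p^u or p^u; for q - 1 | E > 0 this is absurd. The bounds with
-- 1/2 and 1/3 follow from explicit J, J′ with q - 1 | d J + J′ and small base p digit sums.
--
-- Third moments. If 3 K > 2 N, orthogonality shows that every line of the projective plane over F
-- meets the curve x^d + y^d + z^d = 0. That curve has q + 1 points, so it is a line, x ↦ x^d is
-- additive, and d is degenerate.
module Submission where

open import Defs
open import Level using (0ℓ)
open import Algebra.Bundles using (CommutativeRing; CommutativeMonoid; RawRing)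
open import Algebra.Structures using (IsAbelianGroup)
open import Data.Bool using (Bool; if_then_else_; true; false)
open import Data.Empty using (⊥; ⊥-elim)
open import Data.Fin using (zero; suc; toℕ; fromℕ; inject₁)
open import Data.Integer as ℤ using (ℤ; +_; -[1+_])
open import Data.Integer.Solver using () renaming (module +-*-Solver to ℤSolver)
open import Data.List using (List; []; _∷_; _++_; length; map; foldr; replicate; upTo; applyUpTo)
open import Data.List.Properties using (length-++; length-replicate; length-applyUpTo; length-map)
open import Data.List.Relation.Unary.All as All using (All; []; _∷_; all?)
open import Data.List.Relation.Unary.All.Properties using (¬All⇒Any¬)
open import Data.List.Relation.Unary.AllPairs as AllPairs using (AllPairs; []; _∷_)
open import Data.List.Relation.Unary.Any using (Any; here; there; any?; satisfied)
open import Data.Maybe using (Maybe; just; nothing)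
open import Data.Nat as ℕ using (ℕ; zero; suc; _≤_; _<_; _*_; _+_; _^_; _∸_; _/_; _%_; _!; NonZero; z≤n; s≤s)
open import Data.Nat.Combinatorics using (nCk≡n!/k![n-k]!; k![n∸k]!∣n!; nCn≡1) renaming (_C_ to _choose_)
open import Data.Nat.Coprimality using (Coprime; coprime-Bézout; gcd≡1⇒coprime) renaming (sym to coprime-sym)
open import Data.Nat.Divisibility as ℕ using (_∣_; divides)
open import Data.Nat.GCD using (gcd; module Bézout)
open import Data.Nat.Primality using (Prime; euclidsLemma; prime⇒irreducible; prime⇒nonZero; prime⇒nonTrivial)
open import Data.Nat.Tactic.RingSolver using () renaming (solve-∀ to ℕ-solve-∀)
open import Data.Product using (∃-syntax; _×_; _,_; proj₁; proj₂)
open import Data.Sum using (_⊎_; inj₁; inj₂)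
open import Data.Vec.Functional using (Vector; init; last)
open import Relation.Binary using (Setoid)
open import Relation.Binary.Definitions using (tri<; tri≈; tri>)
open import Relation.Binary.PropositionalEquality as ≡ using (_≡_; cong; cong₂; subst; subst₂)
open import Relation.Nullary using (¬_; does; Dec; yes; no; contradiction)
open import Relation.Nullary.Decidable using (¬?; decidable-stable)
import Algebra.Properties.CommutativeSemigroup as CommutativeSemigroupProperties
import Algebra.Properties.CommutativeSemiring.Binomial as Binomial
import Algebra.Properties.CommutativeSemiring.Exp as CommutativeSemiringExp
import Algebra.Properties.Ring as RingProperties
import Algebra.Properties.Semiring.Exp as SemiringExp
import Algebra.Properties.Semiring.Mult as SemiringMult
import Algebra.Properties.Semiring.Mult.TCOptimised as OptimisedMult
import Algebra.Properties.Semiring.Sum as SemiringSum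
import Algebra.Solver.Ring as RingSolver
import Algebra.Solver.Ring.AlmostCommutativeRing as ACR
import Data.Fin.Properties as Finₚ
import Data.Integer.Divisibility.Signed as ℤ∣
import Data.Integer.Properties as ℤ
import Data.List.Relation.Unary.All.Properties as Allₚ
import Data.List.Relation.Unary.AllPairs.Properties as AllPairsₚ
import Data.List.Relation.Unary.Any.Properties as Anyₚ
import Data.Nat.DivMod as ℕ
import Data.Nat.Properties as ℕ
import Relation.Binary.Reasoning.Setoid as SetoidReasoning

-- Divisibility passes from the W(a) to all sums of ψ(c x^d + b x) by a scaling of x that normalises
-- c to 1; c = 0 leaves 0 or q, whence the condition K ≤ N. Short multiples are found over a small
-- subfield and carried to F by repeating digits, which keeps the ratio of digit sum to degree. If d
-- is nondegenerate over 𝔽_p, the congruence d x + y ≡ 0 (mod p - 1) has a solution of small weight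
-- x + y, except when d ≡ 1 + (p - 1)/2. There the prime field gives only 1/2, and the better bound
-- needs the field of order p², where coprimality of d to (p + 1)/2 excludes the one bad residue
-- class. Hence the role of the parity of n in (iii). If n is a power of 2, F is reached by
-- quadratic steps, and d turns nondegenerate at one of them, from order Q to order Q². Up to a
-- power of p it is then ≡ 1 (mod Q - 1), a Niho exponent, for which half of the maximal digit sum
-- suffices. Existence of a is obtained by search over F, since divisibility by π^k is decidable.

module IntegerImage (R : CommutativeRing 0ℓ 0ℓ) where
  open CommutativeRing R hiding (zero) renaming (_+_ to _+ᴿ_; _*_ to _*ᴿ_; -_ to -ᴿ_)
  open SemiringMult semiring using (×-homo-+; ×1-homo-*) renaming (_×_ to _·_)
  open OptimisedMult semiring using (×ᵤ≈×) renaming (_×_ to _·′_)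
  open RingProperties ring
  open SetoidReasoning setoid

  ι : ℤ → Carrier
  ι (+ n)    = n · 1#
  ι -[1+ n ] = -ᴿ (suc n · 1#)

  ι-⊖ : ∀ m n → ι (m ℤ.⊖ n) ≈ m · 1# +ᴿ -ᴿ (n · 1#)
  ι-⊖ zero    zero    = sym (-‿inverseʳ 0#)
  ι-⊖ zero    (suc n) = sym (+-identityˡ _)
  ι-⊖ (suc m) zero    = sym (trans (+-congˡ -0#≈0#) (+-identityʳ _))
  ι-⊖ (suc m) (suc n) = begin
    ι (suc m ℤ.⊖ suc n)  ≡⟨ cong ι (ℤ.[1+m]⊖[1+n]≡m⊖n m n) ⟩
    ι (m ℤ.⊖ n)  ≈⟨ ι-⊖ m n ⟩
    m · 1# +ᴿ -ᴿ (n · 1#)  ≈⟨ +-congʳ (sym (+-identityʳ _)) ⟩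
    m · 1# +ᴿ 0# +ᴿ -ᴿ (n · 1#)  ≈⟨ +-congʳ (+-congˡ (sym (-‿inverseʳ 1#))) ⟩
    m · 1# +ᴿ (1# +ᴿ -ᴿ 1#) +ᴿ -ᴿ (n · 1#)  ≈⟨ +-congʳ (sym (+-assoc _ _ _)) ⟩
    m · 1# +ᴿ 1# +ᴿ -ᴿ 1# +ᴿ -ᴿ (n · 1#)  ≈⟨ +-assoc _ _ _ ⟩
    m · 1# +ᴿ 1# +ᴿ (-ᴿ 1# +ᴿ -ᴿ (n · 1#))  ≈⟨ +-cong (+-comm _ _) (-‿+-comm _ _) ⟩
    suc m · 1# +ᴿ -ᴿ (suc n · 1#)  ∎

  ι-+ : ∀ i j → ι (i ℤ.+ j) ≈ ι i +ᴿ ι j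
  ι-+ (+ m)      (+ n)      = ×-homo-+ 1# m n
  ι-+ (+ m)      -[1+ n ]   = ι-⊖ m (suc n)
  ι-+ -[1+ m ]   (+ n)      = trans (ι-⊖ n (suc m)) (+-comm _ _)
  ι-+ -[1+ m ]   -[1+ n ]   = begin
    -ᴿ (suc (suc (m + n)) · 1#)  ≡⟨ cong (λ k → -ᴿ (suc k · 1#)) (≡.sym (ℕ.+-suc m n)) ⟩
    -ᴿ ((suc m + suc n) · 1#)  ≈⟨ -‿cong (×-homo-+ 1# (suc m) (suc n)) ⟩
    -ᴿ (suc m · 1# +ᴿ suc n · 1#)  ≈⟨ sym (-‿+-comm _ _) ⟩
    -ᴿ (suc m · 1#) +ᴿ -ᴿ (suc n · 1#)  ∎

  ι-neg : ∀ i → ι (ℤ.- i) ≈ -ᴿ ι i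
  ι-neg (+ zero)   = sym -0#≈0#
  ι-neg (+ suc n)  = refl
  ι-neg -[1+ n ]   = sym (-‿involutive _)

  ι-*-+ : ∀ m j → ι (+ m ℤ.* j) ≈ ι (+ m) *ᴿ ι j
  ι-*-+ m (+ n)    = trans (reflexive (cong ι (≡.sym (ℤ.pos-* m n)))) (×1-homo-* m n)
  ι-*-+ m -[1+ n ] = begin
    ι (+ m ℤ.* ℤ.- (+ suc n))  ≡⟨ cong ι (≡.sym (ℤ.neg-distribʳ-* (+ m) (+ suc n))) ⟩
    ι (ℤ.- (+ m ℤ.* + suc n))  ≈⟨ ι-neg (+ m ℤ.* + suc n) ⟩
    -ᴿ ι (+ m ℤ.* + suc n)  ≈⟨ -‿cong (ι-*-+ m (+ suc n)) ⟩
    -ᴿ (ι (+ m) *ᴿ ι (+ suc n))  ≈⟨ -‿distribʳ-* _ _ ⟩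
    ι (+ m) *ᴿ -ᴿ ι (+ suc n)  ∎

  ι-* : ∀ i j → ι (i ℤ.* j) ≈ ι i *ᴿ ι j
  ι-* (+ m)    j = ι-*-+ m j
  ι-* -[1+ m ] j = begin
    ι (ℤ.- (+ suc m) ℤ.* j)  ≡⟨ cong ι (≡.sym (ℤ.neg-distribˡ-* (+ suc m) j)) ⟩
    ι (ℤ.- (+ suc m ℤ.* j))  ≈⟨ ι-neg (+ suc m ℤ.* j) ⟩
    -ᴿ ι (+ suc m ℤ.* j)  ≈⟨ -‿cong (ι-*-+ (suc m) j) ⟩
    -ᴿ (ι (+ suc m) *ᴿ ι j)  ≈⟨ -‿distribˡ-* _ _ ⟩
    -ᴿ ι (+ suc m) *ᴿ ι j  ∎

  private
    ℤ-rawRing : RawRing 0ℓ 0ℓ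
    ℤ-rawRing = CommutativeRing.rawRing ℤ.+-*-commutativeRing

    -- Unlike ι, ι′ sends + 1 to 1# definitionally, so that solver constants match ring constants.
    ι′ : ℤ → Carrier
    ι′ (+ n)    = n ·′ 1#
    ι′ -[1+ n ] = -ᴿ (suc n ·′ 1#)

    ι′≈ι : ∀ i → ι′ i ≈ ι i
    ι′≈ι (+ n)    = sym (×ᵤ≈× n 1#)
    ι′≈ι -[1+ n ] = -‿cong (sym (×ᵤ≈× (suc n) 1#))

    ι′-morphism : ℤ-rawRing ACR.-Raw-AlmostCommutative⟶ ACR.fromCommutativeRing R
    ι′-morphism = record
      { ⟦_⟧    = ι′
      ; +-homo = λ i j → trans (ι′≈ι (i ℤ.+ j)) (trans (ι-+ i j) (sym (+-cong (ι′≈ι i) (ι′≈ι j))))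
      ; *-homo = λ i j → trans (ι′≈ι (i ℤ.* j)) (trans (ι-* i j) (sym (*-cong (ι′≈ι i) (ι′≈ι j))))
      ; -‿homo = λ i → trans (ι′≈ι (ℤ.- i)) (trans (ι-neg i) (sym (-‿cong (ι′≈ι i))))
      ; 0-homo = refl
      ; 1-homo = refl
      }

    ι′-≟ : ∀ i j → Maybe (ι′ i ≈ ι′ j)
    ι′-≟ i j with i ℤ.≟ j
    ... | yes i≡j = just (reflexive (cong ι′ i≡j))
    ... | no _    = nothing

  module Solver = RingSolver ℤ-rawRing (ACR.fromCommutativeRing R) ι′-morphism ι′-≟

-- Finite sums over lists

module ListSum (M : CommutativeMonoid 0ℓ 0ℓ) where
  open CommutativeMonoid M
  open CommutativeSemigroupProperties commutativeSemigroup using (interchange) public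

  sum : {X : Set} → List X → (X → Carrier) → Carrier
  sum []       f = ε
  sum (x ∷ xs) f = f x ∙ sum xs f

  sum-cong : ∀ {X : Set} (xs : List X) {f g : X → Carrier} → (∀ x → f x ≈ g x) → sum xs f ≈ sum xs g
  sum-cong []       f≈g = refl
  sum-cong (x ∷ xs) f≈g = ∙-cong (f≈g x) (sum-cong xs f≈g)

  sum-ε : ∀ {X : Set} (xs : List X) → sum xs (λ _ → ε) ≈ ε
  sum-ε []       = refl
  sum-ε (x ∷ xs) = trans (identityˡ _) (sum-ε xs)

  sum-∙ : ∀ {X : Set} (xs : List X) (f g : X → Carrier) → sum xs (λ x → f x ∙ g x) ≈ sum xs f ∙ sum xs g
  sum-∙ []       f g = sym (identityˡ ε)
  sum-∙ (x ∷ xs) f g = trans (∙-congˡ (sum-∙ xs f g)) (interchange (f x) (g x) (sum xs f) (sum xs g))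

  sum-swap : ∀ {X Y : Set} (xs : List X) (ys : List Y) (f : X → Y → Carrier) →
             sum xs (λ x → sum ys (f x)) ≈ sum ys (λ y → sum xs (λ x → f x y))
  sum-swap []       ys f = sym (sum-ε ys)
  sum-swap (x ∷ xs) ys f = trans (∙-congˡ (sum-swap xs ys f)) (sym (sum-∙ ys (f x) _))

-- Binomial coefficients modulo p

prime≥2 : ∀ {p} → Prime p → 2 ≤ p
prime≥2 {p} p-prime = ℕ.nonTrivial⇒n>1 p {{prime⇒nonTrivial p-prime}}

prime∤! : ∀ {p} → Prime p → ∀ k → k < p → ¬ (p ∣ k !)
prime∤! pp zero    k<p p∣1 = ℕ.<⇒≱ (prime≥2 pp) (ℕ.∣⇒≤ p∣1)
prime∤! pp (suc k) k<p p∣k! with euclidsLemma (suc k) (k !) pp p∣k!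
... | inj₁ p∣k = ℕ.<⇒≱ k<p (ℕ.∣⇒≤ p∣k)
... | inj₂ p∣k! = prime∤! pp k (ℕ.<-trans (ℕ.n<1+n k) k<p) p∣k!

-- p divides p! = C(p , k) k! (p - k)!, while `prime∤!` keeps it out of the two factorials.
prime∣C : ∀ {p} → Prime p → ∀ k → 1 ≤ k → k < p → p ∣ (p choose k)
prime∣C {suc p} pp k 1≤k k<p with euclidsLemma (suc p choose k) (k ! * (suc p ∸ k) !) pp p∣C*d
  where
  instance
    _ = k ℕ.!* (suc p ∸ k) !≢0
  p∣C*d : suc p ∣ (suc p choose k) * (k ! * (suc p ∸ k) !)
  p∣C*d = subst (suc p ∣_)
    (≡.sym (≡.trans (cong (_* (k ! * (suc p ∸ k) !)) (nCk≡n!/k![n-k]! (ℕ.<⇒≤ k<p)))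
                    (ℕ.m/n*n≡m (k![n∸k]!∣n! (ℕ.<⇒≤ k<p)))))
    (ℕ.m∣m*n (p !))
... | inj₁ p∣C = p∣C
... | inj₂ p∣d with euclidsLemma (k !) ((suc p ∸ k) !) pp p∣d
...   | inj₁ p∣k! = ⊥-elim (prime∤! pp k k<p p∣k!)
...   | inj₂ p∣l! = ⊥-elim (prime∤! pp (suc p ∸ k) (ℕ.∸-monoʳ-< 1≤k (ℕ.<⇒≤ k<p)) p∣l!)

module PrimePower (R : CommutativeRing 0ℓ 0ℓ) where
  open CommutativeRing R hiding (zero) renaming (_+_ to _+ᴿ_; _*_ to _*ᴿ_)
  open SemiringMult semiring using (×1-homo-*) renaming (_×_ to _·_)
  open SemiringExp semiring using () renaming (_^_ to _↑_)
  open SemiringSum semiring using () renaming (sum to ∑; sum-init-last to ∑-init-last)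
  open SetoidReasoning setoid

  ·≈* : ∀ n x → n · x ≈ n · 1# *ᴿ x
  ·≈* zero    x = sym (zeroˡ x)
  ·≈* (suc n) x = sym (trans (distribʳ x 1# (n · 1#)) (+-cong (*-identityˡ x) (sym (·≈* n x))))

  ∣⇒multiple : ∀ {p n} → p ∣ n → ∀ x → ∃[ g ] (n · x ≈ p · 1# *ᴿ g)
  ∣⇒multiple {p} {n} (divides c n≡cp) x = c · 1# *ᴿ x , (begin
    n · x  ≈⟨ ·≈* n x ⟩
    n · 1# *ᴿ x  ≡⟨ cong (λ k → k · 1# *ᴿ x) (≡.trans n≡cp (ℕ.*-comm c p)) ⟩
    (p * c) · 1# *ᴿ x  ≈⟨ *-congʳ (×1-homo-* p c) ⟩
    p · 1# *ᴿ c · 1# *ᴿ x  ≈⟨ *-assoc _ _ _ ⟩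
    p · 1# *ᴿ (c · 1# *ᴿ x)  ∎)

  ∑-multiple : ∀ c {n} (t : Vector Carrier n) → (∀ i → ∃[ g ] (t i ≈ c *ᴿ g)) → ∃[ g ] (∑ t ≈ c *ᴿ g)
  ∑-multiple c {zero}  t h = 0# , sym (zeroʳ c)
  ∑-multiple c {suc n} t h with h zero | ∑-multiple c (λ i → t (suc i)) (λ i → h (suc i))
  ... | g , tg | g' , tg' = g +ᴿ g' , trans (+-cong tg tg') (sym (distribˡ c g g'))

  -- The remainder p g is kept because the ring is arbitrary: in F it vanishes and gives Frobenius,
  -- in ℤ[X] it leads to the relation between p and (1 - X)^(p-1) modulo Φ_p.
  freshman : ∀ {p} → Prime p → ∀ x y → ∃[ g ] ((x +ᴿ y) ↑ p ≈ x ↑ p +ᴿ y ↑ p +ᴿ p · 1# *ᴿ g)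
  freshman {zero} pp with prime≥2 pp
  ... | ()
  freshman {suc p} pp x y with ∑-multiple (suc p · 1#) (init (λ k → term (suc k))) middle
    where
    term : Vector Carrier (suc (suc p))
    term = Binomial.binomialTerm commutativeSemiring x y (suc p)
    middle : ∀ i → ∃[ g ] (init (λ k → term (suc k)) i ≈ suc p · 1# *ᴿ g)
    middle i = ∣⇒multiple (prime∣C pp (suc (toℕ (inject₁ i))) (s≤s z≤n)
      (s≤s (subst (_< p) (≡.sym (Finₚ.toℕ-inject₁ i)) (Finₚ.toℕ<n i)))) _
  ... | g , ∑≈pg = g , (begin
    (x +ᴿ y) ↑ suc p  ≈⟨ Binomial.theorem commutativeSemiring (suc p) x y ⟩
    term zero +ᴿ ∑ (λ k → term (suc k))  ≈⟨ +-congˡ (∑-init-last (λ k → term (suc k))) ⟩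
    term zero +ᴿ (∑ (init (λ k → term (suc k))) +ᴿ last (λ k → term (suc k)))
                                                           ≈⟨ +-cong first (+-cong ∑≈pg final) ⟩
    y ↑ suc p +ᴿ (suc p · 1# *ᴿ g +ᴿ x ↑ suc p)  ≈⟨ +-comm _ _ ⟩
    suc p · 1# *ᴿ g +ᴿ x ↑ suc p +ᴿ y ↑ suc p  ≈⟨ +-assoc _ _ _ ⟩
    suc p · 1# *ᴿ g +ᴿ (x ↑ suc p +ᴿ y ↑ suc p)  ≈⟨ +-comm _ _ ⟩
    x ↑ suc p +ᴿ y ↑ suc p +ᴿ suc p · 1# *ᴿ g  ∎)
    where
    term : Vector Carrier (suc (suc p))
    term = Binomial.binomialTerm commutativeSemiring x y (suc p)
    first : term zero ≈ y ↑ suc p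
    first = trans (+-identityʳ _) (*-identityˡ _)
    final : last (λ k → term (suc k)) ≈ x ↑ suc p
    final = begin
      (suc p choose suc (toℕ (fromℕ p))) · (x ↑ suc (toℕ (fromℕ p)) *ᴿ y ↑ (p ∸ toℕ (fromℕ p)))
        ≡⟨ cong (λ k → (suc p choose suc k) · (x ↑ suc k *ᴿ y ↑ (p ∸ k))) (Finₚ.toℕ-fromℕ p) ⟩
      (suc p choose suc p) · (x ↑ suc p *ᴿ y ↑ (p ∸ p))
        ≡⟨ cong₂ (λ c e → c · (x ↑ suc p *ᴿ y ↑ e)) (nCn≡1 (suc p)) (ℕ.n∸n≡0 p) ⟩
      x ↑ suc p *ᴿ 1# +ᴿ 0#  ≈⟨ trans (+-identityʳ _) (*-identityʳ _) ⟩
      x ↑ suc p  ∎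

-- Sums over a finite field

module FieldSum (F : FiniteField) (M : CommutativeMonoid 0ℓ 0ℓ) where
  private module F = FiniteField F
  open CommutativeMonoid M
  open ListSum M public
  open SetoidReasoning setoid

  ∑F : (F.Carrier → Carrier) → Carrier
  ∑F = sum F.elems

  private
    at : F.Carrier → (F.Carrier → Carrier) → F.Carrier → Carrier
    at z f y = if does (y F.≟ z) then f y else ε

    at-yes : ∀ {z y} f → y F.≈ z → at z f y ≈ f y
    at-yes {z} {y} f y≈z with y F.≟ z
    ... | yes _  = refl
    ... | no y≉z = contradiction y≈z y≉z

    at-no : ∀ {z y} f → ¬ (y F.≈ z) → at z f y ≈ ε
    at-no {z} {y} f y≉z with y F.≟ z
    ... | yes y≈z = contradiction y≈z y≉z
    ... | no _    = refl

    sum-none : ∀ {z} f {ys} → All (λ y → ¬ (y F.≈ z)) ys → sum ys (at z f) ≈ ε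
    sum-none f []           = refl
    sum-none f (y≉z ∷ ys≉z) = trans (∙-cong (at-no f y≉z) (sum-none f ys≉z)) (identityˡ ε)

    sum-once : ∀ {z} f → (∀ {x y} → x F.≈ y → f x ≈ f y) → ∀ {ys} →
               AllPairs (λ a b → ¬ (a F.≈ b)) ys → Any (z F.≈_) ys → sum ys (at z f) ≈ f z
    sum-once f f-cong (y≉ys ∷ _) (here z≈y) =
      trans (∙-cong (trans (at-yes f (F.sym z≈y)) (f-cong (F.sym z≈y)))
                    (sum-none f (All.map (λ y≉x x≈z → y≉x (F.trans (F.sym z≈y) (F.sym x≈z))) y≉ys)))
            (identityʳ _)
    sum-once {z} f f-cong {y ∷ ys} (y≉ys ∷ dist) (there z∈ys) =
      trans (∙-cong (at-no f (λ y≈z → y∉ y≉ys z∈ys y≈z)) (sum-once f f-cong dist z∈ys)) (identityˡ _)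
      where
      y∉ : ∀ {xs} → All (λ b → ¬ (y F.≈ b)) xs → Any (z F.≈_) xs → y F.≈ z → ⊥
      y∉ (y≉b ∷ _) (here z≈b) y≈z = y≉b (F.trans y≈z z≈b)
      y∉ (_ ∷ y≉)  (there z∈) y≈z = y∉ y≉ z∈ y≈z

  ∑F-single : ∀ z f → (∀ {x y} → x F.≈ y → f x ≈ f y) →
              ∑F (λ y → if does (y F.≟ z) then f y else ε) ≈ f z
  ∑F-single z f f-cong = sum-once f f-cong F.distinct (F.complete z)

  -- Both sides are the double sum of f y over all pairs with y ≈ σ x.
  ∑F-reindex : (σ τ : F.Carrier → F.Carrier) →
               (∀ {x y} → x F.≈ y → σ x F.≈ σ y) → (∀ {x y} → x F.≈ y → τ x F.≈ τ y) →
               (∀ x → σ (τ x) F.≈ x) → (∀ x → τ (σ x) F.≈ x) →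
               ∀ f → (∀ {x y} → x F.≈ y → f x ≈ f y) → ∑F (λ x → f (σ x)) ≈ ∑F f
  ∑F-reindex σ τ σ-cong τ-cong στ τσ f f-cong = begin
    ∑F (λ x → f (σ x))  ≈⟨ sum-cong F.elems (λ x → sym (∑F-single (σ x) f f-cong)) ⟩
    ∑F (λ x → ∑F (at (σ x) f))  ≈⟨ sum-swap F.elems F.elems _ ⟩
    ∑F (λ y → ∑F (λ x → at (σ x) f y))  ≈⟨ sum-cong F.elems (λ y → sum-cong F.elems (λ x → flip x y)) ⟩
    ∑F (λ y → ∑F (at (τ y) (λ _ → f y)))  ≈⟨ sum-cong F.elems (λ y → ∑F-single (τ y) (λ _ → f y) (λ _ → refl)) ⟩
    ∑F f  ∎
    where
    flip : ∀ x y → at (σ x) f y ≈ at (τ y) (λ _ → f y) x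
    flip x y with y F.≟ σ x
    ... | yes y≈σx = sym (at-yes (λ _ → f y) (F.trans (F.sym (τσ x)) (τ-cong (F.sym y≈σx))))
    ... | no  y≉σx = sym (at-no (λ _ → f y) (λ x≈τy → y≉σx (F.trans (F.sym (στ y)) (σ-cong (F.sym x≈τy)))))

module RingSum (R : CommutativeRing 0ℓ 0ℓ) where
  open CommutativeRing R hiding (zero) renaming (_*_ to _*ᴿ_)
  open SemiringMult semiring using () renaming (_×_ to _·_)
  open ListSum +-commutativeMonoid using (sum)

  *-distribˡ-sum : ∀ {X : Set} (xs : List X) c f → c *ᴿ sum xs f ≈ sum xs (λ x → c *ᴿ f x)
  *-distribˡ-sum []       c f = zeroʳ c
  *-distribˡ-sum (x ∷ xs) c f = trans (distribˡ c (f x) (sum xs f)) (+-congˡ (*-distribˡ-sum xs c f))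

  *-distribʳ-sum : ∀ {X : Set} (xs : List X) c f → sum xs f *ᴿ c ≈ sum xs (λ x → f x *ᴿ c)
  *-distribʳ-sum []       c f = zeroˡ c
  *-distribʳ-sum (x ∷ xs) c f = trans (distribʳ c (f x) (sum xs f)) (+-congˡ (*-distribʳ-sum xs c f))

  sum-const : ∀ {X : Set} (xs : List X) c → sum xs (λ _ → c) ≈ length xs · c
  sum-const []       c = refl
  sum-const (x ∷ xs) c = +-congˡ (sum-const xs c)

-- The polynomial ring ℤ[X] on coefficient lists

infix 4 _≋_

-- Lists differing by trailing zeros are identified. As a record, an equality determines f and g,
-- which a bare family of equations between coefficients would not.
record _≋_ (f g : Poly) : Set where
  constructor coeffwise
  field
    coeff-≡ : ∀ i → coeff f i ≡ coeff g i

open _≋_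

module Polynomials where
  private
    neg : Poly → Poly
    neg = map (λ a → ℤ.- a)

    scale : ℤ → Poly → Poly
    scale a = map (a ℤ.*_)

    shift : Poly → Poly
    shift f = + 0 ∷ f

  coeff-⊕ : ∀ f g i → coeff (f ⊕ g) i ≡ coeff f i ℤ.+ coeff g i
  coeff-⊕ []      g       i       = ≡.sym (ℤ.+-identityˡ _)
  coeff-⊕ (a ∷ f) []      zero    = ≡.sym (ℤ.+-identityʳ _)
  coeff-⊕ (a ∷ f) []      (suc i) = ≡.sym (ℤ.+-identityʳ _)
  coeff-⊕ (a ∷ f) (b ∷ g) zero    = ≡.refl
  coeff-⊕ (a ∷ f) (b ∷ g) (suc i) = coeff-⊕ f g i

  coeff-scale : ∀ a f i → coeff (scale a f) i ≡ a ℤ.* coeff f i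
  coeff-scale a []      i       = ≡.sym (ℤ.*-zeroʳ a)
  coeff-scale a (b ∷ f) zero    = ≡.refl
  coeff-scale a (b ∷ f) (suc i) = coeff-scale a f i

  private
    coeff-neg : ∀ f i → coeff (neg f) i ≡ ℤ.- coeff f i
    coeff-neg []      i       = ≡.refl
    coeff-neg (b ∷ f) zero    = ≡.refl
    coeff-neg (b ∷ f) (suc i) = coeff-neg f i

    ≋-refl : ∀ {f} → f ≋ f
    ≋-refl = coeffwise λ i → ≡.refl

    ≋-sym : ∀ {f g} → f ≋ g → g ≋ f
    ≋-sym e = coeffwise λ i → ≡.sym (coeff-≡ e i)

    ≋-trans : ∀ {f g h} → f ≋ g → g ≋ h → f ≋ h
    ≋-trans e e' = coeffwise λ i → ≡.trans (coeff-≡ e i) (coeff-≡ e' i)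

    ≋-setoid : Setoid 0ℓ 0ℓ
    ≋-setoid = record
      { Carrier = Poly
      ; _≈_ = _≋_
      ; isEquivalence = record { refl = ≋-refl ; sym = ≋-sym ; trans = ≋-trans }
      }

    ⊕-cong : ∀ {f f' g g'} → f ≋ f' → g ≋ g' → f ⊕ g ≋ f' ⊕ g'
    ⊕-cong {f} {f'} {g} {g'} e e' = coeffwise λ i →
      ≡.trans (coeff-⊕ f g i) (≡.trans (cong₂ ℤ._+_ (coeff-≡ e i) (coeff-≡ e' i)) (≡.sym (coeff-⊕ f' g' i)))

    ⊕-assoc : ∀ f g h → (f ⊕ g) ⊕ h ≋ f ⊕ (g ⊕ h)
    ⊕-assoc f g h = coeffwise λ i → begin
      coeff ((f ⊕ g) ⊕ h) i  ≡⟨ coeff-⊕ (f ⊕ g) h i ⟩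
      coeff (f ⊕ g) i ℤ.+ coeff h i  ≡⟨ cong (ℤ._+ coeff h i) (coeff-⊕ f g i) ⟩
      coeff f i ℤ.+ coeff g i ℤ.+ coeff h i  ≡⟨ ℤ.+-assoc (coeff f i) _ _ ⟩
      coeff f i ℤ.+ (coeff g i ℤ.+ coeff h i)  ≡⟨ cong (λ c → coeff f i ℤ.+ c) (coeff-⊕ g h i) ⟨
      coeff f i ℤ.+ coeff (g ⊕ h) i  ≡⟨ coeff-⊕ f (g ⊕ h) i ⟨
      coeff (f ⊕ (g ⊕ h)) i  ∎
      where open ≡.≡-Reasoning

    ⊕-comm : ∀ f g → f ⊕ g ≋ g ⊕ f
    ⊕-comm f g = coeffwise λ i →
      ≡.trans (coeff-⊕ f g i) (≡.trans (ℤ.+-comm (coeff f i) _) (≡.sym (coeff-⊕ g f i)))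

    ⊕-identityʳ : ∀ f → f ⊕ [] ≋ f
    ⊕-identityʳ f = ⊕-comm f []

    ⊕-inverseʳ : ∀ f → f ⊕ neg f ≋ []
    ⊕-inverseʳ f = coeffwise λ i →
      ≡.trans (coeff-⊕ f (neg f) i) (≡.trans (cong (λ c → coeff f i ℤ.+ c) (coeff-neg f i)) (ℤ.+-inverseʳ (coeff f i)))

    neg-cong : ∀ {f g} → f ≋ g → neg f ≋ neg g
    neg-cong {f} {g} e = coeffwise λ i →
      ≡.trans (coeff-neg f i) (≡.trans (cong (λ a → ℤ.- a) (coeff-≡ e i)) (≡.sym (coeff-neg g i)))

    ⊕-abelian : IsAbelianGroup _≋_ _⊕_ [] neg
    ⊕-abelian = record
      { isGroup = record
        { isMonoid = record
          { isSemigroup = record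
            { isMagma = record { isEquivalence = Setoid.isEquivalence ≋-setoid ; ∙-cong = ⊕-cong }
            ; assoc = ⊕-assoc
            }
          ; identity = (λ f → ≋-refl) , ⊕-identityʳ
          }
        ; inverse = (λ f → ≋-trans (⊕-comm (neg f) f) (⊕-inverseʳ f)) , ⊕-inverseʳ
        ; ⁻¹-cong = neg-cong
        }
      ; comm = ⊕-comm
      }

    ⊕-commutativeMonoid : CommutativeMonoid 0ℓ 0ℓ
    ⊕-commutativeMonoid = record { isCommutativeMonoid = IsAbelianGroup.isCommutativeMonoid ⊕-abelian }

    open ListSum ⊕-commutativeMonoid using (interchange)
    open SetoidReasoning ≋-setoid

    shift-cong : ∀ {f g} → f ≋ g → shift f ≋ shift g
    shift-cong e = coeffwise λ { zero → ≡.refl ; (suc i) → coeff-≡ e i }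

    shift-[] : shift [] ≋ []
    shift-[] = coeffwise λ { zero → ≡.refl ; (suc i) → ≡.refl }

    scale-cong : ∀ a {f g} → f ≋ g → scale a f ≋ scale a g
    scale-cong a {f} {g} e = coeffwise λ i →
      ≡.trans (coeff-scale a f i) (≡.trans (cong (a ℤ.*_) (coeff-≡ e i)) (≡.sym (coeff-scale a g i)))

    scale-⊕ : ∀ a f g → scale a (f ⊕ g) ≋ scale a f ⊕ scale a g
    scale-⊕ a []      g       = ≋-refl
    scale-⊕ a (b ∷ f) []      = ≋-refl
    scale-⊕ a (b ∷ f) (c ∷ g) = coeffwise λ
      { zero → ℤ.*-distribˡ-+ a b c ; (suc i) → coeff-≡ (scale-⊕ a f g) i }

    scale-shift : ∀ a f → scale a (shift f) ≋ shift (scale a f)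
    scale-shift a f = coeffwise λ { zero → ℤ.*-zeroʳ a ; (suc i) → ≡.refl }

    scale-scale : ∀ a b f → scale (a ℤ.* b) f ≋ scale a (scale b f)
    scale-scale a b []      = ≋-refl
    scale-scale a b (c ∷ f) = coeffwise λ { zero → ℤ.*-assoc a b c ; (suc i) → coeff-≡ (scale-scale a b f) i }

    scale-1 : ∀ f → scale (+ 1) f ≋ f
    scale-1 f = coeffwise λ i → ≡.trans (coeff-scale (+ 1) f i) (ℤ.*-identityˡ _)

    scale-0 : ∀ f → scale (+ 0) f ≋ []
    scale-0 f = coeffwise λ i → coeff-scale (+ 0) f i

    ⊛-congʳ : ∀ f {g g'} → g ≋ g' → f ⊛ g ≋ f ⊛ g'
    ⊛-congʳ []      e = ≋-refl
    ⊛-congʳ (a ∷ f) e = ⊕-cong (scale-cong a e) (shift-cong (⊛-congʳ f e))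

    ⊛-zeroʳ : ∀ f → f ⊛ [] ≋ []
    ⊛-zeroʳ []      = ≋-refl
    ⊛-zeroʳ (a ∷ f) = ≋-trans (shift-cong (⊛-zeroʳ f)) shift-[]

    -- `_⊛_` recurses on its left factor; this is the matching recursion on the right, from which
    -- commutativity follows by induction.
    ⊛-∷ʳ : ∀ f b g → f ⊛ (b ∷ g) ≋ scale b f ⊕ shift (f ⊛ g)
    ⊛-∷ʳ []      b g = ≋-sym shift-[]
    ⊛-∷ʳ (a ∷ f) b g = coeffwise λ
      { zero    → cong (ℤ._+ + 0) (ℤ.*-comm a b)
      ; (suc i) → coeff-≡ tail i
      }
      where
      tail : scale a g ⊕ (f ⊛ (b ∷ g)) ≋ scale b f ⊕ (scale a g ⊕ shift (f ⊛ g))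
      tail = begin
        scale a g ⊕ (f ⊛ (b ∷ g))  ≈⟨ ⊕-cong ≋-refl (⊛-∷ʳ f b g) ⟩
        scale a g ⊕ (scale b f ⊕ shift (f ⊛ g))  ≈⟨ ≋-sym (⊕-assoc (scale a g) (scale b f) _) ⟩
        (scale a g ⊕ scale b f) ⊕ shift (f ⊛ g)  ≈⟨ ⊕-cong (⊕-comm (scale a g) (scale b f)) ≋-refl ⟩
        (scale b f ⊕ scale a g) ⊕ shift (f ⊛ g)  ≈⟨ ⊕-assoc (scale b f) (scale a g) _ ⟩
        scale b f ⊕ (scale a g ⊕ shift (f ⊛ g))  ∎

    ⊛-comm : ∀ f g → f ⊛ g ≋ g ⊛ f
    ⊛-comm []      g = ≋-sym (⊛-zeroʳ g)
    ⊛-comm (a ∷ f) g = ≋-trans (⊕-cong ≋-refl (shift-cong (⊛-comm f g))) (≋-sym (⊛-∷ʳ g a f))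

    ⊛-congˡ : ∀ g {f f'} → f ≋ f' → f ⊛ g ≋ f' ⊛ g
    ⊛-congˡ g {f} {f'} e = ≋-trans (⊛-comm f g) (≋-trans (⊛-congʳ g e) (⊛-comm g f'))

    ⊛-distribˡ : ∀ f g h → f ⊛ (g ⊕ h) ≋ (f ⊛ g) ⊕ (f ⊛ h)
    ⊛-distribˡ []      g h = ≋-refl
    ⊛-distribˡ (a ∷ f) g h = begin
      scale a (g ⊕ h) ⊕ shift (f ⊛ (g ⊕ h))  ≈⟨ ⊕-cong (scale-⊕ a g h) (shift-cong (⊛-distribˡ f g h)) ⟩
      (scale a g ⊕ scale a h) ⊕ (shift (f ⊛ g) ⊕ shift (f ⊛ h))  ≈⟨ interchange (scale a g) (scale a h) (shift (f ⊛ g)) (shift (f ⊛ h)) ⟩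
      (scale a g ⊕ shift (f ⊛ g)) ⊕ (scale a h ⊕ shift (f ⊛ h))  ∎

    ⊛-distribʳ : ∀ f g h → (g ⊕ h) ⊛ f ≋ (g ⊛ f) ⊕ (h ⊛ f)
    ⊛-distribʳ f g h = ≋-trans (⊛-comm (g ⊕ h) f) (≋-trans (⊛-distribˡ f g h) (⊕-cong (⊛-comm f g) (⊛-comm f h)))

    scale-⊛ : ∀ a f g → scale a f ⊛ g ≋ scale a (f ⊛ g)
    scale-⊛ a []      g = ≋-refl
    scale-⊛ a (b ∷ f) g = begin
      scale (a ℤ.* b) g ⊕ shift (scale a f ⊛ g)  ≈⟨ ⊕-cong (scale-scale a b g) (shift-cong (scale-⊛ a f g)) ⟩
      scale a (scale b g) ⊕ shift (scale a (f ⊛ g))  ≈⟨ ⊕-cong ≋-refl (≋-sym (scale-shift a (f ⊛ g))) ⟩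
      scale a (scale b g) ⊕ scale a (shift (f ⊛ g))  ≈⟨ ≋-sym (scale-⊕ a (scale b g) (shift (f ⊛ g))) ⟩
      scale a (scale b g ⊕ shift (f ⊛ g))  ∎

    shift-⊛ : ∀ f g → shift f ⊛ g ≋ shift (f ⊛ g)
    shift-⊛ f g = ⊕-cong (scale-0 g) ≋-refl

    ⊛-assoc : ∀ f g h → (f ⊛ g) ⊛ h ≋ f ⊛ (g ⊛ h)
    ⊛-assoc []      g h = ≋-refl
    ⊛-assoc (a ∷ f) g h = begin
      (scale a g ⊕ shift (f ⊛ g)) ⊛ h  ≈⟨ ⊛-distribʳ h (scale a g) (shift (f ⊛ g)) ⟩
      (scale a g ⊛ h) ⊕ (shift (f ⊛ g) ⊛ h)  ≈⟨ ⊕-cong (scale-⊛ a g h) (shift-⊛ (f ⊛ g) h) ⟩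
      scale a (g ⊛ h) ⊕ shift ((f ⊛ g) ⊛ h)  ≈⟨ ⊕-cong ≋-refl (shift-cong (⊛-assoc f g h)) ⟩
      scale a (g ⊛ h) ⊕ shift (f ⊛ (g ⊛ h))  ∎

    ⊛-identityˡ : ∀ f → (+ 1 ∷ []) ⊛ f ≋ f
    ⊛-identityˡ f = ≋-trans (⊕-cong (scale-1 f) shift-[]) (⊕-identityʳ f)

  ℤ[X] : CommutativeRing 0ℓ 0ℓ
  ℤ[X] = record
    { Carrier = Poly
    ; _≈_ = _≋_
    ; _+_ = _⊕_
    ; _*_ = _⊛_
    ; -_ = neg
    ; 0# = []
    ; 1# = + 1 ∷ []
    ; isCommutativeRing = record
      { isRing = record
        { +-isAbelianGroup = ⊕-abelian
        ; *-cong = λ {f} {f'} {g} {g'} e e' → ≋-trans (⊛-congˡ g e) (⊛-congʳ f' e')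
        ; *-assoc = ⊛-assoc
        ; *-identity = ⊛-identityˡ , (λ f → ≋-trans (⊛-comm f _) (⊛-identityˡ f))
        ; distrib = ⊛-distribˡ , ⊛-distribʳ
        }
      ; *-comm = ⊛-comm
      }
    }

  ∷-as-sum : ∀ a f → a ∷ f ≋ (a ∷ []) ⊕ shift f
  ∷-as-sum a f = coeffwise λ { zero → ≡.sym (ℤ.+-identityʳ a) ; (suc i) → ≡.refl }

open Polynomials using (ℤ[X])

-- Evaluation at 1 and division by 1 - X

module Evaluation where
  open CommutativeRing ℤ[X] hiding (zero) renaming (_+_ to _+ᴿ_; _*_ to _*ᴿ_; -_ to -ᴿ_)
  open SemiringExp semiring using () renaming (_^_ to _↑_)
  open IntegerImage ℤ[X] using (module Solver)
  open Solver using (_:+_; _:*_; _:-_; :-_; _:=_; con; solve)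
  open SetoidReasoning setoid

  X : Poly
  X = + 0 ∷ + 1 ∷ []

  const : ℤ → Poly
  const a = a ∷ []

  eval₁ : Poly → ℤ
  eval₁ []      = + 0
  eval₁ (a ∷ f) = a ℤ.+ eval₁ f

  eval₁-0 : ∀ {f} → f ≋ [] → eval₁ f ≡ + 0
  eval₁-0 {[]}    e = ≡.refl
  eval₁-0 {a ∷ f} e = cong₂ ℤ._+_ (coeff-≡ e 0) (eval₁-0 {f} (coeffwise λ i → coeff-≡ e (suc i)))

  eval₁-cong : ∀ {f g} → f ≋ g → eval₁ f ≡ eval₁ g
  eval₁-cong {[]}    {g}     e = ≡.sym (eval₁-0 (sym e))
  eval₁-cong {a ∷ f} {[]}    e = eval₁-0 e
  eval₁-cong {a ∷ f} {b ∷ g} e =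
    cong₂ ℤ._+_ (coeff-≡ e 0) (eval₁-cong {f} {g} (coeffwise λ i → coeff-≡ e (suc i)))

  open ListSum ℤ.+-0-commutativeMonoid using () renaming (interchange to ℤ-interchange)

  eval₁-⊕ : ∀ f g → eval₁ (f ⊕ g) ≡ eval₁ f ℤ.+ eval₁ g
  eval₁-⊕ []      g       = ≡.sym (ℤ.+-identityˡ _)
  eval₁-⊕ (a ∷ f) []      = ≡.sym (ℤ.+-identityʳ _)
  eval₁-⊕ (a ∷ f) (b ∷ g) = ≡.trans (cong (λ c → a ℤ.+ b ℤ.+ c) (eval₁-⊕ f g)) (ℤ-interchange a b (eval₁ f) (eval₁ g))

  eval₁-scale : ∀ a f → eval₁ (map (a ℤ.*_) f) ≡ a ℤ.* eval₁ f
  eval₁-scale a []      = ≡.sym (ℤ.*-zeroʳ a)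
  eval₁-scale a (b ∷ f) = ≡.trans (cong (λ c → a ℤ.* b ℤ.+ c) (eval₁-scale a f)) (≡.sym (ℤ.*-distribˡ-+ a b (eval₁ f)))

  eval₁-⊛ : ∀ f g → eval₁ (f ⊛ g) ≡ eval₁ f ℤ.* eval₁ g
  eval₁-⊛ []      g = ≡.refl
  eval₁-⊛ (a ∷ f) g =
    ≡.trans (eval₁-⊕ (map (a ℤ.*_) g) (+ 0 ∷ (f ⊛ g)))
    (≡.trans (cong₂ ℤ._+_ (eval₁-scale a g) (≡.trans (ℤ.+-identityˡ _) (eval₁-⊛ f g)))
             (≡.sym (ℤ.*-distribʳ-+ (eval₁ g) a (eval₁ f))))

  X* : ∀ f → + 0 ∷ f ≈ X *ᴿ f
  X* f = coeffwise λ
    { zero    → ≡.sym (≡.trans (Polynomials.coeff-⊕ (map (+ 0 ℤ.*_) f) _ 0) (cong (ℤ._+ + 0) (Polynomials.coeff-scale (+ 0) f 0)))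
    ; (suc i) → ≡.sym (≡.trans (Polynomials.coeff-⊕ (map (+ 0 ℤ.*_) f) _ (suc i))
        (≡.trans (cong₂ ℤ._+_ (Polynomials.coeff-scale (+ 0) f (suc i)) (coeff-≡ (*-identityˡ f) i)) (ℤ.+-identityˡ _))) }

  ∷≈ : ∀ a f → a ∷ f ≈ const a +ᴿ X *ᴿ f
  ∷≈ a f = trans (Polynomials.∷-as-sum a f) (+-congˡ {const a} (X* f))

  -- Synthetic division by 1 - X. If f = e + π g, then X f = e + π (X g - e), so the quotient for a
  -- + X f is -e + X g.
  divπ : Poly → Poly
  divπ []      = []
  divπ (a ∷ f) = ℤ.- eval₁ f ∷ divπ f

  divπ-spec : ∀ f → f ≈ const (eval₁ f) +ᴿ π *ᴿ divπ f
  divπ-spec []      = coeffwise λ { zero → ≡.refl ; (suc zero) → ≡.refl ; (suc (suc i)) → ≡.refl }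
  divπ-spec (a ∷ f) = begin
    a ∷ f  ≈⟨ ∷≈ a f ⟩
    const a +ᴿ X *ᴿ f  ≈⟨ +-congˡ {const a} (*-congˡ {X} (divπ-spec f)) ⟩
    const a +ᴿ X *ᴿ (const e +ᴿ π *ᴿ g)
      ≈⟨ solve 4 (λ A E x G → A :+ x :* (E :+ (con (+ 1) :- x) :* G) := A :+ E :+ (con (+ 1) :- x) :* ((:- E) :+ x :* G))
               refl (const a) (const e) X g ⟩
    const (a ℤ.+ e) +ᴿ π *ᴿ (const (ℤ.- e) +ᴿ X *ᴿ g)  ≈⟨ +-congˡ {const (a ℤ.+ e)} (*-congˡ {π} (sym (∷≈ (ℤ.- e) g))) ⟩
    const (a ℤ.+ e) +ᴿ π *ᴿ (ℤ.- e ∷ g)  ∎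
    where
    e = eval₁ f
    g = divπ f

  π∣-of-root : ∀ f → eval₁ f ≡ + 0 → f ≈ π *ᴿ divπ f
  π∣-of-root f e = trans (divπ-spec f) (trans (+-congʳ (trans (reflexive (cong const e)) const-0)) (+-identityˡ (π *ᴿ divπ f)))
    where
    const-0 : const (+ 0) ≈ 0#
    const-0 = coeffwise λ { zero → ≡.refl ; (suc i) → ≡.refl }

  -- The constant coefficient of X f is 0, and comparing coefficients of X f and f carries this
  -- upwards.
  X*-injective : ∀ {f} → X *ᴿ f ≈ f → f ≈ 0#
  X*-injective {f} e = coeffwise go
    where
    e' : + 0 ∷ f ≈ f
    e' = trans (X* f) e
    go : ∀ i → coeff f i ≡ + 0
    go zero    = ≡.sym (coeff-≡ e' 0)
    go (suc i) = ≡.trans (≡.sym (coeff-≡ e' (suc i))) (go i)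

  π-regular : ∀ {f} → π *ᴿ f ≈ 0# → f ≈ 0#
  π-regular {f} e = X*-injective (begin
    X *ᴿ f  ≈⟨ solve 2 (λ x y → x :* y := y :- (con (+ 1) :- x) :* y) refl X f ⟩
    f +ᴿ -ᴿ (π *ᴿ f)  ≈⟨ +-congˡ {f} (-‿cong e) ⟩
    f +ᴿ 0#  ≈⟨ +-identityʳ f ⟩
    f  ∎)

  monomial-↑ : ∀ s → monomial s ≈ X ↑ s
  monomial-↑ zero    = refl
  monomial-↑ (suc s) = trans (X* (monomial s)) (*-congˡ {X} (monomial-↑ s))

  π*Φ : ∀ t → π *ᴿ Φ t ≈ 1# +ᴿ -ᴿ monomial t
  π*Φ zero    = coeffwise λ { zero → ≡.refl ; (suc zero) → ≡.refl ; (suc (suc i)) → ≡.refl }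
  π*Φ (suc t) = begin
    π *ᴿ (+ 1 ∷ Φ t)  ≈⟨ *-congˡ {π} (∷≈ (+ 1) (Φ t)) ⟩
    π *ᴿ (1# +ᴿ X *ᴿ Φ t)  ≈⟨ solve 2 (λ x f → (con (+ 1) :- x) :* (con (+ 1) :+ x :* f)
                                                   := con (+ 1) :- x :+ x :* ((con (+ 1) :- x) :* f)) refl X (Φ t) ⟩
    1# +ᴿ -ᴿ X +ᴿ X *ᴿ (π *ᴿ Φ t)  ≈⟨ +-congˡ {1# +ᴿ -ᴿ X} (*-congˡ {X} (π*Φ t)) ⟩
    1# +ᴿ -ᴿ X +ᴿ X *ᴿ (1# +ᴿ -ᴿ monomial t)  ≈⟨ solve 2 (λ x m → con (+ 1) :- x :+ x :* (con (+ 1) :- m) := con (+ 1) :- x :* m)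
                                                   refl X (monomial t) ⟩
    1# +ᴿ -ᴿ (X *ᴿ monomial t)  ≈⟨ +-congˡ {1#} (-‿cong (sym (X* (monomial t)))) ⟩
    1# +ᴿ -ᴿ monomial (suc t)  ∎

  eval₁-Φ : ∀ t → eval₁ (Φ t) ≡ + t
  eval₁-Φ zero    = ≡.refl
  eval₁-Φ (suc t) = cong (λ c → + 1 ℤ.+ c) (eval₁-Φ t)

-- Quotient rings and the ring ℤ[ζ_p]

module Quotient (R : CommutativeRing 0ℓ 0ℓ) (c : CommutativeRing.Carrier R) where
  open CommutativeRing R hiding (zero) renaming (_+_ to _+ᴿ_; _*_ to _*ᴿ_; -_ to -ᴿ_)
  open IntegerImage R using (module Solver)
  open Solver using (_:+_; _:*_; :-_; _:=_; solve)
  open SetoidReasoning setoid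

  infix 4 _~_

  -- The cofactor is kept as data: modulo Φ_p it is the second witness that `πDiv` asks for.
  record _~_ (x y : Carrier) : Set where
    constructor modulo
    field
      quotient : Carrier
      equation : x ≈ y +ᴿ c *ᴿ quotient

  ≈⇒~ : ∀ {x y} → x ≈ y → x ~ y
  ≈⇒~ {x} {y} e = modulo 0# (trans e (sym (trans (+-congˡ (zeroʳ c)) (+-identityʳ y))))

  private
    ~-sym : ∀ {x y} → x ~ y → y ~ x
    ~-sym {x} {y} (modulo q e) = modulo (-ᴿ q) (begin
      y  ≈⟨ solve 3 (λ y c q → y := (y :+ c :* q) :+ c :* (:- q)) refl y c q ⟩
      (y +ᴿ c *ᴿ q) +ᴿ c *ᴿ -ᴿ q  ≈⟨ +-congʳ (sym e) ⟩
      x +ᴿ c *ᴿ -ᴿ q  ∎)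

    ~-trans : ∀ {x y z} → x ~ y → y ~ z → x ~ z
    ~-trans {x} {y} {z} (modulo q e) (modulo r e') = modulo (r +ᴿ q) (begin
      x  ≈⟨ e ⟩
      y +ᴿ c *ᴿ q  ≈⟨ +-congʳ e' ⟩
      (z +ᴿ c *ᴿ r) +ᴿ c *ᴿ q  ≈⟨ solve 4 (λ z c r q → (z :+ c :* r) :+ c :* q := z :+ c :* (r :+ q)) refl z c r q ⟩
      z +ᴿ c *ᴿ (r +ᴿ q)  ∎)

    +-~ : ∀ {x x' y y'} → x ~ x' → y ~ y' → x +ᴿ y ~ x' +ᴿ y'
    +-~ {x} {x'} {y} {y'} (modulo q e) (modulo r e') = modulo (q +ᴿ r) (begin
      x +ᴿ y  ≈⟨ +-cong e e' ⟩
      (x' +ᴿ c *ᴿ q) +ᴿ (y' +ᴿ c *ᴿ r)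
        ≈⟨ solve 5 (λ x c q y r → (x :+ c :* q) :+ (y :+ c :* r) := x :+ y :+ c :* (q :+ r)) refl x' c q y' r ⟩
      x' +ᴿ y' +ᴿ c *ᴿ (q +ᴿ r)  ∎)

    *-~ : ∀ {x x' y y'} → x ~ x' → y ~ y' → x *ᴿ y ~ x' *ᴿ y'
    *-~ {x} {x'} {y} {y'} (modulo q e) (modulo r e') = modulo (x' *ᴿ r +ᴿ y' *ᴿ q +ᴿ c *ᴿ q *ᴿ r) (begin
      x *ᴿ y  ≈⟨ *-cong e e' ⟩
      (x' +ᴿ c *ᴿ q) *ᴿ (y' +ᴿ c *ᴿ r)
        ≈⟨ solve 5 (λ x c q y r → (x :+ c :* q) :* (y :+ c :* r) := x :* y :+ c :* (x :* r :+ y :* q :+ c :* q :* r)) refl x' c q y' r ⟩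
      x' *ᴿ y' +ᴿ c *ᴿ (x' *ᴿ r +ᴿ y' *ᴿ q +ᴿ c *ᴿ q *ᴿ r)  ∎)

    neg-~ : ∀ {x y} → x ~ y → -ᴿ x ~ -ᴿ y
    neg-~ {x} {y} (modulo q e) = modulo (-ᴿ q) (begin
      -ᴿ x  ≈⟨ -‿cong e ⟩
      -ᴿ (y +ᴿ c *ᴿ q)  ≈⟨ solve 3 (λ y c q → :- (y :+ c :* q) := :- y :+ c :* (:- q)) refl y c q ⟩
      -ᴿ y +ᴿ c *ᴿ -ᴿ q  ∎)

  quotientRing : CommutativeRing 0ℓ 0ℓ
  quotientRing = record
    { Carrier = Carrier
    ; _≈_ = _~_
    ; _+_ = _+ᴿ_
    ; _*_ = _*ᴿ_
    ; -_ = -ᴿ_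
    ; 0# = 0#
    ; 1# = 1#
    ; isCommutativeRing = record
      { isRing = record
        { +-isAbelianGroup = record
          { isGroup = record
            { isMonoid = record
              { isSemigroup = record
                { isMagma = record
                  { isEquivalence = record { refl = ≈⇒~ refl ; sym = ~-sym ; trans = ~-trans }
                  ; ∙-cong = +-~
                  }
                ; assoc = λ x y z → ≈⇒~ (+-assoc x y z)
                }
              ; identity = (λ x → ≈⇒~ (+-identityˡ x)) , (λ x → ≈⇒~ (+-identityʳ x))
              }
            ; inverse = (λ x → ≈⇒~ (-‿inverseˡ x)) , (λ x → ≈⇒~ (-‿inverseʳ x))
            ; ⁻¹-cong = neg-~
            }
          ; comm = λ x y → ≈⇒~ (+-comm x y)
          }
        ; *-cong = *-~
        ; *-assoc = λ x y z → ≈⇒~ (*-assoc x y z)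
        ; *-identity = (λ x → ≈⇒~ (*-identityˡ x)) , (λ x → ≈⇒~ (*-identityʳ x))
        ; distrib = (λ x y z → ≈⇒~ (distribˡ x y z)) , (λ x y z → ≈⇒~ (distribʳ x y z))
        }
      ; *-comm = λ x y → ≈⇒~ (*-comm x y)
      }
    }

  open SemiringMult semiring using () renaming (_×_ to _·_)
  open SemiringExp semiring using () renaming (_^_ to _↑_)
  open SemiringMult (CommutativeRing.semiring quotientRing) using () renaming (_×_ to _·′_)
  open SemiringExp (CommutativeRing.semiring quotientRing) using () renaming (_^_ to _↑′_)

  -- The two rings share their operations and differ only in equality, so powers coincide as terms
  -- and equations can be moved from the base ring to the quotient.
  ↑-agree : ∀ f k → f ↑ k ≡ f ↑′ k
  ↑-agree f zero    = ≡.refl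
  ↑-agree f (suc k) = cong (f *ᴿ_) (↑-agree f k)

  ·-agree : ∀ f k → k · f ≡ k ·′ f
  ·-agree f zero    = ≡.refl
  ·-agree f (suc k) = cong (f +ᴿ_) (·-agree f k)

-- The features of ℤ[X] used below: aug is evaluation at 1, and Φ is Φ_p.
record AugmentedRing (p : ℕ) : Set₁ where
  field
    base : CommutativeRing 0ℓ 0ℓ
  open CommutativeRing base renaming (_+_ to _+ᴿ_; _*_ to _*ᴿ_; -_ to -ᴿ_)
  open SemiringExp semiring using () renaming (_^_ to _↑_)
  field
    X Φₚ     : Carrier
    aug      : Carrier → ℤ
    aug-cong : ∀ {f g} → f ≈ g → aug f ≡ aug g
    aug-+    : ∀ f g → aug (f +ᴿ g) ≡ aug f ℤ.+ aug g
    aug-*    : ∀ f g → aug (f *ᴿ g) ≡ aug f ℤ.* aug g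
    aug-neg  : ∀ f → aug (-ᴿ f) ≡ ℤ.- aug f
    aug-1    : aug 1# ≡ + 1
    aug-X    : aug X ≡ + 1
    aug-Φ    : aug Φₚ ≡ + p
    root     : ∀ f → aug f ≡ + 0 → ∃[ g ] (f ≈ (1# +ᴿ -ᴿ X) *ᴿ g)
    regular  : ∀ {f} → (1# +ᴿ -ᴿ X) *ᴿ f ≈ 0# → f ≈ 0#
    [1-X]*Φ  : (1# +ᴿ -ᴿ X) *ᴿ Φₚ ≈ 1# +ᴿ -ᴿ (X ↑ p)

-- The features of ℤ[ζ_p] used below; aug is evaluation of a representative at 1, well defined modulo p.
record CyclotomicRing (p : ℕ) : Set₁ where
  field
    ring : CommutativeRing 0ℓ 0ℓ
  open CommutativeRing ring renaming (_+_ to _+ᴿ_; _*_ to _*ᴿ_; -_ to -ᴿ_)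
  open SemiringMult semiring using () renaming (_×_ to _·_)
  open SemiringExp semiring using () renaming (_^_ to _↑_)
  field
    ζ : Carrier
  π̂ : Carrier
  π̂ = 1# +ᴿ -ᴿ ζ
  field
    aug       : Carrier → ℤ
    aug-cong  : ∀ {f g} → f ≈ g → ∃[ c ] (aug f ≡ aug g ℤ.+ + p ℤ.* c)
    aug-+     : ∀ f g → aug (f +ᴿ g) ≡ aug f ℤ.+ aug g
    aug-*     : ∀ f g → aug (f *ᴿ g) ≡ aug f ℤ.* aug g
    aug-neg   : ∀ f → aug (-ᴿ f) ≡ ℤ.- aug f
    aug-0     : aug 0# ≡ + 0
    aug-1     : aug 1# ≡ + 1
    aug-ζ     : aug ζ ≡ + 1
    ζ^p       : ζ ↑ p ≈ 1#
    π-regular : ∀ {f} → π̂ *ᴿ f ≈ 0# → f ≈ 0#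
    π-divides : ∀ w c → aug w ≡ + p ℤ.* c → ∃[ v ] (w ≈ π̂ *ᴿ v)
    -- In ℤ[X], Φ_p = (1-X)^(p-1) + p (1 + (1-X) h) for some h.
    p-relation : ∃[ h ] (π̂ ↑ (p ∸ 1) +ᴿ p · 1# *ᴿ (1# +ᴿ π̂ *ᴿ h) ≈ 0#)

module Cyclotomic {p : ℕ} (p-prime : Prime p) (Z : AugmentedRing p) where
  open AugmentedRing Z
  open Quotient base Φₚ using (_~_; modulo; quotientRing; ↑-agree; ·-agree)
  open CommutativeRing base hiding (zero) renaming (_+_ to _+ᴿ_; _*_ to _*ᴿ_; -_ to -ᴿ_)
  open SemiringMult semiring using () renaming (_×_ to _·_)
  open SemiringExp semiring using (^-congˡ) renaming (_^_ to _↑_)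
  open IntegerImage base using (ι; module Solver)
  open Solver using (_:+_; _:*_; _:-_; :-_; _:=_; con; solve)

  private
    instance
      p≢0 : NonZero p
      p≢0 = prime⇒nonZero p-prime

  π̂ : Carrier
  π̂ = 1# +ᴿ -ᴿ X

  aug-0 : aug 0# ≡ + 0
  aug-0 = ≡.trans (aug-cong (sym (-‿inverseʳ 0#))) (≡.trans (aug-+ 0# _)
          (≡.trans (cong (λ c → aug 0# ℤ.+ c) (aug-neg 0#)) (ℤ.+-inverseʳ (aug 0#))))

  aug-π* : ∀ f → aug (π̂ *ᴿ f) ≡ + 0
  aug-π* f = ≡.trans (aug-* π̂ f) (≡.trans (cong (λ c → c ℤ.* aug f) aug-π) (ℤ.*-zeroˡ (aug f)))
    where
    aug-π : aug π̂ ≡ + 0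
    aug-π = ≡.trans (aug-+ 1# (-ᴿ X)) (cong₂ ℤ._+_ aug-1 (≡.trans (aug-neg X) (cong (λ c → ℤ.- c) aug-X)))

  aug-· : ∀ n → aug (n · 1#) ≡ + n
  aug-· zero    = aug-0
  aug-· (suc n) = ≡.trans (aug-+ 1# _) (cong₂ ℤ._+_ aug-1 (aug-· n))

  aug-ι : ∀ c → aug (ι c) ≡ c
  aug-ι (+ n)    = aug-· n
  aug-ι -[1+ n ] = ≡.trans (aug-neg _) (cong (λ c → ℤ.- c) (aug-· (suc n)))

  aug-~ : ∀ {f g} → f ~ g → ∃[ c ] (aug f ≡ aug g ℤ.+ + p ℤ.* c)
  aug-~ {f} {g} (modulo z e) = aug z ,
    ≡.trans (aug-cong e) (≡.trans (aug-+ g (Φₚ *ᴿ z)) (cong (λ c → aug g ℤ.+ c)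
      (≡.trans (aug-* Φₚ z) (cong (λ c → c ℤ.* aug z) aug-Φ))))

  private
    p-regular : ∀ {c} → + p ℤ.* c ≡ + 0 → c ≡ + 0
    p-regular pc≡0 with ℤ.i*j≡0⇒i≡0∨j≡0 (+ p) pc≡0
    ... | inj₁ p≡0 = contradiction (ℤ.+-injective p≡0) (ℕ.≢-nonZero⁻¹ p)
    ... | inj₂ c≡0 = c≡0

  π-cancel : ∀ {f g} → π̂ *ᴿ f ≈ π̂ *ᴿ g → f ≈ g
  π-cancel {f} {g} e = trans (solve 2 (λ x y → x := (x :- y) :+ y) refl f g)
    (trans (+-congʳ (regular (trans (solve 3 (λ c x y → c :* (x :- y) := c :* x :- c :* y) refl π̂ f g)
      (trans (+-congʳ e) (-‿inverseʳ (π̂ *ᴿ g)))))) (+-identityˡ g))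

  -- If π f = Φ_p z in the base ring, evaluation at 1 gives 0 = p z(1), so z has a factor π, which
  -- cancels against the one on the left.
  π-regular-~ : ∀ {f} → π̂ *ᴿ f ~ 0# → f ~ 0#
  π-regular-~ {f} (modulo z e) with root z z1≡0
    where
    z1≡0 : aug z ≡ + 0
    z1≡0 = p-regular (≡.trans (≡.trans (cong (λ c → c ℤ.* aug z) (≡.sym aug-Φ)) (≡.sym (aug-* Φₚ z)))
             (≡.trans (≡.sym (≡.trans (aug-cong e) (≡.trans (aug-+ 0# _) (≡.trans (cong (λ c → c ℤ.+ aug (Φₚ *ᴿ z)) aug-0) (ℤ.+-identityˡ _)))))
                      (aug-π* f)))
  ... | z' , z≈πz' = modulo z' (π-cancel (trans e (trans (+-congˡ (*-congˡ z≈πz'))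
      (solve 3 (λ a b c → con (+ 0) :+ a :* (b :* c) := b :* (con (+ 0) :+ a :* c)) refl Φₚ π̂ z'))))

  -- When p divides aug w, subtracting a multiple of Φₚ makes 1 a root of w.
  divide-by-π : ∀ w c → aug w ≡ + p ℤ.* c → ∃[ v ] (w ~ π̂ *ᴿ v)
  divide-by-π w c e with root w' w'1≡0
    where
    w' : Carrier
    w' = w +ᴿ -ᴿ (Φₚ *ᴿ ι c)
    w'1≡0 : aug w' ≡ + 0
    w'1≡0 = ≡.trans (aug-+ w _) (≡.trans (cong₂ ℤ._+_ e (≡.trans (aug-neg _) (cong (λ a → ℤ.- a)
      (≡.trans (aug-* Φₚ (ι c)) (cong₂ ℤ._*_ aug-Φ (aug-ι c)))))) (ℤ.+-inverseʳ (+ p ℤ.* c)))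
  ... | v , w'≈πv = v , modulo (ι c) (trans
    (solve 3 (λ a b c → a := (a :- b :* c) :+ b :* c) refl w Φₚ (ι c)) (+-congʳ w'≈πv))

  private
    p̂ : Carrier
    p̂ = p · 1#

    1↑ : ∀ k → 1# ↑ k ≈ 1#
    1↑ zero    = refl
    1↑ (suc k) = trans (*-identityˡ (1# ↑ k)) (1↑ k)

    p-1-suc : ∃[ j ] (p ≡ suc (suc j))
    p-1-suc = p ∸ 2 , ≡.sym (ℕ.m+[n∸m]≡n (prime≥2 p-prime))

    aug-p̂* : ∀ g → aug (p̂ *ᴿ g) ≡ + p ℤ.* aug g
    aug-p̂* g = ≡.trans (aug-* p̂ g) (cong (λ c → c ℤ.* aug g) (aug-· p))

    aug-π*+p̂* : ∀ f g → aug (π̂ *ᴿ f +ᴿ p̂ *ᴿ g) ≡ + p ℤ.* aug g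
    aug-π*+p̂* f g = ≡.trans (aug-+ _ _) (≡.trans (cong₂ ℤ._+_ (aug-π* f) (aug-p̂* g)) (ℤ.+-identityˡ _))

  open SetoidReasoning setoid

  -- From 1 = (X + π)^p one gets π Φ_p = 1 - X^p = π^p + p g, where g(1) = 0.
  Φ-expansion : ∃[ h ] (Φₚ ≈ π̂ ↑ (p ∸ 1) +ᴿ p̂ *ᴿ (1# +ᴿ π̂ *ᴿ h))
  Φ-expansion with PrimePower.freshman base p-prime X π̂
  ... | g , binom = h , (begin
      Φₚ  ≈⟨ Φ≈ ⟩
      ϖ +ᴿ p̂ *ᴿ g'  ≈⟨ +-congˡ (*-congˡ (solve 1 (λ a → a := con (+ 1) :+ (a :- con (+ 1))) refl g')) ⟩
      ϖ +ᴿ p̂ *ᴿ (1# +ᴿ (g' +ᴿ -ᴿ 1#))  ≈⟨ +-congˡ (*-congˡ (+-congˡ g'-1≈πh)) ⟩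
      ϖ +ᴿ p̂ *ᴿ (1# +ᴿ π̂ *ᴿ h)  ∎)
    where
    ϖ : Carrier
    ϖ = π̂ ↑ (p ∸ 1)

    ↑p : π̂ ↑ p ≡ π̂ *ᴿ ϖ
    ↑p = cong (π̂ ↑_) (≡.sym (ℕ.m+[n∸m]≡n (ℕ.<⇒≤ (prime≥2 p-prime))))

    -- As p - 1 ≥ 1, at least one factor π is present and vanishes at 1.
    aug-ϖ : aug ϖ ≡ + 0
    aug-ϖ = ≡.trans (cong (λ k → aug (π̂ ↑ (k ∸ 1))) (proj₂ p-1-suc)) (aug-π* (π̂ ↑ proj₁ p-1-suc))

    πΦ≈ : π̂ *ᴿ Φₚ ≈ π̂ *ᴿ ϖ +ᴿ p̂ *ᴿ g
    πΦ≈ = begin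
      π̂ *ᴿ Φₚ  ≈⟨ [1-X]*Φ ⟩
      1# +ᴿ -ᴿ (X ↑ p)  ≈⟨ +-congʳ (sym (1↑ p)) ⟩
      1# ↑ p +ᴿ -ᴿ (X ↑ p)  ≈⟨ +-congʳ (^-congˡ p (solve 1 (λ x → con (+ 1) := x :+ (con (+ 1) :- x)) refl X)) ⟩
      (X +ᴿ π̂) ↑ p +ᴿ -ᴿ (X ↑ p)  ≈⟨ +-congʳ binom ⟩
      (X ↑ p +ᴿ π̂ ↑ p +ᴿ p̂ *ᴿ g) +ᴿ -ᴿ (X ↑ p)  ≈⟨ solve 3 (λ a b c → (a :+ b :+ c) :- a := b :+ c) refl (X ↑ p) (π̂ ↑ p) (p̂ *ᴿ g) ⟩
      π̂ ↑ p +ᴿ p̂ *ᴿ g  ≡⟨ cong (_+ᴿ p̂ *ᴿ g) ↑p ⟩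
      π̂ *ᴿ ϖ +ᴿ p̂ *ᴿ g  ∎

    g-root : ∃[ g' ] (g ≈ π̂ *ᴿ g')
    -- Both π Φ_p and π^p vanish at 1, hence so does p g.
    g-root = root g (p-regular (≡.trans (≡.sym (aug-π*+p̂* ϖ g)) (≡.trans (≡.sym (aug-cong πΦ≈)) (aug-π* Φₚ))))

    g' : Carrier
    g' = proj₁ g-root

    Φ≈ : Φₚ ≈ ϖ +ᴿ p̂ *ᴿ g'
    Φ≈ = π-cancel (begin
      π̂ *ᴿ Φₚ  ≈⟨ πΦ≈ ⟩
      π̂ *ᴿ ϖ +ᴿ p̂ *ᴿ g  ≈⟨ +-congˡ (*-congˡ (proj₂ g-root)) ⟩
      π̂ *ᴿ ϖ +ᴿ p̂ *ᴿ (π̂ *ᴿ g')  ≈⟨ solve 4 (λ a b c e → a :* b :+ c :* (a :* e) := a :* (b :+ c :* e)) refl π̂ ϖ p̂ g' ⟩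
      π̂ *ᴿ (ϖ +ᴿ p̂ *ᴿ g')  ∎)

    aug-g' : aug g' ≡ + 1
    -- Evaluating Φ_p = π^(p-1) + p g' at 1 gives p = p g'(1).
    aug-g' = ℤ.*-cancelˡ-≡ (+ p) _ _ (≡.trans (≡.sym (aug-p̂* g')) (≡.trans (≡.sym (ℤ.+-identityˡ _))
      (≡.trans (≡.trans (cong (λ c → c ℤ.+ aug (p̂ *ᴿ g')) (≡.sym aug-ϖ)) (≡.sym (aug-+ ϖ (p̂ *ᴿ g'))))
      (≡.trans (≡.sym (aug-cong Φ≈)) (≡.trans aug-Φ (≡.sym (ℤ.*-identityʳ (+ p))))))))

    g'-1-root : ∃[ h ] (g' +ᴿ -ᴿ 1# ≈ π̂ *ᴿ h)
    g'-1-root = root (g' +ᴿ -ᴿ 1#) (≡.trans (aug-+ g' (-ᴿ 1#)) (cong₂ ℤ._+_ aug-g' (≡.trans (aug-neg 1#) (cong (λ c → ℤ.- c) aug-1))))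

    h : Carrier
    h = proj₁ g'-1-root

    g'-1≈πh : g' +ᴿ -ᴿ 1# ≈ π̂ *ᴿ h
    g'-1≈πh = proj₂ g'-1-root

  X^p~1 : X ↑ p ~ 1#
  X^p~1 = modulo (-ᴿ π̂) (begin
    X ↑ p  ≈⟨ solve 1 (λ a → a := con (+ 1) :- (con (+ 1) :- a)) refl (X ↑ p) ⟩
    1# +ᴿ -ᴿ (1# +ᴿ -ᴿ (X ↑ p))  ≈⟨ +-congˡ (-‿cong (sym [1-X]*Φ)) ⟩
    1# +ᴿ -ᴿ (π̂ *ᴿ Φₚ)  ≈⟨ solve 2 (λ a b → con (+ 1) :- a :* b := con (+ 1) :+ b :* (:- a)) refl π̂ Φₚ ⟩
    1# +ᴿ Φₚ *ᴿ -ᴿ π̂  ∎)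

  ℤ[ζ] : CyclotomicRing p
  ℤ[ζ] = record
    { ring       = quotientRing
    ; ζ          = X
    ; aug        = aug
    ; aug-cong   = aug-~
    ; aug-+      = aug-+
    ; aug-*      = aug-*
    ; aug-neg    = aug-neg
    ; aug-0      = aug-0
    ; aug-1      = aug-1
    ; aug-ζ      = aug-X
    ; ζ^p        = subst (_~ 1#) (↑-agree X p) X^p~1
    ; π-regular  = π-regular-~
    ; π-divides  = divide-by-π
    ; p-relation = let h , Φ≈ = Φ-expansion in h ,
        subst₂ (λ a b → a +ᴿ b *ᴿ (1# +ᴿ π̂ *ᴿ h) ~ 0#) (↑-agree π̂ (p ∸ 1)) (·-agree 1# p)
          (modulo 1# (trans (sym Φ≈) (sym (trans (+-identityˡ _) (*-identityʳ Φₚ)))))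
    }

-- The π-adic valuation

module PiAdic {p : ℕ} (p-prime : Prime p) (C : CyclotomicRing p) where
  open CyclotomicRing C
  open CommutativeRing ring hiding (zero; ring) renaming (_+_ to _+ᴿ_; _*_ to _*ᴿ_; -_ to -ᴿ_)
  open SemiringMult semiring using (×1-homo-*) renaming (_×_ to _·_)
  open SemiringExp semiring using (^-homo-*) renaming (_^_ to _↑_)
  open IntegerImage ring using (module Solver)
  open Solver using (_:+_; _:*_; _:-_; :-_; _:=_; con; solve)
  open ℤSolver using () renaming (solve to ℤ-solve; _:=_ to _⊜_; _:*_ to _⊠_; _:-_ to _⊟_; _:+_ to _⊞_; con to ℤ-con)
  open SetoidReasoning setoid

  aug-· : ∀ n → aug (n · 1#) ≡ + n
  aug-· zero    = aug-0
  aug-· (suc n) = ≡.trans (aug-+ 1# _) (cong₂ ℤ._+_ aug-1 (aug-· n))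

  aug-π* : ∀ f → aug (π̂ *ᴿ f) ≡ + 0
  aug-π* f = ≡.trans (aug-* π̂ f) (≡.trans (cong (λ c → c ℤ.* aug f) aug-π) (ℤ.*-zeroˡ (aug f)))
    where
    aug-π : aug π̂ ≡ + 0
    aug-π = ≡.trans (aug-+ 1# (-ᴿ ζ)) (cong₂ ℤ._+_ aug-1 (≡.trans (aug-neg ζ) (cong (λ c → ℤ.- c) aug-ζ)))

  π-cancel : ∀ {f g} → π̂ *ᴿ f ≈ π̂ *ᴿ g → f ≈ g
  π-cancel {f} {g} e = begin
    f  ≈⟨ solve 2 (λ x y → x := (x :- y) :+ y) refl f g ⟩
    (f +ᴿ -ᴿ g) +ᴿ g  ≈⟨ +-congʳ {g} (π-regular (begin
        π̂ *ᴿ (f +ᴿ -ᴿ g)  ≈⟨ solve 3 (λ c x y → c :* (x :- y) := c :* x :- c :* y) refl π̂ f g ⟩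
        π̂ *ᴿ f +ᴿ -ᴿ (π̂ *ᴿ g)  ≈⟨ +-congʳ { -ᴿ (π̂ *ᴿ g)} e ⟩
        π̂ *ᴿ g +ᴿ -ᴿ (π̂ *ᴿ g)  ≈⟨ -‿inverseʳ (π̂ *ᴿ g) ⟩
        0#  ∎)) ⟩
    0# +ᴿ g  ≈⟨ +-identityˡ g ⟩
    g  ∎

  π↑-cancel : ∀ k {f g} → π̂ ↑ k *ᴿ f ≈ π̂ ↑ k *ᴿ g → f ≈ g
  π↑-cancel zero    {f} {g} e = trans (sym (*-identityˡ f)) (trans e (*-identityˡ g))
  π↑-cancel (suc k) {f} {g} e = π↑-cancel k (π-cancel (trans (sym (*-assoc π̂ (π̂ ↑ k) f)) (trans e (*-assoc π̂ (π̂ ↑ k) g))))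

  infix 4 π^_∣_
  π^_∣_ : ℕ → Carrier → Set
  π^ k ∣ w = ∃[ y ] (w ≈ π̂ ↑ k *ᴿ y)

  π∣-respects : ∀ k {v w} → v ≈ w → π^ k ∣ v → π^ k ∣ w
  π∣-respects k v≈w (y , e) = y , trans (sym v≈w) e

  π∣-0 : ∀ k → π^ k ∣ 0#
  π∣-0 k = 0# , sym (zeroʳ (π̂ ↑ k))

  π∣-+ : ∀ k {v w} → π^ k ∣ v → π^ k ∣ w → π^ k ∣ v +ᴿ w
  π∣-+ k (y , e) (y' , e') = y +ᴿ y' , trans (+-cong e e') (sym (distribˡ (π̂ ↑ k) y y'))

  π∣-neg : ∀ k {v} → π^ k ∣ v → π^ k ∣ -ᴿ v
  π∣-neg k (y , e) = -ᴿ y , trans (-‿cong e) (solve 2 (λ a b → :- (a :* b) := a :* (:- b)) refl (π̂ ↑ k) y)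

  π∣-* : ∀ j k {v w} → π^ j ∣ v → π^ k ∣ w → π^ (j + k) ∣ v *ᴿ w
  π∣-* j k {v} {w} (y , e) (y' , e') = y *ᴿ y' , (begin
    v *ᴿ w  ≈⟨ *-cong e e' ⟩
    (π̂ ↑ j *ᴿ y) *ᴿ (π̂ ↑ k *ᴿ y')  ≈⟨ solve 4 (λ a b c d → (a :* b) :* (c :* d) := (a :* c) :* (b :* d)) refl (π̂ ↑ j) y (π̂ ↑ k) y' ⟩
    (π̂ ↑ j *ᴿ π̂ ↑ k) *ᴿ (y *ᴿ y')  ≈⟨ *-congʳ {y *ᴿ y'} (sym (^-homo-* π̂ j k)) ⟩
    π̂ ↑ (j + k) *ᴿ (y *ᴿ y')  ∎)

  π∣-≤ : ∀ {j k w} → j ≤ k → π^ k ∣ w → π^ j ∣ w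
  π∣-≤ {j} {k} {w} j≤k (y , e) = π̂ ↑ (k ∸ j) *ᴿ y , (begin
    w  ≈⟨ e ⟩
    π̂ ↑ k *ᴿ y  ≡⟨ cong (λ i → π̂ ↑ i *ᴿ y) (≡.sym (ℕ.m+[n∸m]≡n j≤k)) ⟩
    π̂ ↑ (j + (k ∸ j)) *ᴿ y  ≈⟨ *-congʳ {y} (^-homo-* π̂ j (k ∸ j)) ⟩
    π̂ ↑ j *ᴿ π̂ ↑ (k ∸ j) *ᴿ y  ≈⟨ *-assoc (π̂ ↑ j) (π̂ ↑ (k ∸ j)) y ⟩
    π̂ ↑ j *ᴿ (π̂ ↑ (k ∸ j) *ᴿ y)  ∎)

  aug-π∣ : ∀ k {w} → π^ suc k ∣ w → ∃[ c ] (aug w ≡ + p ℤ.* c)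
  aug-π∣ k {w} (y , e) with aug-cong (trans e (*-assoc π̂ (π̂ ↑ k) y))
  ... | c , ev = c , ≡.trans ev (≡.trans (cong (λ a → a ℤ.+ + p ℤ.* c) (aug-π* (π̂ ↑ k *ᴿ y))) (ℤ.+-identityˡ _))

  -- The residue field at π is 𝔽_p, through `aug` modulo p: a factor π splits off exactly when p
  -- divides `aug w`. Regularity of π makes the quotient unique, so the test can be repeated on it.
  π∣? : ∀ k w → Dec (π^ k ∣ w)
  π∣? zero    w = yes (w , sym (*-identityˡ w))
  π∣? (suc k) w with + p ℤ∣.∣? aug w
  ... | no p∤w1 = no λ π∣w → let c , ev = aug-π∣ k π∣w in p∤w1 (ℤ∣.divides c (≡.trans ev (ℤ.*-comm (+ p) c)))
  ... | yes (ℤ∣.divides c ev) with π-divides w c (≡.trans ev (ℤ.*-comm c (+ p)))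
  ...   | v , w≈πv with π∣? k v
  ...     | yes (y , e) = yes (y , trans w≈πv (trans (*-congˡ {π̂} e) (sym (*-assoc π̂ (π̂ ↑ k) y))))
  ...     | no ¬π∣v     = no λ { (y , e) → ¬π∣v (y , π-cancel (trans (sym w≈πv) (trans e (*-assoc π̂ (π̂ ↑ k) y)))) }

  private
    p̂ : Carrier
    p̂ = p · 1#

    ϖ : Carrier
    ϖ = π̂ ↑ (p ∸ 1)

    -- p ≡ π^(p-1) u + p π^(j+1) w with u(1) ≡ -1 (mod p), improved one power of π at a time.
    approximate : ∀ j → ∃[ u ] ∃[ w ] (p̂ ≈ ϖ *ᴿ u +ᴿ π̂ ↑ suc j *ᴿ (p̂ *ᴿ w) × ∃[ c ] (aug u ≡ -[1+ 0 ] ℤ.+ + p ℤ.* c))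
    approximate j with p-relation
    ... | h , relation = go j
      where
      step₁ : p̂ ≈ -ᴿ ϖ +ᴿ π̂ *ᴿ (p̂ *ᴿ -ᴿ h)
      step₁ = begin
        p̂  ≈⟨ solve 4 (λ a b e h → e := (:- a) :+ b :* (e :* (:- h)) :+ (a :+ e :* (con (+ 1) :+ b :* h))) refl ϖ π̂ p̂ h ⟩
        -ᴿ ϖ +ᴿ π̂ *ᴿ (p̂ *ᴿ -ᴿ h) +ᴿ (ϖ +ᴿ p̂ *ᴿ (1# +ᴿ π̂ *ᴿ h))  ≈⟨ +-congˡ relation ⟩
        -ᴿ ϖ +ᴿ π̂ *ᴿ (p̂ *ᴿ -ᴿ h) +ᴿ 0#  ≈⟨ +-identityʳ _ ⟩
        -ᴿ ϖ +ᴿ π̂ *ᴿ (p̂ *ᴿ -ᴿ h)  ∎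

      go : ∀ j → ∃[ u ] ∃[ w ] (p̂ ≈ ϖ *ᴿ u +ᴿ π̂ ↑ suc j *ᴿ (p̂ *ᴿ w) × ∃[ c ] (aug u ≡ -[1+ 0 ] ℤ.+ + p ℤ.* c))
      go zero = -ᴿ 1# , -ᴿ h ,
        trans step₁ (solve 4 (λ a b e h → (:- a) :+ b :* (e :* (:- h)) := a :* (:- con (+ 1)) :+ (b :* con (+ 1)) :* (e :* (:- h))) refl ϖ π̂ p̂ h) ,
        + 0 , ≡.trans (≡.trans (aug-neg 1#) (cong (λ c → ℤ.- c) aug-1)) (≡.sym (cong (λ c → -[1+ 0 ] ℤ.+ c) (ℤ.*-zeroʳ (+ p))))
      go (suc j) with go j
      ... | u , w , e , c , ev = u +ᴿ -ᴿ (π̂ ↑ suc j *ᴿ w) , w *ᴿ -ᴿ h , (begin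
          p̂  ≈⟨ e ⟩
          ϖ *ᴿ u +ᴿ π̂ ↑ suc j *ᴿ (p̂ *ᴿ w)  ≈⟨ +-congˡ {ϖ *ᴿ u} (*-congˡ {π̂ ↑ suc j} (*-congʳ {w} step₁)) ⟩
          ϖ *ᴿ u +ᴿ π̂ ↑ suc j *ᴿ ((-ᴿ ϖ +ᴿ π̂ *ᴿ (p̂ *ᴿ -ᴿ h)) *ᴿ w)
            ≈⟨ solve 7 (λ a u b w e h π → a :* u :+ b :* (((:- a) :+ π :* (e :* (:- h))) :* w)
                  := a :* (u :- b :* w) :+ (π :* b) :* (e :* (w :* (:- h)))) refl ϖ u (π̂ ↑ suc j) w p̂ h π̂ ⟩
          ϖ *ᴿ (u +ᴿ -ᴿ (π̂ ↑ suc j *ᴿ w)) +ᴿ π̂ ↑ suc (suc j) *ᴿ (p̂ *ᴿ (w *ᴿ -ᴿ h))  ∎) ,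
          c , (≡.trans (aug-+ u _) (≡.trans (cong₂ ℤ._+_ ev (≡.trans (aug-neg _) (cong (λ a → ℤ.- a) aug-0'))) (ℤ.+-identityʳ _)))
          where
          aug-0' : aug (π̂ ↑ suc j *ᴿ w) ≡ + 0
          aug-0' = ≡.trans (aug-* (π̂ ↑ suc j) w) (cong (λ a → a ℤ.* aug w) (aug-π* (π̂ ↑ j)))

  -- p (1 + π h) = -π^(p-1) is solved for p by truncating the geometric series of -1/(1 + π h). At j
  -- = p - 2 the error term itself carries π^(p-1) and joins the cofactor.
  p-associate : ∃[ u ] (p · 1# ≈ π̂ ↑ (p ∸ 1) *ᴿ u × ∃[ c ] (aug u ≡ -[1+ 0 ] ℤ.+ + p ℤ.* c))
  p-associate with approximate (p ∸ 2)
  ... | u , w , e , c , ev = u +ᴿ p̂ *ᴿ w ,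
    trans e (trans (+-congˡ (*-congʳ (reflexive (cong (π̂ ↑_) p-1≡)))) (sym (distribˡ ϖ u (p̂ *ᴿ w)))) ,
    c ℤ.+ aug w , ≡.trans (aug-+ u (p̂ *ᴿ w)) (≡.trans (cong₂ ℤ._+_ ev (≡.trans (aug-* p̂ w) (cong (λ a → a ℤ.* aug w) (aug-· p))))
      (≡.trans (ℤ.+-assoc -[1+ 0 ] (+ p ℤ.* c) (+ p ℤ.* aug w)) (cong (λ a → -[1+ 0 ] ℤ.+ a) (≡.sym (ℤ.*-distribˡ-+ (+ p) c (aug w))))))
    where
    p-1≡ : suc (p ∸ 2) ≡ p ∸ 1
    p-1≡ = cong (_∸ 1) (ℕ.m+[n∸m]≡n (prime≥2 p-prime))

  private
    q-as-power : ∀ n → (p ^ n) · 1# ≈ (p · 1#) ↑ n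
    q-as-power zero    = +-identityʳ 1#
    q-as-power (suc n) = trans (×1-homo-* p (p ^ n)) (*-congˡ {p · 1#} (q-as-power n))

  -- The n-th power of `p-associate`. Its cofactor has `aug` ≡ (-1)^n (mod p), so π does not divide
  -- it and the exponent n (p - 1) is exact.
  q-associate : ∀ n → ∃[ v ] ((p ^ n) · 1# ≈ π̂ ↑ (n * (p ∸ 1)) *ᴿ v × ¬ π^ 1 ∣ v)
  q-associate n with p-associate
  ... | u , p≈ , c , ev = u ↑ n , trans (q-as-power n) (power n) , unit n
    where
    power : ∀ n → (p · 1#) ↑ n ≈ π̂ ↑ (n * (p ∸ 1)) *ᴿ u ↑ n
    power zero    = sym (*-identityˡ 1#)
    power (suc n) = begin
      p · 1# *ᴿ (p · 1#) ↑ n  ≈⟨ *-cong p≈ (power n) ⟩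
      (ϖ *ᴿ u) *ᴿ (π̂ ↑ (n * (p ∸ 1)) *ᴿ u ↑ n)  ≈⟨ solve 4 (λ a b c e → (a :* b) :* (c :* e) := (a :* c) :* (b :* e)) refl ϖ u (π̂ ↑ (n * (p ∸ 1))) (u ↑ n) ⟩
      (ϖ *ᴿ π̂ ↑ (n * (p ∸ 1))) *ᴿ (u *ᴿ u ↑ n)  ≈⟨ *-congʳ {u *ᴿ u ↑ n} (sym (^-homo-* π̂ (p ∸ 1) (n * (p ∸ 1)))) ⟩
      π̂ ↑ (suc n * (p ∸ 1)) *ᴿ u ↑ suc n  ∎

    p∤1 : ∀ b → ¬ (+ 1 ≡ + p ℤ.* b)
    p∤1 b e = ℕ.<⇒≱ (prime≥2 p-prime) (ℕ.∣⇒≤ (ℤ∣.∣⇒∣ᵤ (ℤ∣.divides b (≡.trans e (ℤ.*-comm (+ p) b)))))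

    p∤u↑ : ∀ n b → ¬ (aug (u ↑ n) ≡ + p ℤ.* b)
    p∤u↑ zero    b e = p∤1 b (≡.trans (≡.sym aug-1) e)
    -- a = p c a - (p c - 1) a, so if p divides (p c - 1) a, it divides a.
    p∤u↑ (suc n) b e = p∤u↑ n (c ℤ.* a ℤ.- b)
      (≡.trans (ℤ-solve 3 (λ a p c → a ⊜ p ⊠ (c ⊠ a) ⊟ (ℤ-con -[1+ 0 ] ⊞ p ⊠ c) ⊠ a) ≡.refl a (+ p) c)
      (≡.trans (cong (λ x → + p ℤ.* (c ℤ.* a) ℤ.- x) ua≡pb)
               (ℤ-solve 4 (λ a p c b → p ⊠ (c ⊠ a) ⊟ p ⊠ b ⊜ p ⊠ (c ⊠ a ⊟ b)) ≡.refl a (+ p) c b)))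
      where
      a = aug (u ↑ n)
      ua≡pb : (-[1+ 0 ] ℤ.+ + p ℤ.* c) ℤ.* a ≡ + p ℤ.* b
      ua≡pb = ≡.trans (cong (λ x → x ℤ.* a) (≡.sym ev)) (≡.trans (≡.sym (aug-* u (u ↑ n))) e)

    unit : ∀ n → ¬ π^ 1 ∣ u ↑ n
    unit n d = let b , e = aug-π∣ 0 d in p∤u↑ n b e

  π∣q : ∀ n {k} → k ≤ n * (p ∸ 1) → π^ k ∣ (p ^ n) · 1#
  π∣q n k≤N = let v , e , _ = q-associate n in π∣-≤ k≤N (v , e)

  π∤q : ∀ n → ¬ π^ suc (n * (p ∸ 1)) ∣ (p ^ n) · 1#
  π∤q n (y , e') with q-associate n
  ... | v , e , π∤v = π∤v (y , π↑-cancel (n * (p ∸ 1)) (trans (sym e) (trans e'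
    (solve 3 (λ a b c → (a :* b) :* c := b :* ((a :* con (+ 1)) :* c)) refl π̂ (π̂ ↑ (n * (p ∸ 1))) y))))

-- Finite fields: Fermat, root counts, power sums

module FiniteFieldTheory (F : FiniteField) (p n : ℕ) (p-prime : Prime p)
                         (char-p : FiniteField._≈_ F (natF F p) (FiniteField.0# F))
                         (card : order F ≡ p ^ n) where
  open FiniteField F hiding (zero) renaming (_+_ to _+ᴿ_; _*_ to _*ᴿ_; -_ to -ᴿ_)
  open SemiringMult semiring using (×-homo-+; ×1-homo-*) renaming (_×_ to _·_)
  open SemiringExp semiring using (^-homo-*; ^-congˡ; ^-assocʳ) renaming (_^_ to _↑_)
  open CommutativeSemiringExp commutativeSemiring using (^-distrib-*)
  open IntegerImage commRing using (module Solver)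
  open Solver using (_:+_; _:*_; _:-_; :-_; _:=_; con; solve)
  open RingSum commRing
  open FieldSum F +-commutativeMonoid public
  private module ∏ = FieldSum F *-commutativeMonoid
  open SetoidReasoning setoid

  private
    instance
      p≢0 : NonZero p
      p≢0 = prime⇒nonZero p-prime

  q : ℕ
  q = p ^ n

  pow≡↑ : ∀ x k → pow F x k ≡ x ↑ k
  pow≡↑ x zero    = ≡.refl
  pow≡↑ x (suc k) = cong (x *ᴿ_) (pow≡↑ x k)

  natF≡· : ∀ k → natF F k ≡ k · 1#
  natF≡· zero    = ≡.refl
  natF≡· (suc k) = cong (1# +ᴿ_) (natF≡· k)

  natF-+ : ∀ j k → natF F (j + k) ≈ natF F j +ᴿ natF F k
  natF-+ j k rewrite natF≡· (j + k) | natF≡· j | natF≡· k = ×-homo-+ 1# j k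

  natF-* : ∀ j k → natF F (j * k) ≈ natF F j *ᴿ natF F k
  natF-* j k rewrite natF≡· (j * k) | natF≡· j | natF≡· k = ×1-homo-* j k

  natF-multiple : ∀ k → natF F (k * p) ≈ 0#
  natF-multiple k = trans (natF-* k p) (trans (*-congˡ char-p) (zeroʳ _))

  ·-vanishes : ∀ x → p · 1# *ᴿ x ≈ 0#
  ·-vanishes x = trans (*-congʳ (trans (reflexive (≡.sym (natF≡· p))) char-p)) (zeroˡ x)

  *-cancelˡ : ∀ {a} x y → ¬ a ≈ 0# → a *ᴿ x ≈ a *ᴿ y → x ≈ y
  *-cancelˡ {a} x y a≉0 e with inverse a a≉0
  ... | b , ab≈1 = begin
    x  ≈⟨ sym (*-identityˡ x) ⟩
    1# *ᴿ x  ≈⟨ *-congʳ (sym ab≈1) ⟩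
    a *ᴿ b *ᴿ x  ≈⟨ solve 3 (λ a b x → a :* b :* x := b :* (a :* x)) refl a b x ⟩
    b *ᴿ (a *ᴿ x)  ≈⟨ *-congˡ e ⟩
    b *ᴿ (a *ᴿ y)  ≈⟨ solve 3 (λ a b x → b :* (a :* x) := a :* b :* x) refl a b y ⟩
    a *ᴿ b *ᴿ y  ≈⟨ *-congʳ ab≈1 ⟩
    1# *ᴿ y  ≈⟨ *-identityˡ y ⟩
    y  ∎

  integral : ∀ {x y} → x *ᴿ y ≈ 0# → ¬ x ≈ 0# → y ≈ 0#
  integral {x} {y} e x≉0 = *-cancelˡ y 0# x≉0 (trans e (sym (zeroʳ x)))

  difference-≉0 : ∀ {x y} → ¬ x ≈ y → ¬ x +ᴿ -ᴿ y ≈ 0#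
  difference-≉0 {x} {y} x≉y e = x≉y (begin
    x  ≈⟨ solve 2 (λ x y → x := (x :- y) :+ y) refl x y ⟩
    (x +ᴿ -ᴿ y) +ᴿ y  ≈⟨ +-congʳ e ⟩
    0# +ᴿ y  ≈⟨ +-identityˡ y ⟩
    y  ∎)

  1≉0 : ¬ 1# ≈ 0#
  1≉0 e = 0≉1 (sym e)

  0↑ : ∀ k → .{{NonZero k}} → 0# ↑ k ≈ 0#
  0↑ (suc k) = zeroˡ _

  1↑ : ∀ k → 1# ↑ k ≈ 1#
  1↑ zero    = refl
  1↑ (suc k) = trans (*-identityˡ _) (1↑ k)

  ↑≉0 : ∀ {x} k → ¬ x ≈ 0# → ¬ x ↑ k ≈ 0#
  ↑≉0 zero    x≉0 = 1≉0
  ↑≉0 (suc k) x≉0 e = ↑≉0 k x≉0 (integral e x≉0)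

  q≥2 : 2 ≤ q
  q≥2 = subst (2 ≤_) card (two-elements elems (complete 0#) (complete 1#))
    where
    two-elements : ∀ xs → Any (0# ≈_) xs → Any (1# ≈_) xs → 2 ≤ length xs
    two-elements (x ∷ [])     (here 0≈x) (here 1≈x) = contradiction (trans 0≈x (sym 1≈x)) 0≉1
    two-elements (x ∷ y ∷ xs) _          _          = s≤s (s≤s z≤n)

  n≥1 : 1 ≤ n
  n≥1 = ℕ.n≢0⇒n>0 λ n≡0 → ℕ.<⇒≱ q≥2 (ℕ.≤-reflexive (cong (p ^_) n≡0))

  private
    instance
      q≢0 : NonZero q
      q≢0 = ℕ.>-nonZero (ℕ.<⇒≤ q≥2)

      q-1≢0 : NonZero (q ∸ 1)
      q-1≢0 = ℕ.>-nonZero (ℕ.∸-monoˡ-≤ 1 q≥2)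

    suc[q-1] : suc (q ∸ 1) ≡ q
    suc[q-1] = ℕ.m+[n∸m]≡n (ℕ.<⇒≤ q≥2)

  frobenius-+ : ∀ x y → (x +ᴿ y) ↑ p ≈ x ↑ p +ᴿ y ↑ p
  frobenius-+ x y with PrimePower.freshman commRing p-prime x y
  ... | g , e = trans e (trans (+-congˡ (·-vanishes g)) (+-identityʳ _))

  frobenius^-+ : ∀ i x y → (x +ᴿ y) ↑ (p ^ i) ≈ x ↑ (p ^ i) +ᴿ y ↑ (p ^ i)
  frobenius^-+ zero    x y = trans (*-identityʳ _) (sym (+-cong (*-identityʳ x) (*-identityʳ y)))
  frobenius^-+ (suc i) x y = begin
    (x +ᴿ y) ↑ (p * p ^ i)  ≈⟨ sym (^-assocʳ (x +ᴿ y) p (p ^ i)) ⟩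
    ((x +ᴿ y) ↑ p) ↑ (p ^ i)  ≈⟨ ^-congˡ (p ^ i) (frobenius-+ x y) ⟩
    (x ↑ p +ᴿ y ↑ p) ↑ (p ^ i)  ≈⟨ frobenius^-+ i (x ↑ p) (y ↑ p) ⟩
    (x ↑ p) ↑ (p ^ i) +ᴿ (y ↑ p) ↑ (p ^ i)  ≈⟨ +-cong (^-assocʳ x p (p ^ i)) (^-assocʳ y p (p ^ i)) ⟩
    x ↑ (p * p ^ i) +ᴿ y ↑ (p * p ^ i)  ∎

  -- Comparing the products of all nonzero x and of all a x.
  fermat : ∀ a → a ↑ q ≈ a
  fermat a with a ≟ 0#
  ... | yes a≈0 = trans (^-congˡ q a≈0) (trans (0↑ q) (sym a≈0))
  ... | no a≉0 with inverse a a≉0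
  ...   | b , ab≈1 = begin
    a ↑ q  ≡⟨ cong (a ↑_) (≡.sym card) ⟩
    a ↑ length elems  ≈⟨ sym (∏-const elems) ⟩
    ∏.∑F (λ _ → a)  ≈⟨ ∏.sum-cong elems (λ x → sym (hg x)) ⟩
    ∏.∑F (λ x → h x *ᴿ g x)  ≈⟨ ∏.sum-∙ elems h g ⟩
    ∏.∑F h *ᴿ ∏.∑F g  ≈⟨ *-cong (∏.∑F-single 0# (λ _ → a) (λ _ → refl)) ∏g≈1 ⟩
    a *ᴿ 1#  ≈⟨ *-identityʳ a ⟩
    a  ∎
    where
    f g h : Carrier → Carrier
    f x = if does (x ≟ 0#) then 1# else x
    g x = if does (x ≟ 0#) then 1# else a
    h x = if does (x ≟ 0#) then a else 1#

    ∏-const : ∀ xs → ∏.sum xs (λ _ → a) ≈ a ↑ length xs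
    ∏-const []       = refl
    ∏-const (x ∷ xs) = *-congˡ (∏-const xs)

    hg : ∀ x → h x *ᴿ g x ≈ a
    hg x with x ≟ 0#
    ... | yes _ = *-identityʳ a
    ... | no _  = *-identityˡ a

    f-cong : ∀ {x y} → x ≈ y → f x ≈ f y
    f-cong {x} {y} x≈y with x ≟ 0# | y ≟ 0#
    ... | yes _   | yes _   = refl
    ... | yes x≈0 | no y≉0  = contradiction (trans (sym x≈y) x≈0) y≉0
    ... | no x≉0  | yes y≈0 = contradiction (trans x≈y y≈0) x≉0
    ... | no _    | no _    = x≈y

    f-a* : ∀ x → f (a *ᴿ x) ≈ g x *ᴿ f x
    f-a* x with x ≟ 0# | (a *ᴿ x) ≟ 0#
    ... | yes x≈0 | yes _    = sym (*-identityˡ 1#)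
    ... | yes x≈0 | no ax≉0  = contradiction (trans (*-congˡ x≈0) (zeroʳ a)) ax≉0
    ... | no x≉0  | yes ax≈0 = contradiction (integral ax≈0 a≉0) x≉0
    ... | no x≉0  | no _     = refl

    f≉0 : ∀ x → ¬ f x ≈ 0#
    f≉0 x with x ≟ 0#
    ... | yes _  = 1≉0
    ... | no x≉0 = x≉0

    ∏f≉0 : ∀ xs → ¬ ∏.sum xs f ≈ 0#
    ∏f≉0 []       = 1≉0
    ∏f≉0 (x ∷ xs) e = ∏f≉0 xs (integral e (f≉0 x))

    a*-inverse : ∀ x → a *ᴿ (b *ᴿ x) ≈ x
    a*-inverse x = trans (sym (*-assoc a b x)) (trans (*-congʳ ab≈1) (*-identityˡ x))

    b*-inverse : ∀ x → b *ᴿ (a *ᴿ x) ≈ x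
    b*-inverse x = trans (sym (*-assoc b a x)) (trans (*-congʳ (trans (*-comm b a) ab≈1)) (*-identityˡ x))

    ∏g≈1 : ∏.∑F g ≈ 1#
    ∏g≈1 = *-cancelˡ (∏.∑F g) 1# (∏f≉0 elems) (begin
      ∏.∑F f *ᴿ ∏.∑F g  ≈⟨ *-comm _ _ ⟩
      ∏.∑F g *ᴿ ∏.∑F f  ≈⟨ sym (∏.sum-∙ elems g f) ⟩
      ∏.∑F (λ x → g x *ᴿ f x)  ≈⟨ ∏.sum-cong elems (λ x → sym (f-a* x)) ⟩
      ∏.∑F (λ x → f (a *ᴿ x))  ≈⟨ ∏.∑F-reindex (a *ᴿ_) (b *ᴿ_) *-congˡ *-congˡ a*-inverse b*-inverse f f-cong ⟩
      ∏.∑F f  ≈⟨ sym (*-identityʳ _) ⟩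
      ∏.∑F f *ᴿ 1#  ∎)

  evalAt : List Carrier → Carrier → Carrier
  evalAt []      x = 0#
  evalAt (a ∷ f) x = a +ᴿ x *ᴿ evalAt f x

  private
    divideAt : List Carrier → Carrier → List Carrier
    divideAt []          r = []
    divideAt (a ∷ [])    r = []
    divideAt (a ∷ b ∷ f) r = evalAt (b ∷ f) r ∷ divideAt (b ∷ f) r

    divideAt-spec : ∀ f r x → evalAt f x ≈ evalAt f r +ᴿ (x +ᴿ -ᴿ r) *ᴿ evalAt (divideAt f r) x
    divideAt-spec []          r x = solve 2 (λ x r → con (+ 0) := con (+ 0) :+ (x :- r) :* con (+ 0)) refl x r
    divideAt-spec (a ∷ [])    r x =
      solve 3 (λ a x r → a :+ x :* con (+ 0) := a :+ r :* con (+ 0) :+ (x :- r) :* con (+ 0)) refl a x r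
    divideAt-spec (a ∷ b ∷ f) r x = trans (+-congˡ (*-congˡ (divideAt-spec (b ∷ f) r x)))
      (solve 5 (λ a x r e g → a :+ x :* (e :+ (x :- r) :* g) := a :+ r :* e :+ (x :- r) :* (e :+ x :* g)) refl
        a x r (evalAt (b ∷ f) r) (evalAt (divideAt (b ∷ f) r) x))

    length-divideAt : ∀ a f r → length (divideAt (a ∷ f) r) ≡ length f
    length-divideAt a []      r = ≡.refl
    length-divideAt a (b ∷ f) r = cong suc (length-divideAt b f r)

    divideAt-zero : ∀ f r → All (_≈ 0#) (divideAt f r) → evalAt f r ≈ 0# → All (_≈ 0#) f
    divideAt-zero []          r zs e = []
    divideAt-zero (a ∷ [])    r zs e = trans (solve 2 (λ a r → a := a :+ r :* con (+ 0)) refl a r) e ∷ []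
    divideAt-zero (a ∷ b ∷ f) r (z ∷ zs) e =
      trans (sym (+-identityʳ a)) (trans (+-congˡ (sym (trans (*-congˡ z) (zeroʳ r)))) e) ∷ divideAt-zero (b ∷ f) r zs z

  -- A list of length l has degree below l, so l distinct roots are too many. Coefficient lists may
  -- end in zeros, hence the conclusion that all entries vanish; the induction divides by X - r.
  root-bound : ∀ f rs → length f ≤ length rs → AllPairs (λ a b → ¬ (a ≈ b)) rs →
               All (λ r → evalAt f r ≈ 0#) rs → All (_≈ 0#) f
  root-bound []      rs       _         _          _          = []
  root-bound (a ∷ f) (r ∷ rs) (s≤s f≤rs) (r≉ ∷ dist) (e ∷ es) = divideAt-zero (a ∷ f) r
    (root-bound (divideAt (a ∷ f) r) rs (subst (_≤ length rs) (≡.sym (length-divideAt a f r)) f≤rs) dist (roots rs r≉ es)) e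
    where
    roots : ∀ ss → All (λ s → ¬ (r ≈ s)) ss → All (λ s → evalAt (a ∷ f) s ≈ 0#) ss →
            All (λ s → evalAt (divideAt (a ∷ f) r) s ≈ 0#) ss
    roots []       []          []          = []
    roots (s ∷ ss) (r≉s ∷ r≉) (es ∷ ess) = integral (begin
        (s +ᴿ -ᴿ r) *ᴿ evalAt (divideAt (a ∷ f) r) s  ≈⟨ sym (+-identityˡ _) ⟩
        0# +ᴿ (s +ᴿ -ᴿ r) *ᴿ evalAt (divideAt (a ∷ f) r) s  ≈⟨ +-congʳ (sym e) ⟩
        evalAt (a ∷ f) r +ᴿ (s +ᴿ -ᴿ r) *ᴿ evalAt (divideAt (a ∷ f) r) s  ≈⟨ sym (divideAt-spec (a ∷ f) r s) ⟩
        evalAt (a ∷ f) s  ≈⟨ es ⟩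
        0#  ∎)
      (difference-≉0 (λ s≈r → r≉s (sym s≈r))) ∷ roots ss r≉ ess

  private
    -- x^(k+2) - x
    fixedPoly : ℕ → List Carrier
    fixedPoly k = 0# ∷ -ᴿ 1# ∷ replicate k 0# ++ 1# ∷ []

    evalAt-fixedPoly : ∀ k x → evalAt (fixedPoly k) x ≈ x ↑ suc (suc k) +ᴿ -ᴿ x
    evalAt-fixedPoly k x = trans (+-congˡ (*-congˡ (+-congˡ (*-congˡ (evalAt-monomial k)))))
      (solve 2 (λ x y → con (+ 0) :+ x :* ((:- con (+ 1)) :+ x :* y) := x :* (x :* y) :- x) refl x (x ↑ k))
      where
      evalAt-monomial : ∀ k → evalAt (replicate k 0# ++ 1# ∷ []) x ≈ x ↑ k
      evalAt-monomial zero    = trans (+-congˡ (zeroʳ x)) (+-identityʳ 1#)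
      evalAt-monomial (suc k) = trans (+-identityˡ _) (*-congˡ (evalAt-monomial k))

    length-fixedPoly : ∀ k → length (fixedPoly k) ≡ 3 + k
    length-fixedPoly k = cong (λ j → 2 + j) (≡.trans (length-++ (replicate k 0#)) (≡.trans (cong (_+ 1) (length-replicate k)) (ℕ.+-comm k 1)))

    fixedPoly-nonzero : ∀ k → ¬ All (_≈ 0#) (fixedPoly k)
    fixedPoly-nonzero k (_ ∷ _ ∷ zs) = leading k zs
      where
      leading : ∀ k → ¬ All (_≈ 0#) (replicate k 0# ++ 1# ∷ [])
      leading zero    (z ∷ _)  = 1≉0 z
      leading (suc k) (_ ∷ zs) = leading k zs

  -- x^(k+2) - x has at most k + 2 roots. This serves to find some g with g^E ≠ 1 in place of a
  -- primitive root, to identify the roots of y^p = y with the prime field, and as a pigeonhole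
  -- principle for q + 1 elements of F.
  too-many-fixed-points : ∀ k rs → 3 + k ≤ length rs → AllPairs (λ a b → ¬ (a ≈ b)) rs →
                          ¬ All (λ x → x ↑ (2 + k) ≈ x) rs
  too-many-fixed-points k rs k≤ dist fixed = fixedPoly-nonzero k (root-bound (fixedPoly k) rs
    (subst (_≤ length rs) (≡.sym (length-fixedPoly k)) k≤) dist
    (All.map (λ {x} e → trans (evalAt-fixedPoly k x) (trans (+-congʳ e) (-‿inverseʳ x))) fixed))

  ∑F-const : ∑F (λ _ → 1#) ≈ 0#
  ∑F-const = begin
    ∑F (λ _ → 1#)  ≈⟨ sum-const elems 1# ⟩
    length elems · 1#  ≡⟨ cong (_· 1#) card ⟩
    q · 1#  ≡⟨ ≡.sym (natF≡· q) ⟩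
    natF F q  ≡⟨ cong (λ k → natF F (p ^ k)) (≡.sym (ℕ.m+[n∸m]≡n n≥1)) ⟩
    natF F (p * p ^ (n ∸ 1))  ≡⟨ cong (natF F) (ℕ.*-comm p (p ^ (n ∸ 1))) ⟩
    natF F (p ^ (n ∸ 1) * p)  ≈⟨ natF-multiple (p ^ (n ∸ 1)) ⟩
    0#  ∎

  powerSum : ℕ → Carrier
  powerSum E = ∑F (_↑ E)

  ↑[q-1]-one : ∀ {x} → ¬ x ≈ 0# → x ↑ (q ∸ 1) ≈ 1#
  ↑[q-1]-one {x} x≉0 = *-cancelˡ _ 1# x≉0 (trans (reflexive (cong (x ↑_) suc[q-1])) (trans (fermat x) (sym (*-identityʳ x))))

  ↑-multiple-one : ∀ {x} k → ¬ x ≈ 0# → x ↑ ((q ∸ 1) * k) ≈ 1#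
  ↑-multiple-one {x} k x≉0 = trans (sym (^-assocʳ x (q ∸ 1) k)) (trans (^-congˡ k (↑[q-1]-one x≉0)) (1↑ k))

  -- c^E = 1 for every c ≠ 0, so the sum is q - 1 = -1 in F. At c = 0 the term vanishes because E ≥
  -- 1, and δ fills the gap.
  powerSum-divides : ∀ E → 1 ≤ E → (q ∸ 1) ∣ E → powerSum E ≈ -ᴿ 1#
  powerSum-divides E E≥1 (divides k E≡) = begin
    powerSum E  ≈⟨ solve 2 (λ a b → a := (a :+ b) :- b) refl (powerSum E) 1# ⟩
    (powerSum E +ᴿ 1#) +ᴿ -ᴿ 1#  ≈⟨ +-congʳ (+-congˡ (sym (∑F-single 0# (λ _ → 1#) (λ _ → refl)))) ⟩
    (powerSum E +ᴿ ∑F δ) +ᴿ -ᴿ 1#  ≈⟨ +-congʳ (sym (sum-∙ elems (_↑ E) δ)) ⟩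
    ∑F (λ c → c ↑ E +ᴿ δ c) +ᴿ -ᴿ 1#  ≈⟨ +-congʳ (trans (sum-cong elems one) ∑F-const) ⟩
    0# +ᴿ -ᴿ 1#  ≈⟨ +-identityˡ _ ⟩
    -ᴿ 1#  ∎
    where
    δ : Carrier → Carrier
    δ c = if does (c ≟ 0#) then 1# else 0#
    one : ∀ c → c ↑ E +ᴿ δ c ≈ 1#
    one c with c ≟ 0#
    ... | yes c≈0 = trans (+-congʳ (trans (^-congˡ E c≈0) (0↑ E {{ℕ.>-nonZero E≥1}}))) (+-identityˡ 1#)
    ... | no c≉0  = trans (+-identityʳ _) (trans (reflexive (cong (c ↑_) (≡.trans E≡ (ℕ.*-comm k (q ∸ 1))))) (↑-multiple-one k c≉0))

  -- Scaling c by some g with g^E ≠ 1 multiplies the sum by g^E.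
  powerSum-∤ : ∀ E → ¬ (q ∸ 1) ∣ E → powerSum E ≈ 0#
  powerSum-∤ E ∤E with all? (λ x → (x ↑ suc (E ℕ.% (q ∸ 1))) ≟ x) elems
  ... | yes fixed = contradiction fixed not-all
    where
    r : ℕ
    r = E ℕ.% (q ∸ 1)
    -- r = 0 would mean q - 1 | E. Otherwise x^(r+1) - x has degree r + 1 ≤ q - 1, too small for q
    -- roots.
    not-all : ¬ All (λ x → x ↑ suc r ≈ x) elems
    not-all with r in r≡
    ... | zero  = contradiction (ℕ.m%n≡0⇒n∣m E (q ∸ 1) r≡) ∤E
    ... | suc k = too-many-fixed-points k elems
      (ℕ.≤-trans (ℕ.≤-reflexive (cong (λ j → 2 + j) (≡.sym r≡)))
        (ℕ.≤-trans (s≤s (ℕ.m%n<n E (q ∸ 1))) (ℕ.≤-reflexive (≡.trans suc[q-1] (≡.sym card))))) distinct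
  ... | no ¬fixed with satisfied (¬All⇒Any¬ (λ x → (x ↑ suc (E ℕ.% (q ∸ 1))) ≟ x) elems ¬fixed)
  ...   | g , g↑≉g with inverse g (λ g≈0 → g↑≉g (trans (*-congʳ g≈0) (trans (zeroˡ _) (sym g≈0))))
  ...     | b , gb≈1 = integral {g ↑ E +ᴿ -ᴿ 1#} (begin
      (g ↑ E +ᴿ -ᴿ 1#) *ᴿ S  ≈⟨ solve 2 (λ a b → (a :- con (+ 1)) :* b := a :* b :- b) refl (g ↑ E) S ⟩
      g ↑ E *ᴿ S +ᴿ -ᴿ S  ≈⟨ +-congʳ scale ⟩
      S +ᴿ -ᴿ S  ≈⟨ -‿inverseʳ S ⟩
      0#  ∎) (difference-≉0 g↑E≉1)
      where
      S : Carrier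
      S = powerSum E

      g≉0 : ¬ g ≈ 0#
      g≉0 g≈0 = g↑≉g (trans (*-congʳ g≈0) (trans (zeroˡ _) (sym g≈0)))

      scale : g ↑ E *ᴿ S ≈ S
      scale = begin
        g ↑ E *ᴿ S  ≈⟨ *-distribˡ-sum elems (g ↑ E) _ ⟩
        ∑F (λ c → g ↑ E *ᴿ c ↑ E)  ≈⟨ sum-cong elems (λ c → sym (^-distrib-* g c E)) ⟩
        ∑F (λ c → (g *ᴿ c) ↑ E)  ≈⟨ ∑F-reindex (g *ᴿ_) (b *ᴿ_) *-congˡ *-congˡ
          (λ x → trans (sym (*-assoc g b x)) (trans (*-congʳ gb≈1) (*-identityˡ x)))
          (λ x → trans (sym (*-assoc b g x)) (trans (*-congʳ (trans (*-comm b g) gb≈1)) (*-identityˡ x)))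
          (_↑ E) (^-congˡ E) ⟩
        S  ∎

      g↑E≉1 : ¬ g ↑ E ≈ 1#
      g↑E≉1 e = g↑≉g (begin
        g *ᴿ g ↑ r  ≈⟨ *-congˡ (sym (*-identityʳ _)) ⟩
        g *ᴿ (g ↑ r *ᴿ 1#)  ≈⟨ *-congˡ (*-congˡ (sym (↑-multiple-one k g≉0))) ⟩
        g *ᴿ (g ↑ r *ᴿ g ↑ ((q ∸ 1) * k))  ≈⟨ *-congˡ (sym (^-homo-* g r _)) ⟩
        g *ᴿ g ↑ (r + (q ∸ 1) * k)  ≡⟨ cong (λ j → g *ᴿ g ↑ (r + j)) (ℕ.*-comm (q ∸ 1) k) ⟩
        g *ᴿ g ↑ (r + k * (q ∸ 1))  ≡⟨ cong (λ j → g *ᴿ g ↑ j) (≡.sym (ℕ.m≡m%n+[m/n]*n E (q ∸ 1))) ⟩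
        g *ᴿ g ↑ E  ≈⟨ *-congˡ e ⟩
        g *ᴿ 1#  ≈⟨ *-identityʳ g ⟩
        g  ∎)
        where
        r k : ℕ
        r = E ℕ.% (q ∸ 1)
        k = E ℕ./ (q ∸ 1)

-- The prime field and the absolute trace

prime∤⇒coprime : ∀ {p k} → Prime p → ¬ p ∣ k → Coprime p k
prime∤⇒coprime p-prime p∤k (d∣p , d∣k) with prime⇒irreducible p-prime d∣p
... | inj₁ d≡1    = d≡1
... | inj₂ ≡.refl = contradiction d∣k p∤k

module Trace (F : FiniteField) (p n : ℕ) (p-prime : Prime p)
             (char-p : FiniteField._≈_ F (natF F p) (FiniteField.0# F))
             (card : order F ≡ p ^ n) where
  open FiniteField F hiding (zero) renaming (_+_ to _+ᴿ_; _*_ to _*ᴿ_; -_ to -ᴿ_)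
  open SemiringExp semiring using (^-homo-*; ^-congˡ; ^-assocʳ) renaming (_^_ to _↑_)
  open CommutativeSemiringExp commutativeSemiring using (^-distrib-*)
  open IntegerImage commRing using (module Solver)
  open Solver using (_:+_; _:*_; _:-_; :-_; _:=_; con; solve)
  open RingSum commRing
  open FiniteFieldTheory F p n p-prime char-p card
  open SetoidReasoning setoid

  private
    instance
      p≢0 : NonZero p
      p≢0 = prime⇒nonZero p-prime

      n≢0 : NonZero n
      n≢0 = ℕ.>-nonZero n≥1

  -- For k prime to p, Bézout's identity read in F would give 1 = 0.
  natF≈0⇒∣ : ∀ k → natF F k ≈ 0# → p ∣ k
  natF≈0⇒∣ k e with p ℕ.∣? k
  ... | yes p∣k = p∣k
  ... | no p∤k with coprime-Bézout (coprime-sym (prime∤⇒coprime p-prime p∤k))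
  ...   | Bézout.+- x y 1+yp≡xk = contradiction (begin
      1#  ≈⟨ sym (+-identityʳ 1#) ⟩
      1# +ᴿ 0#  ≈⟨ +-congˡ (sym (natF-multiple y)) ⟩
      natF F (1 + y * p)  ≡⟨ cong (natF F) 1+yp≡xk ⟩
      natF F (x * k)  ≈⟨ natF-* x k ⟩
      natF F x *ᴿ natF F k  ≈⟨ trans (*-congˡ e) (zeroʳ _) ⟩
      0#  ∎) 1≉0
  ...   | Bézout.-+ x y 1+xk≡yp = contradiction (begin
      1#  ≈⟨ sym (+-identityʳ 1#) ⟩
      1# +ᴿ 0#  ≈⟨ +-congˡ (sym (trans (*-congˡ e) (zeroʳ _))) ⟩
      1# +ᴿ natF F x *ᴿ natF F k  ≈⟨ +-congˡ (sym (natF-* x k)) ⟩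
      natF F (1 + x * k)  ≡⟨ cong (natF F) 1+xk≡yp ⟩
      natF F (y * p)  ≈⟨ natF-multiple y ⟩
      0#  ∎) 1≉0

  natF-difference : ∀ {s t} → s ≤ t → natF F s ≈ natF F t → ∃[ k ] (t ≡ s + k * p)
  natF-difference {s} {t} s≤t e with natF≈0⇒∣ (t ∸ s) (begin
      natF F (t ∸ s)  ≈⟨ solve 2 (λ a b → a := (b :+ a) :- b) refl (natF F (t ∸ s)) (natF F s) ⟩
      (natF F s +ᴿ natF F (t ∸ s)) +ᴿ -ᴿ natF F s  ≈⟨ +-congʳ (sym (natF-+ s (t ∸ s))) ⟩
      natF F (s + (t ∸ s)) +ᴿ -ᴿ natF F s  ≡⟨ cong (λ j → natF F j +ᴿ -ᴿ natF F s) (ℕ.m+[n∸m]≡n s≤t) ⟩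
      natF F t +ᴿ -ᴿ natF F s  ≈⟨ +-congʳ (sym e) ⟩
      natF F s +ᴿ -ᴿ natF F s  ≈⟨ -‿inverseʳ _ ⟩
      0#  ∎)
  ... | divides k t-s≡kp = k , ≡.trans (≡.sym (ℕ.m+[n∸m]≡n s≤t)) (cong (λ j → s + j) t-s≡kp)

  natF-distinct : ∀ {i j} → i < j → j < p → ¬ natF F i ≈ natF F j
  natF-distinct {i} {j} i<j j<p e with natF-difference (ℕ.<⇒≤ i<j) e
  ... | zero  , j≡i+0  = ℕ.<⇒≢ i<j (≡.sym (≡.trans j≡i+0 (ℕ.+-identityʳ i)))
  ... | suc k , j≡i+kp = ℕ.<⇒≱ j<p (subst (p ≤_) (≡.sym j≡i+kp) (ℕ.≤-trans (ℕ.m≤m+n p (k * p)) (ℕ.m≤n+m (p + k * p) i)))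

  natF-fixed : ∀ k → natF F k ↑ p ≈ natF F k
  natF-fixed zero    = 0↑ p
  natF-fixed (suc k) = trans (frobenius-+ 1# (natF F k)) (+-cong (1↑ p) (natF-fixed k))

  -- The images of 0 , ... , p - 1 already exhaust the roots of y^p = y; one more would make p + 1.
  fixed⇒natF : ∀ {y} → y ↑ p ≈ y → Any (λ t → natF F t ≈ y) (upTo p)
  fixed⇒natF {y} y-fixed with any? (λ t → natF F t ≟ y) (upTo p)
  ... | yes found = found
  ... | no none   = contradiction (y-fixed ∷ Allₚ.applyUpTo⁺₁ (natF F) p (λ {i} _ → natF-fixed i)) (subst (λ e → ¬ All (λ x → x ↑ e ≈ x) ys)
      p-2+2 (too-many-fixed-points (p ∸ 2) ys (ℕ.≤-reflexive (≡.trans (cong suc p-2+2) (cong suc (≡.sym (length-applyUpTo (natF F) p)))))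
        (Allₚ.applyUpTo⁺₁ (natF F) p (λ i<p y≈ → none (Anyₚ.applyUpTo⁺ _ (sym y≈) i<p)) ∷ AllPairsₚ.applyUpTo⁺₁ (natF F) p natF-distinct)))
    where
    ys : List Carrier
    ys = y ∷ applyUpTo (natF F) p
    p-2+2 : 2 + (p ∸ 2) ≡ p
    p-2+2 = ℕ.m+[n∸m]≡n (prime≥2 p-prime)

  Tr : Carrier → Carrier
  Tr = trace F p n

  private
    tr : ℕ → Carrier → Carrier
    tr = trace F p

    tr-suc : ∀ k x → tr (suc k) x ≈ x ↑ (p ^ k) +ᴿ tr k x
    tr-suc k x = +-congʳ (reflexive (pow≡↑ x (p ^ k)))

    tr-cong : ∀ k {x y} → x ≈ y → tr k x ≈ tr k y
    tr-cong zero    e = refl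
    tr-cong (suc k) {x} {y} e = trans (tr-suc k x) (trans (+-cong (^-congˡ (p ^ k) e) (tr-cong k e)) (sym (tr-suc k y)))

    tr-+ : ∀ k x y → tr k (x +ᴿ y) ≈ tr k x +ᴿ tr k y
    tr-+ zero    x y = sym (+-identityˡ 0#)
    tr-+ (suc k) x y = begin
      tr (suc k) (x +ᴿ y)  ≈⟨ tr-suc k (x +ᴿ y) ⟩
      (x +ᴿ y) ↑ (p ^ k) +ᴿ tr k (x +ᴿ y)  ≈⟨ +-cong (frobenius^-+ k x y) (tr-+ k x y) ⟩
      (x ↑ (p ^ k) +ᴿ y ↑ (p ^ k)) +ᴿ (tr k x +ᴿ tr k y)
        ≈⟨ solve 4 (λ a b c e → (a :+ b) :+ (c :+ e) := (a :+ c) :+ (b :+ e)) refl (x ↑ (p ^ k)) (y ↑ (p ^ k)) (tr k x) (tr k y) ⟩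
      (x ↑ (p ^ k) +ᴿ tr k x) +ᴿ (y ↑ (p ^ k) +ᴿ tr k y)  ≈⟨ sym (+-cong (tr-suc k x) (tr-suc k y)) ⟩
      tr (suc k) x +ᴿ tr (suc k) y  ∎

    -- Frobenius shifts the summands by one place: x drops out and x^(p^k) enters. For k = n these
    -- two agree by Fermat.
    tr-frobenius : ∀ k x → tr k (x ↑ p) +ᴿ x ≈ tr k x +ᴿ x ↑ (p ^ k)
    tr-frobenius zero    x = +-congˡ (sym (*-identityʳ x))
    tr-frobenius (suc k) x = begin
      tr (suc k) (x ↑ p) +ᴿ x  ≈⟨ +-congʳ (tr-suc k (x ↑ p)) ⟩
      ((x ↑ p) ↑ (p ^ k) +ᴿ tr k (x ↑ p)) +ᴿ x  ≈⟨ +-assoc _ _ _ ⟩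
      (x ↑ p) ↑ (p ^ k) +ᴿ (tr k (x ↑ p) +ᴿ x)  ≈⟨ +-cong (^-assocʳ x p (p ^ k)) (tr-frobenius k x) ⟩
      x ↑ (p * p ^ k) +ᴿ (tr k x +ᴿ x ↑ (p ^ k))
        ≈⟨ solve 3 (λ a b c → a :+ (b :+ c) := (c :+ b) :+ a) refl (x ↑ (p * p ^ k)) (tr k x) (x ↑ (p ^ k)) ⟩
      (x ↑ (p ^ k) +ᴿ tr k x) +ᴿ x ↑ (p * p ^ k)  ≈⟨ +-congʳ (sym (tr-suc k x)) ⟩
      tr (suc k) x +ᴿ x ↑ (p * p ^ k)  ∎

    tr-↑p : ∀ k x → tr k x ↑ p ≈ tr k (x ↑ p)
    tr-↑p zero    x = 0↑ p
    tr-↑p (suc k) x = begin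
      tr (suc k) x ↑ p  ≈⟨ ^-congˡ p (tr-suc k x) ⟩
      (x ↑ (p ^ k) +ᴿ tr k x) ↑ p  ≈⟨ frobenius-+ (x ↑ (p ^ k)) (tr k x) ⟩
      (x ↑ (p ^ k)) ↑ p +ᴿ tr k x ↑ p  ≈⟨ +-cong (swap x (p ^ k)) (tr-↑p k x) ⟩
      (x ↑ p) ↑ (p ^ k) +ᴿ tr k (x ↑ p)  ≈⟨ sym (tr-suc k (x ↑ p)) ⟩
      tr (suc k) (x ↑ p)  ∎
      where
      swap : ∀ x e → (x ↑ e) ↑ p ≈ (x ↑ p) ↑ e
      swap x e = trans (^-assocʳ x e p) (trans (reflexive (cong (x ↑_) (ℕ.*-comm e p))) (sym (^-assocʳ x p e)))

  Tr-cong : ∀ {x y} → x ≈ y → Tr x ≈ Tr y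
  Tr-cong = tr-cong n

  Tr-+ : ∀ x y → Tr (x +ᴿ y) ≈ Tr x +ᴿ Tr y
  Tr-+ = tr-+ n

  Tr-0 : Tr 0# ≈ 0#
  Tr-0 = begin
    Tr 0#  ≈⟨ solve 1 (λ a → a := (a :+ a) :- a) refl (Tr 0#) ⟩
    (Tr 0# +ᴿ Tr 0#) +ᴿ -ᴿ Tr 0#  ≈⟨ +-congʳ (trans (sym (Tr-+ 0# 0#)) (Tr-cong (+-identityˡ 0#))) ⟩
    Tr 0# +ᴿ -ᴿ Tr 0#  ≈⟨ -‿inverseʳ _ ⟩
    0#  ∎

  Tr-natF* : ∀ k x → Tr (natF F k *ᴿ x) ≈ natF F k *ᴿ Tr x
  Tr-natF* zero    x = trans (Tr-cong (zeroˡ x)) (trans Tr-0 (sym (zeroˡ _)))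
  Tr-natF* (suc k) x = begin
    Tr ((1# +ᴿ natF F k) *ᴿ x)  ≈⟨ Tr-cong (trans (distribʳ x 1# (natF F k)) (+-congʳ (*-identityˡ x))) ⟩
    Tr (x +ᴿ natF F k *ᴿ x)  ≈⟨ Tr-+ x _ ⟩
    Tr x +ᴿ Tr (natF F k *ᴿ x)  ≈⟨ +-cong (sym (*-identityˡ _)) (Tr-natF* k x) ⟩
    1# *ᴿ Tr x +ᴿ natF F k *ᴿ Tr x  ≈⟨ sym (distribʳ (Tr x) 1# (natF F k)) ⟩
    (1# +ᴿ natF F k) *ᴿ Tr x  ∎

  Tr-frobenius : ∀ x → Tr (x ↑ p) ≈ Tr x
  Tr-frobenius x = begin
    Tr (x ↑ p)  ≈⟨ solve 2 (λ a b → a := (a :+ b) :- b) refl (Tr (x ↑ p)) x ⟩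
    (Tr (x ↑ p) +ᴿ x) +ᴿ -ᴿ x  ≈⟨ +-congʳ (trans (tr-frobenius n x) (+-congˡ (fermat x))) ⟩
    (Tr x +ᴿ x) +ᴿ -ᴿ x  ≈⟨ solve 2 (λ a b → (a :+ b) :- b := a) refl (Tr x) x ⟩
    Tr x  ∎

  Tr-frobenius^ : ∀ i x → Tr (x ↑ (p ^ i)) ≈ Tr x
  Tr-frobenius^ zero    x = Tr-cong (*-identityʳ x)
  Tr-frobenius^ (suc i) x = trans (Tr-cong (sym (^-assocʳ x p (p ^ i)))) (trans (Tr-frobenius^ i (x ↑ p)) (Tr-frobenius x))

  Tr-fixed : ∀ x → Tr x ↑ p ≈ Tr x
  Tr-fixed x = trans (tr-↑p n x) (Tr-frobenius x)

  private
    primeIdx-spec : ∀ {y} ks → Any (λ t → natF F t ≈ y) ks → natF F (primeIdx F y ks) ≈ y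
    primeIdx-spec {y} (k ∷ ks) found with natF F k ≟ y | found
    ... | yes k≈y | _           = k≈y
    ... | no k≉y  | here k≈y    = contradiction k≈y k≉y
    ... | no _    | there found = primeIdx-spec ks found

  -- `primeIdx` defaults to 0 when its search fails. As Tr x is fixed by Frobenius, it lies in the
  -- prime field and the search succeeds.
  natF-trIdx : ∀ x → natF F (trIdx F p n x) ≈ Tr x
  natF-trIdx x = primeIdx-spec (upTo p) (fixed⇒natF (Tr-fixed x))

  below : ℕ → (ℕ → Carrier) → Carrier
  below zero    f = 0#
  below (suc k) f = f k +ᴿ below k f

  private
    below-zero : ∀ k f → (∀ i → i < k → f i ≈ 0#) → below k f ≈ 0#
    below-zero zero    f z = refl
    below-zero (suc k) f z =
      trans (+-cong (z k (ℕ.n<1+n k)) (below-zero k f (λ i i<k → z i (ℕ.m<n⇒m<1+n i<k)))) (+-identityˡ 0#)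

    below-single : ∀ k f u → u < k → (∀ i → i < k → ¬ i ≡ u → f i ≈ 0#) → below k f ≈ f u
    below-single (suc k) f u u<k z with k ℕ.≟ u
    ... | yes ≡.refl = trans (+-congˡ (below-zero k f (λ i i<k → z i (ℕ.m<n⇒m<1+n i<k) (ℕ.<⇒≢ i<k)))) (+-identityʳ _)
    ... | no k≢u = trans (+-cong (z k (ℕ.n<1+n k) k≢u)
        (below-single k f u (ℕ.≤∧≢⇒< (ℕ.≤-pred u<k) (λ u≡k → k≢u (≡.sym u≡k))) (λ i i<k → z i (ℕ.m<n⇒m<1+n i<k)))) (+-identityˡ _)

  below-nonzero : ∀ k f → ¬ below k f ≈ 0# → ∃[ i ] (i < k × ¬ f i ≈ 0#)
  below-nonzero zero    f nz = contradiction refl nz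
  below-nonzero (suc k) f nz with f k ≟ 0#
  ... | no fk≉0  = k , ℕ.n<1+n k , fk≉0
  ... | yes fk≈0 with below-nonzero k f (λ e → nz (trans (+-cong fk≈0 e) (+-identityˡ 0#)))
  ...   | i , i<k , fi≉0 = i , ℕ.m<n⇒m<1+n i<k , fi≉0

  -- Expanding the trace separates c from x. The power sums over c then act as a filter: only those
  -- i survive for which q - 1 divides e + p^i.
  ∑-power-trace : ∀ e x → ∑F (λ c → c ↑ e *ᴿ Tr (c *ᴿ x)) ≈ below n (λ i → powerSum (e + p ^ i) *ᴿ x ↑ (p ^ i))
  ∑-power-trace e x = go n
    where
    go : ∀ k → ∑F (λ c → c ↑ e *ᴿ tr k (c *ᴿ x)) ≈ below k (λ i → powerSum (e + p ^ i) *ᴿ x ↑ (p ^ i))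
    go zero    = trans (sum-cong elems (λ c → zeroʳ (c ↑ e))) (sum-ε elems)
    go (suc k) = begin
      ∑F (λ c → c ↑ e *ᴿ tr (suc k) (c *ᴿ x))  ≈⟨ sum-cong elems step ⟩
      ∑F (λ c → c ↑ (e + p ^ k) *ᴿ x ↑ (p ^ k) +ᴿ c ↑ e *ᴿ tr k (c *ᴿ x))  ≈⟨ sum-∙ elems _ _ ⟩
      ∑F (λ c → c ↑ (e + p ^ k) *ᴿ x ↑ (p ^ k)) +ᴿ ∑F (λ c → c ↑ e *ᴿ tr k (c *ᴿ x))
        ≈⟨ +-cong (sym (*-distribʳ-sum elems (x ↑ (p ^ k)) (_↑ (e + p ^ k)))) (go k) ⟩
      powerSum (e + p ^ k) *ᴿ x ↑ (p ^ k) +ᴿ below k (λ i → powerSum (e + p ^ i) *ᴿ x ↑ (p ^ i))  ∎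
      where
      step : ∀ c → c ↑ e *ᴿ tr (suc k) (c *ᴿ x) ≈ c ↑ (e + p ^ k) *ᴿ x ↑ (p ^ k) +ᴿ c ↑ e *ᴿ tr k (c *ᴿ x)
      step c = begin
        c ↑ e *ᴿ tr (suc k) (c *ᴿ x)  ≈⟨ *-congˡ (tr-suc k (c *ᴿ x)) ⟩
        c ↑ e *ᴿ ((c *ᴿ x) ↑ (p ^ k) +ᴿ tr k (c *ᴿ x))  ≈⟨ *-congˡ (+-congʳ (^-distrib-* c x (p ^ k))) ⟩
        c ↑ e *ᴿ (c ↑ (p ^ k) *ᴿ x ↑ (p ^ k) +ᴿ tr k (c *ᴿ x))
          ≈⟨ solve 4 (λ a b y t → a :* (b :* y :+ t) := (a :* b) :* y :+ a :* t) refl (c ↑ e) (c ↑ (p ^ k)) (x ↑ (p ^ k)) (tr k (c *ᴿ x)) ⟩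
        (c ↑ e *ᴿ c ↑ (p ^ k)) *ᴿ x ↑ (p ^ k) +ᴿ c ↑ e *ᴿ tr k (c *ᴿ x)  ≈⟨ +-congʳ (*-congʳ (sym (^-homo-* c e (p ^ k)))) ⟩
        c ↑ (e + p ^ k) *ᴿ x ↑ (p ^ k) +ᴿ c ↑ e *ᴿ tr k (c *ᴿ x)  ∎

  private
    p^-< : ∀ {i j} → i < j → p ^ i < p ^ j
    p^-< i<j = ℕ.^-monoʳ-< p (prime≥2 p-prime) i<j

    p^-≢ : ∀ {i j} → ¬ i ≡ j → ¬ p ^ i ≡ p ^ j
    p^-≢ {i} {j} i≢j e with ℕ.<-cmp i j
    ... | tri< i<j _ _ = ℕ.<⇒≢ (p^-< i<j) e
    ... | tri≈ _ i≡j _ = i≢j i≡j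
    ... | tri> _ _ j<i = ℕ.<⇒≢ (p^-< j<i) (≡.sym e)

    p^≤q-1 : ∀ {i} → i < n → p ^ i ≤ q ∸ 1
    p^≤q-1 i<n = ℕ.∸-monoˡ-≤ 1 (p^-< i<n)

    unique-multiple : ∀ m a b → 1 ≤ a → a ≤ m → 1 ≤ b → b ≤ m → m ∣ m ∸ a + b → a ≡ b
    unique-multiple m a b 1≤a a≤m 1≤b b≤m (divides k e) = go k e
      where
      go : ∀ k → m ∸ a + b ≡ k * m → a ≡ b
      go zero e = contradiction 1≤b (ℕ.<⇒≱ (s≤s (ℕ.≤-reflexive (ℕ.m+n≡0⇒n≡0 (m ∸ a) e))))
      go (suc zero) e = ≡.sym (ℕ.+-cancelˡ-≡ (m ∸ a) b a (≡.trans e (≡.trans (ℕ.+-identityʳ m) (≡.sym (ℕ.m∸n+n≡m a≤m)))))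
      go (suc (suc k)) e = contradiction (ℕ.+-mono-<-≤ (ℕ.∸-monoʳ-< 1≤a a≤m) b≤m)
        (ℕ.≤⇒≯ (ℕ.≤-trans (ℕ.≤-trans (ℕ.m≤m+n (m + m) (k * m)) (ℕ.≤-reflexive (ℕ.+-assoc m m (k * m)))) (ℕ.≤-reflexive (≡.sym e))))

  -- With r = u mod n, the exponent q - 1 - p^r is the one for which the filter in `∑-power-trace`
  -- keeps i = r alone. The surviving power sum is -1, hence the sign.
  traceCoefficient : ℕ → Carrier → Carrier
  traceCoefficient u c = -ᴿ (c ↑ (q ∸ 1 ∸ p ^ (u ℕ.% n)))

  frobenius-mod : ∀ u x → x ↑ (p ^ u) ≈ x ↑ (p ^ (u ℕ.% n))
  frobenius-mod u x = begin
    x ↑ (p ^ u)  ≡⟨ cong (λ j → x ↑ (p ^ j)) (ℕ.m≡m%n+[m/n]*n u n) ⟩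
    x ↑ (p ^ (r + k * n))  ≡⟨ cong (x ↑_) (ℕ.^-distribˡ-+-* p r (k * n)) ⟩
    x ↑ (p ^ r * p ^ (k * n))  ≈⟨ sym (^-assocʳ x (p ^ r) (p ^ (k * n))) ⟩
    (x ↑ (p ^ r)) ↑ (p ^ (k * n))  ≈⟨ ↑q^ k (x ↑ (p ^ r)) ⟩
    x ↑ (p ^ r)  ∎
    where
    r k : ℕ
    r = u ℕ.% n
    k = u ℕ./ n
    ↑q^ : ∀ k y → y ↑ (p ^ (k * n)) ≈ y
    ↑q^ zero    y = *-identityʳ y
    ↑q^ (suc k) y = begin
      y ↑ (p ^ (n + k * n))  ≡⟨ cong (y ↑_) (ℕ.^-distribˡ-+-* p n (k * n)) ⟩
      y ↑ (q * p ^ (k * n))  ≈⟨ sym (^-assocʳ y q (p ^ (k * n))) ⟩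
      (y ↑ q) ↑ (p ^ (k * n))  ≈⟨ ^-congˡ (p ^ (k * n)) (fermat y) ⟩
      y ↑ (p ^ (k * n))  ≈⟨ ↑q^ k y ⟩
      y  ∎

  frobenius-as-traces : ∀ u x → x ↑ (p ^ u) ≈ ∑F (λ c → traceCoefficient u c *ᴿ Tr (c *ᴿ x))
  frobenius-as-traces u x = begin
    x ↑ (p ^ u)  ≈⟨ frobenius-mod u x ⟩
    x ↑ (p ^ r)  ≈⟨ solve 1 (λ a → a := (:- con (+ 1)) :* ((:- con (+ 1)) :* a)) refl (x ↑ (p ^ r)) ⟩
    -ᴿ 1# *ᴿ (-ᴿ 1# *ᴿ x ↑ (p ^ r))  ≈⟨ *-congˡ (*-congʳ (sym (powerSum-divides (e + p ^ r)
                                                                         (ℕ.≤-trans (ℕ.m^n>0 p r) (ℕ.m≤n+m (p ^ r) e))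
                                                                         (divides 1 (≡.trans (ℕ.m∸n+n≡m p^r≤) (≡.sym (ℕ.+-identityʳ (q ∸ 1)))))))) ⟩
    -ᴿ 1# *ᴿ (powerSum (e + p ^ r) *ᴿ x ↑ (p ^ r))  ≈⟨ *-congˡ (sym (below-single n _ r r<n vanish)) ⟩
    -ᴿ 1# *ᴿ below n (λ i → powerSum (e + p ^ i) *ᴿ x ↑ (p ^ i))  ≈⟨ *-congˡ (sym (∑-power-trace e x)) ⟩
    -ᴿ 1# *ᴿ ∑F (λ c → c ↑ e *ᴿ Tr (c *ᴿ x))  ≈⟨ *-distribˡ-sum elems (-ᴿ 1#) _ ⟩
    ∑F (λ c → -ᴿ 1# *ᴿ (c ↑ e *ᴿ Tr (c *ᴿ x)))
      ≈⟨ sum-cong elems (λ c → solve 2 (λ a b → (:- con (+ 1)) :* (a :* b) := (:- a) :* b) refl (c ↑ e) (Tr (c *ᴿ x))) ⟩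
    ∑F (λ c → traceCoefficient u c *ᴿ Tr (c *ᴿ x))  ∎
    where
    r e : ℕ
    r = u ℕ.% n
    e = q ∸ 1 ∸ p ^ r
    r<n : r < n
    r<n = ℕ.m%n<n u n
    p^r≤ : p ^ r ≤ q ∸ 1
    p^r≤ = p^≤q-1 r<n
    vanish : ∀ i → i < n → ¬ i ≡ r → powerSum (e + p ^ i) *ᴿ x ↑ (p ^ i) ≈ 0#
    vanish i i<n i≢r = trans (*-congʳ (powerSum-∤ (e + p ^ i) (λ q-1∣ → p^-≢ (λ r≡i → i≢r (≡.sym r≡i))
      (unique-multiple (q ∸ 1) (p ^ r) (p ^ i) (ℕ.m^n>0 p r) p^r≤ (ℕ.m^n>0 p i) (p^≤q-1 i<n) q-1∣)))) (zeroˡ _)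

  -- A trace vanishing everywhere would make 1 = 1^(p^0) a combination of zeros by
  -- `frobenius-as-traces`. A nonzero trace is normalised by its inverse, which lies in the prime
  -- field and so passes through Tr.
  trace-one : ∃[ x ] (Tr x ≈ 1#)
  trace-one with all? (λ x → Tr x ≟ 0#) elems
  ... | yes Tr≈0 = contradiction (begin
      1#  ≈⟨ sym (*-identityʳ 1#) ⟩
      1# ↑ (p ^ 0)  ≈⟨ frobenius-as-traces 0 1# ⟩
      ∑F (λ c → traceCoefficient 0 c *ᴿ Tr (c *ᴿ 1#))  ≈⟨ sum-cong elems (λ c →
        trans (*-congˡ (trans (Tr-cong (*-identityʳ c)) (Tr≈0-everywhere c))) (zeroʳ _)) ⟩
      ∑F (λ _ → 0#)  ≈⟨ sum-ε elems ⟩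
      0#  ∎) 1≉0
    where
    Tr≈0-everywhere : ∀ c → Tr c ≈ 0#
    Tr≈0-everywhere c = lookup-All elems (complete c) Tr≈0
      where
      lookup-All : ∀ xs → Any (c ≈_) xs → All (λ x → Tr x ≈ 0#) xs → Tr c ≈ 0#
      lookup-All (x ∷ xs) (here c≈x) (z ∷ _)  = trans (Tr-cong c≈x) z
      lookup-All (x ∷ xs) (there c∈) (_ ∷ zs) = lookup-All xs c∈ zs
  ... | no ¬all with satisfied (¬All⇒Any¬ (λ x → Tr x ≟ 0#) elems ¬all)
  ...   | c , Trc≉0 with inverse (Tr c) Trc≉0
  ...     | b , e with satisfied (fixed⇒natF b-fixed)
    where
    b-fixed : b ↑ p ≈ b
    b-fixed = *-cancelˡ (b ↑ p) b Trc≉0 (begin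
      Tr c *ᴿ b ↑ p  ≈⟨ *-congʳ (sym (Tr-fixed c)) ⟩
      Tr c ↑ p *ᴿ b ↑ p  ≈⟨ sym (^-distrib-* (Tr c) b p) ⟩
      (Tr c *ᴿ b) ↑ p  ≈⟨ trans (^-congˡ p e) (1↑ p) ⟩
      1#  ≈⟨ sym e ⟩
      Tr c *ᴿ b  ∎)
  ...       | t , t≈b = natF F t *ᴿ c , trans (Tr-natF* t c) (trans (*-congʳ t≈b) (trans (*-comm b (Tr c)) e))

inverse-mod : ∀ d m → 1 ≤ d → 1 ≤ m → gcd d m ≡ 1 → ∃[ e ] ∃[ k ] (d * e ≡ suc (k * m))
inverse-mod d m d≥1 m≥1 coprime with coprime-Bézout (gcd≡1⇒coprime coprime)
... | Bézout.+- x y eq = x , y , ≡.trans (ℕ.*-comm d x) (≡.sym eq)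
-- With D = d + 1 and M = m + 1, the relation 1 + x D = y M makes -x the inverse of D; x (M - 1) + M
-- is a natural number in that class.
inverse-mod (suc d) (suc m) _ _ _ | Bézout.-+ x y eq = x * m + suc m , y * m + d ,
  ℕ.+-cancelˡ-≡ m _ _ (≡.trans (lhs x d m) (≡.trans (cong (λ j → j * m + suc d * suc m) eq) (rhs y d m)))
  where
  lhs : ∀ x d m → m + suc d * (x * m + suc m) ≡ (1 + x * suc d) * m + suc d * suc m
  lhs = ℕ-solve-∀
  rhs : ∀ y d m → y * suc m * m + suc d * suc m ≡ m + suc ((y * m + d) * suc m)
  rhs = ℕ-solve-∀

-- Additive characters and binomial sums

module CharacterSums (F : FiniteField) (p n d : ℕ) (p-prime : Prime p)
                     (char-p : FiniteField._≈_ F (natF F p) (FiniteField.0# F))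
                     (card : order F ≡ p ^ n) (d≥1 : 1 ≤ d) (d-coprime : gcd d (p ^ n ∸ 1) ≡ 1)
                     (C : CyclotomicRing p) where
  open FiniteFieldTheory F p n p-prime char-p card
  open Trace F p n p-prime char-p card
  open CyclotomicRing C using (ζ; π̂; ζ^p; π-regular) renaming (ring to A)
  open PiAdic p-prime C
  private
    module F where
      open FiniteField F public
      open SemiringExp semiring public using (^-homo-*; ^-congˡ; ^-assocʳ) renaming (_^_ to _↑_)
      open CommutativeSemiringExp commutativeSemiring public using (^-distrib-*)
      open IntegerImage.Solver commRing public using (solve; _:+_; _:*_; _:-_; :-_; _:=_; con)

  open CommutativeRing A hiding (zero; ring) renaming (_+_ to _+ᴿ_; _*_ to _*ᴿ_; -_ to -ᴿ_)
  open SemiringMult semiring using () renaming (_×_ to _·_)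
  open SemiringExp semiring using (^-homo-*; ^-congˡ; ^-assocʳ) renaming (_^_ to _↑_)
  open IntegerImage A using (module Solver)
  open Solver using (_:+_; _:*_; _:-_; :-_; _:=_; con; solve)
  private
    module ∑A where
      open FieldSum F +-commutativeMonoid public
      open RingSum A public
    module ∑F′ = RingSum F.commRing

  private
    d-inverse : ∃[ e ] ∃[ k ] (d * e ≡ suc (k * (q ∸ 1)))
    d-inverse = inverse-mod d (q ∸ 1) d≥1 (ℕ.∸-monoˡ-≤ 1 q≥2) d-coprime

  -- The additional factor x makes this hold at x = 0 too.
  ↑-mod : ∀ k x → x F.↑ suc (k * (q ∸ 1)) F.≈ x
  ↑-mod k x with x F.≟ F.0#
  ... | yes x≈0 = F.trans (F.*-congʳ x≈0) (F.trans (F.zeroˡ _) (F.sym x≈0))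
  ... | no x≉0  = F.trans (F.*-congˡ (F.trans (F.reflexive (cong (x F.↑_) (ℕ.*-comm k (q ∸ 1)))) (↑-multiple-one k x≉0))) (F.*-identityʳ x)

  dth-root : ∀ c → ∃[ μ ] (μ F.↑ d F.≈ c)
  dth-root c with d-inverse
  ... | e , k , de≡ = c F.↑ e , F.trans (F.^-assocʳ c e d) (F.trans (F.reflexive (cong (c F.↑_) (≡.trans (ℕ.*-comm e d) de≡))) (↑-mod k c))

  ↑d-injective : ∀ {x y} → x F.↑ d F.≈ y F.↑ d → x F.≈ y
  ↑d-injective {x} {y} eq with d-inverse
  ... | e , k , de≡ = F.trans (F.sym (undo x)) (F.trans (F.^-congˡ e eq) (undo y))
    where
    undo : ∀ x → (x F.↑ d) F.↑ e F.≈ x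
    undo x = F.trans (F.^-assocʳ x d e) (F.trans (F.reflexive (cong (x F.↑_) de≡)) (↑-mod k x))

  ψ : F.Carrier → Carrier
  ψ x = ζ ↑ trIdx F p n x

  open SetoidReasoning setoid

  private
    ζ↑+kp : ∀ s k → ζ ↑ (s + k * p) ≈ ζ ↑ s
    ζ↑+kp s k = begin
      ζ ↑ (s + k * p)  ≈⟨ ^-homo-* ζ s (k * p) ⟩
      ζ ↑ s *ᴿ ζ ↑ (k * p)  ≡⟨ cong (λ j → ζ ↑ s *ᴿ ζ ↑ j) (ℕ.*-comm k p) ⟩
      ζ ↑ s *ᴿ ζ ↑ (p * k)  ≈⟨ *-congˡ (trans (sym (^-assocʳ ζ p k)) (trans (^-congˡ k ζ^p) (one k))) ⟩
      ζ ↑ s *ᴿ 1#  ≈⟨ *-identityʳ _ ⟩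
      ζ ↑ s  ∎
      where
      one : ∀ k → 1# ↑ k ≈ 1#
      one zero    = refl
      one (suc k) = trans (*-identityˡ _) (one k)

  ζ↑-cong : ∀ s t → natF F s F.≈ natF F t → ζ ↑ s ≈ ζ ↑ t
  ζ↑-cong s t e with ℕ.≤-total s t
  ... | inj₁ s≤t = let k , t≡ = natF-difference s≤t e in sym (trans (reflexive (cong (ζ ↑_) t≡)) (ζ↑+kp s k))
  ... | inj₂ t≤s = let k , s≡ = natF-difference t≤s (F.sym e) in trans (reflexive (cong (ζ ↑_) s≡)) (ζ↑+kp t k)

  -- Any natural number with the right image in F may replace the index chosen by `trIdx`, because
  -- ζ^p = 1.
  ψ-Tr : ∀ {x} t → Tr x F.≈ natF F t → ψ x ≈ ζ ↑ t
  ψ-Tr {x} t e = ζ↑-cong (trIdx F p n x) t (F.trans (natF-trIdx x) e)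

  ψ-cong-Tr : ∀ {x y} → Tr x F.≈ Tr y → ψ x ≈ ψ y
  ψ-cong-Tr {x} {y} e = ψ-Tr (trIdx F p n y) (F.trans e (F.sym (natF-trIdx y)))

  ψ-cong : ∀ {x y} → x F.≈ y → ψ x ≈ ψ y
  ψ-cong x≈y = ψ-cong-Tr (Tr-cong x≈y)

  ψ-+ : ∀ x y → ψ (x F.+ y) ≈ ψ x *ᴿ ψ y
  ψ-+ x y = trans (ψ-Tr (s + t) (F.trans (Tr-+ x y) (F.trans (F.sym (F.+-cong (natF-trIdx x) (natF-trIdx y))) (F.sym (natF-+ s t)))))
                  (^-homo-* ζ s t)
    where
    s t : ℕ
    s = trIdx F p n x
    t = trIdx F p n y

  ψ-0 : ψ F.0# ≈ 1#
  ψ-0 = ψ-Tr 0 Tr-0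

  ∑ψ-const : ∑A.∑F (λ _ → 1#) ≈ q · 1#
  ∑ψ-const = trans (∑A.sum-const F.elems 1#) (reflexive (cong (_· 1#) card))

  -- Translating x by some y with Tr(b y) = 1 multiplies the sum S by ζ. Hence π S = 0, and π is
  -- regular.
  ∑ψ-zero : ∀ {b} → ¬ b F.≈ F.0# → ∑A.∑F (λ x → ψ (b F.* x)) ≈ 0#
  ∑ψ-zero {b} b≉0 with trace-one | F.inverse b b≉0
  ... | x₀ , Tr≈1 | b⁻¹ , bb⁻¹≈1 = π-regular (begin
      π̂ *ᴿ S  ≈⟨ solve 2 (λ z s → (con (+ 1) :- z) :* s := s :- s :* z) refl ζ S ⟩
      S +ᴿ -ᴿ (S *ᴿ ζ)  ≈⟨ +-congˡ (-‿cong (sym shift)) ⟩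
      S +ᴿ -ᴿ S  ≈⟨ -‿inverseʳ S ⟩
      0#  ∎)
    where
    S : Carrier
    S = ∑A.∑F (λ x → ψ (b F.* x))

    y : F.Carrier
    y = b⁻¹ F.* x₀

    by≈x₀ : b F.* y F.≈ x₀
    by≈x₀ = F.trans (F.sym (F.*-assoc b b⁻¹ x₀)) (F.trans (F.*-congʳ bb⁻¹≈1) (F.*-identityˡ x₀))

    ψx₀≈ζ : ψ x₀ ≈ ζ
    ψx₀≈ζ = trans (ψ-Tr 1 (F.trans Tr≈1 (F.sym (F.+-identityʳ F.1#)))) (*-identityʳ ζ)

    shift : S ≈ S *ᴿ ζ
    shift = begin
      S  ≈⟨ sym (∑A.∑F-reindex (F._+ y) (F._+ (F.- y)) F.+-congʳ F.+-congʳ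
        (λ x → F.solve 2 (λ x y → (x F.:- y) F.:+ y F.:= x) F.refl x y) (λ x → F.solve 2 (λ x y → (x F.:+ y) F.:- y F.:= x) F.refl x y)
        (λ x → ψ (b F.* x)) (λ e → ψ-cong (F.*-congˡ e))) ⟩
      ∑A.∑F (λ x → ψ (b F.* (x F.+ y)))  ≈⟨ ∑A.sum-cong F.elems (λ x → trans (ψ-cong (F.trans (F.distribˡ b x y) (F.+-congˡ by≈x₀)))
        (trans (ψ-+ _ x₀) (*-congˡ ψx₀≈ζ))) ⟩
      ∑A.∑F (λ x → ψ (b F.* x) *ᴿ ζ)  ≈⟨ sym (∑A.*-distribʳ-sum F.elems ζ _) ⟩
      S *ᴿ ζ  ∎

  ∑ψ-divisible : ∀ b {K} → K ≤ n * (p ∸ 1) → π^ K ∣ ∑A.∑F (λ x → ψ (b F.* x))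
  ∑ψ-divisible b {K} K≤N with b F.≟ F.0#
  ... | yes b≈0 = π∣-respects K (sym (trans (∑A.sum-cong F.elems (λ x → trans (ψ-cong (F.trans (F.*-congʳ b≈0) (F.zeroˡ x))) ψ-0)) ∑ψ-const)) (π∣q n K≤N)
  ... | no b≉0  = π∣-respects K (sym (∑ψ-zero b≉0)) (π∣-0 K)

  weil : F.Carrier → Carrier
  weil a = ∑A.∑F (λ x → ψ (x F.↑ d F.- a F.* x))

  -- For c = μ^d ≠ 0, the substitution of μ x for x identifies the sum with `weil` at -b/μ. For c =
  -- 0 it is 0 or q, and K ≤ N covers q.
  binomial-divisible : ∀ {K} → K ≤ n * (p ∸ 1) → (∀ a → π^ K ∣ weil a) →
                       ∀ c b → π^ K ∣ ∑A.∑F (λ x → ψ (c F.* x F.↑ d F.+ b F.* x))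
  binomial-divisible {K} K≤N weil-divisible c b with c F.≟ F.0#
  ... | yes c≈0 = π∣-respects K (∑A.sum-cong F.elems (λ x → ψ-cong (F.sym (F.trans (F.+-congʳ (F.trans (F.*-congʳ c≈0) (F.zeroˡ _))) (F.+-identityˡ _)))))
                              (∑ψ-divisible b K≤N)
  ... | no c≉0 with dth-root c
  ...   | μ , μ^d≈c with F.inverse μ (λ μ≈0 → c≉0 (F.trans (F.sym μ^d≈c) (F.trans (F.^-congˡ d μ≈0) (0↑ d {{ℕ.>-nonZero d≥1}}))))
  ...     | ν , μν≈1 = π∣-respects K (begin
      weil (F.- (b F.* ν))  ≈⟨ ∑A.sum-cong F.elems (λ x → ψ-cong (F.+-congˡ
        (F.solve 3 (λ b v x → F.:- ((F.:- (b F.:* v)) F.:* x) F.:= b F.:* v F.:* x) F.refl b ν x))) ⟩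
      ∑A.∑F f  ≈⟨ sym (∑A.∑F-reindex (μ F.*_) (ν F.*_) F.*-congˡ F.*-congˡ
        (λ x → F.trans (F.sym (F.*-assoc μ ν x)) (F.trans (F.*-congʳ μν≈1) (F.*-identityˡ x)))
        (λ x → F.trans (F.sym (F.*-assoc ν μ x)) (F.trans (F.*-congʳ (F.trans (F.*-comm ν μ) μν≈1)) (F.*-identityˡ x)))
        f f-cong) ⟩
      ∑A.∑F (λ x → f (μ F.* x))  ≈⟨ ∑A.sum-cong F.elems (λ x → ψ-cong (F.+-cong
        (F.trans (F.^-distrib-* μ x d) (F.*-congʳ μ^d≈c))
        (F.trans (F.solve 4 (λ b v m x → b F.:* v F.:* (m F.:* x) F.:= b F.:* (m F.:* v) F.:* x) F.refl b ν μ x)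
          (F.*-congʳ (F.trans (F.*-congˡ μν≈1) (F.*-identityʳ b)))))) ⟩
      ∑A.∑F (λ x → ψ (c F.* x F.↑ d F.+ b F.* x))  ∎)
    (weil-divisible (F.- (b F.* ν)))
    where
    f : F.Carrier → Carrier
    f y = ψ (y F.↑ d F.+ b F.* ν F.* y)
    f-cong : ∀ {x y} → x F.≈ y → f x ≈ f y
    f-cong e = ψ-cong (F.+-cong (F.^-congˡ d e) (F.*-congˡ e))

-- Digit sums: no short multiple of q - 1

module DigitSums (F : FiniteField) (p n d : ℕ) (p-prime : Prime p)
                 (char-p : FiniteField._≈_ F (natF F p) (FiniteField.0# F))
                 (card : order F ≡ p ^ n) (d≥1 : 1 ≤ d) (d-coprime : gcd d (p ^ n ∸ 1) ≡ 1)
                 (C : CyclotomicRing p) where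
  open FiniteFieldTheory F p n p-prime char-p card
  open Trace F p n p-prime char-p card
  open CyclotomicRing C using (ζ; π̂; aug; aug-+; aug-*; aug-0; aug-1; aug-ζ) renaming (ring to A)
  open PiAdic p-prime C
  open CharacterSums F p n d p-prime char-p card d≥1 d-coprime C
  private
    module F where
      open FiniteField F public
      open SemiringExp semiring public using (^-homo-*; ^-assocʳ) renaming (_^_ to _↑_)
      open IntegerImage commRing public using (ι; ι-+; ι-*)
      open IntegerImage.Solver commRing public using (solve; _:+_; _:*_; _:-_; :-_; _:=_; con)
      open RingSum commRing public

  open CommutativeRing A hiding (zero; ring) renaming (_+_ to _+ᴿ_; _*_ to _*ᴿ_; -_ to -ᴿ_)
  open SemiringExp semiring using () renaming (_^_ to _↑_)
  open IntegerImage A using (module Solver)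
  open Solver using (_:+_; _:*_; _:-_; :-_; _:=_; con; solve)
  private
    module ∑A where
      open FieldSum F +-commutativeMonoid public
      open RingSum A public

  -- The ζ-analogue 1 + ζ + ... + ζ^(t-1) of t, that is, (1 - ζ^t)/π.
  bracket : ℕ → Carrier
  bracket zero    = 0#
  bracket (suc t) = 1# +ᴿ ζ *ᴿ bracket t

  1-ζ↑ : ∀ t → 1# +ᴿ -ᴿ (ζ ↑ t) ≈ π̂ *ᴿ bracket t
  1-ζ↑ zero    = trans (-‿inverseʳ 1#) (sym (zeroʳ π̂))
  1-ζ↑ (suc t) = trans (solve 2 (λ z y → con (+ 1) :- z :* y := (con (+ 1) :- z) :+ z :* (con (+ 1) :- y)) refl ζ (ζ ↑ t))
    (trans (+-congˡ (*-congˡ (1-ζ↑ t))) (solve 2 (λ z b → (con (+ 1) :- z) :+ z :* ((con (+ 1) :- z) :* b)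
      := (con (+ 1) :- z) :* (con (+ 1) :+ z :* b)) refl ζ (bracket t)))

  -- Reduction modulo π, with the residue field 𝔽_p placed inside F.
  θ : Carrier → F.Carrier
  θ f = F.ι (aug f)

  private
    θ-+ : ∀ f g → θ (f +ᴿ g) F.≈ θ f F.+ θ g
    θ-+ f g = F.trans (F.reflexive (cong F.ι (aug-+ f g))) (F.ι-+ (aug f) (aug g))

    θ-* : ∀ f g → θ (f *ᴿ g) F.≈ θ f F.* θ g
    θ-* f g = F.trans (F.reflexive (cong F.ι (aug-* f g))) (F.ι-* (aug f) (aug g))

    θ-0 : θ 0# F.≈ F.0#
    θ-0 = F.reflexive (cong F.ι aug-0)

    θ-1 : θ 1# F.≈ F.1#
    θ-1 = F.trans (F.reflexive (cong F.ι aug-1)) (F.+-identityʳ F.1#)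

    θ-bracket : ∀ t → θ (bracket t) F.≈ natF F t
    θ-bracket zero    = θ-0
    θ-bracket (suc t) = F.trans (θ-+ 1# _) (F.+-cong θ-1 (F.trans (θ-* ζ (bracket t))
      (F.trans (F.*-cong (F.trans (F.reflexive (cong F.ι aug-ζ)) (F.+-identityʳ F.1#)) (θ-bracket t)) (F.*-identityˡ _))))

    θ-sum : ∀ xs (f : F.Carrier → Carrier) → θ (∑A.sum xs f) F.≈ sum xs (λ x → θ (f x))
    θ-sum []       f = θ-0
    θ-sum (x ∷ xs) f = F.trans (θ-+ (f x) _) (F.+-congˡ (θ-sum xs f))

    θ-π∣ : ∀ {w} → π^ 1 ∣ w → θ w F.≈ F.0#
    θ-π∣ {w} d with aug-π∣ 0 d
    ... | c , e = F.trans (F.reflexive (cong F.ι e)) (F.trans (F.ι-* (+ p) c)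
      (F.trans (F.*-congʳ (F.trans (F.reflexive (≡.sym (natF≡· p))) char-p)) (F.zeroˡ _)))

  -- The form Tr(c x^d + b x) is represented by the pair (c , b).
  Form : Set
  Form = F.Carrier × F.Carrier

  form : Form → F.Carrier → F.Carrier
  form (c , b) x = c F.* x F.↑ d F.+ b F.* x

  traceProduct : List Form → F.Carrier → F.Carrier
  traceProduct []      x = F.1#
  traceProduct (l ∷ L) x = Tr (form l x) F.* traceProduct L x

  private
    ψProduct : List Form → F.Carrier → Carrier
    ψProduct []      x = 1#
    ψProduct (l ∷ L) x = (1# +ᴿ -ᴿ ψ (form l x)) *ᴿ ψProduct L x

    bracketProduct : List Form → F.Carrier → Carrier
    bracketProduct []      x = 1#
    bracketProduct (l ∷ L) x = bracket (trIdx F p n (form l x)) *ᴿ bracketProduct L x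

    ψProduct≈ : ∀ L x → ψProduct L x ≈ π̂ ↑ length L *ᴿ bracketProduct L x
    ψProduct≈ []      x = sym (*-identityˡ 1#)
    ψProduct≈ (l ∷ L) x = trans (*-cong (1-ζ↑ (trIdx F p n (form l x))) (ψProduct≈ L x))
      (solve 4 (λ a b c e → (a :* b) :* (c :* e) := (a :* c) :* (b :* e)) refl π̂ _ (π̂ ↑ length L) (bracketProduct L x))

    θ-bracketProduct : ∀ L x → θ (bracketProduct L x) F.≈ traceProduct L x
    θ-bracketProduct []      x = θ-1
    θ-bracketProduct (l ∷ L) x = F.trans (θ-* _ _) (F.*-cong (F.trans (θ-bracket (trIdx F p n (form l x))) (natF-trIdx (form l x))) (θ-bracketProduct L x))

    module Divisible {K : ℕ} (K≤N : K ≤ n * (p ∸ 1)) (weil-divisible : ∀ a → π^ K ∣ weil a) where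

      -- The separate character ψ(γ x^d + β x) makes the induction close: expanding one factor 1 - ψ
      -- gives two sums of the same shape, and in one of them its form has been added to (γ , β).
      ∑ψProduct-divisible : ∀ L γ β → π^ K ∣ ∑A.∑F (λ x → ψ (form (γ , β) x) *ᴿ ψProduct L x)
      ∑ψProduct-divisible [] γ β =
        π∣-respects K (∑A.sum-cong F.elems (λ x → sym (*-identityʳ _))) (binomial-divisible K≤N weil-divisible γ β)
      ∑ψProduct-divisible ((c , b) ∷ L) γ β = π∣-respects K (sym split)
        (π∣-+ K (∑ψProduct-divisible L γ β)
          (π∣-neg K (∑ψProduct-divisible L (γ F.+ c) (β F.+ b))))
        where
        S′ : Carrier
        S′ = ∑A.∑F (λ x → ψ (form (γ F.+ c , β F.+ b) x) *ᴿ ψProduct L x)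
        split : ∑A.∑F (λ x → ψ (form (γ , β) x) *ᴿ ((1# +ᴿ -ᴿ ψ (form (c , b) x)) *ᴿ ψProduct L x))
              ≈ ∑A.∑F (λ x → ψ (form (γ , β) x) *ᴿ ψProduct L x) +ᴿ -ᴿ S′
        split = trans (∑A.sum-cong F.elems pointwise) (trans (∑A.sum-∙ F.elems _ _)
          (+-congˡ (trans (sym (∑A.*-distribˡ-sum F.elems (-ᴿ 1#) _)) (solve 1 (λ a → (:- con (+ 1)) :* a := :- a) refl S′))))
          where
          pointwise : ∀ x → ψ (form (γ , β) x) *ᴿ ((1# +ᴿ -ᴿ ψ (form (c , b) x)) *ᴿ ψProduct L x)
                          ≈ ψ (form (γ , β) x) *ᴿ ψProduct L x +ᴿ -ᴿ 1# *ᴿ (ψ (form (γ F.+ c , β F.+ b) x) *ᴿ ψProduct L x)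
          pointwise x = trans
            (solve 3 (λ a b c → a :* ((con (+ 1) :- b) :* c) := a :* c :+ (:- con (+ 1)) :* (a :* b :* c)) refl
              (ψ (form (γ , β) x)) (ψ (form (c , b) x)) (ψProduct L x))
            (+-congˡ (*-congˡ (*-congʳ (trans (sym (ψ-+ _ _)) (ψ-cong (F.solve 6 (λ g c b e x y →
              (g F.:* x F.:+ e F.:* y) F.:+ (c F.:* x F.:+ b F.:* y) F.:= (g F.:+ c) F.:* x F.:+ (e F.:+ b) F.:* y) F.refl γ c b β (x F.↑ d) x))))))

      -- Each factor 1 - ψ contributes one π. After cancelling these, at least one π is left since
      -- length L < K, and reduction modulo π turns the remaining sum into the sum of trace
      -- products.
      ∑traceProduct-zero : ∀ L → length L < K → ∑F (traceProduct L) F.≈ F.0#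
      ∑traceProduct-zero L L<K = F.trans (F.sym (F.trans (θ-sum F.elems _) (sum-cong F.elems (θ-bracketProduct L)))) (θ-π∣ π∣∑)
        where
        π∣∑ψ : π^ (length L + 1) ∣ ∑A.∑F (ψProduct L)
        π∣∑ψ = π∣-≤ {length L + 1} {K} (subst (_≤ K) (ℕ.+-comm 1 (length L)) L<K)
          (π∣-respects K (∑A.sum-cong F.elems (λ x → trans (*-congʳ (trans (ψ-cong (zero-form x)) ψ-0)) (*-identityˡ _)))
            (∑ψProduct-divisible L F.0# F.0#))
          where
          zero-form : ∀ x → form (F.0# , F.0#) x F.≈ F.0#
          zero-form x = F.trans (F.+-cong (F.zeroˡ _) (F.zeroˡ x)) (F.+-identityˡ F.0#)
        π∣∑ : π^ 1 ∣ ∑A.∑F (bracketProduct L)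
        π∣∑ with π∣∑ψ
        ... | y , e = y , π↑-cancel (length L) (trans (∑A.*-distribˡ-sum F.elems (π̂ ↑ length L) _)
            (trans (sym (∑A.sum-cong F.elems (ψProduct≈ L))) (trans e (trans (*-congʳ (^-homo-* π̂ (length L) 1)) (*-assoc _ _ y)))))
          where open SemiringExp semiring using (^-homo-*)

  -- The digit (true , u) stands for the exponent d p^u and (false , u) for p^u.
  Digit : Set
  Digit = Bool × ℕ

  exponent : Digit → ℕ
  exponent (true  , u) = d * p ^ u
  exponent (false , u) = p ^ u

  exponents : List Digit → ℕ
  exponents []      = 0
  exponents (m ∷ M) = exponent m + exponents M

  private
    powerProduct : List Digit → F.Carrier → F.Carrier
    powerProduct []      x = F.1#
    powerProduct (m ∷ M) x = x F.↑ exponent m F.* powerProduct M x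

    powerProduct≈ : ∀ M x → powerProduct M x F.≈ x F.↑ exponents M
    powerProduct≈ []      x = F.refl
    powerProduct≈ (m ∷ M) x = F.trans (F.*-congˡ (powerProduct≈ M x)) (F.sym (F.^-homo-* x (exponent m) (exponents M)))

    digitForm : Digit → F.Carrier → Form
    digitForm (true  , u) c = c , F.0#
    digitForm (false , u) c = F.0# , c

    digit-as-traces : ∀ m x → x F.↑ exponent m F.≈ ∑F (λ c → traceCoefficient (proj₂ m) c F.* Tr (form (digitForm m c) x))
    digit-as-traces (true  , u) x = F.trans (F.sym (F.^-assocʳ x d (p ^ u))) (F.trans (frobenius-as-traces u (x F.↑ d))
      (sum-cong F.elems (λ c → F.*-congˡ (Tr-cong (F.solve 3 (λ c x y → c F.:* x F.:= c F.:* x F.:+ F.con (+ 0) F.:* y) F.refl c (x F.↑ d) x)))))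
    digit-as-traces (false , u) x = F.trans (frobenius-as-traces u x)
      (sum-cong F.elems (λ c → F.*-congˡ (Tr-cong (F.solve 3 (λ c x y → c F.:* y F.:= F.con (+ 0) F.:* x F.:+ c F.:* y) F.refl c (x F.↑ d) x))))

  no-short-multiple : ∀ {K} → K ≤ n * (p ∸ 1) → (∀ a → π^ K ∣ weil a) →
                      ∀ M → length M < K → 1 ≤ exponents M → ¬ (q ∸ 1) ∣ exponents M
  no-short-multiple {K} K≤N weil-divisible M M<K E≥1 q-1∣E = 1≉0 (F.trans (F.sym (F.trans (F.-‿cong (powerSum-divides (exponents M) E≥1 q-1∣E))
      (F.solve 1 (λ a → F.:- (F.:- a) F.:= a) F.refl F.1#))) (F.trans (F.-‿cong power-zero) (F.solve 0 (F.:- F.con (+ 0) F.:= F.con (+ 0)) F.refl)))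
    where
    open Divisible K≤N weil-divisible
    -- `M` holds the powers still to be expanded, `L` the forms already produced. Expanding a power
    -- moves one entry across, so the total length stays below K until only traces remain.
    mixed : ∀ M L → length M + length L < K → ∑F (λ x → traceProduct L x F.* powerProduct M x) F.≈ F.0#
    mixed []      L L<K = F.trans (sum-cong F.elems (λ x → F.*-identityʳ _)) (∑traceProduct-zero L L<K)
    mixed (m ∷ M) L M+L<K = F.trans (sum-cong F.elems expand) (F.trans (sum-swap F.elems F.elems _)
        (F.trans (sum-cong F.elems (λ c → F.trans (F.sym (F.*-distribˡ-sum F.elems (traceCoefficient (proj₂ m) c) _))
          (F.trans (F.*-congˡ (mixed M (digitForm m c ∷ L) (subst (_< K) (≡.sym (ℕ.+-suc (length M) (length L))) M+L<K))) (F.zeroʳ _))))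
        (sum-ε F.elems)))
      where
      expand : ∀ x → traceProduct L x F.* (x F.↑ exponent m F.* powerProduct M x)
                   F.≈ ∑F (λ c → traceCoefficient (proj₂ m) c F.* (traceProduct (digitForm m c ∷ L) x F.* powerProduct M x))
      expand x = F.trans (F.*-congˡ (F.*-congʳ (digit-as-traces m x)))
        (F.trans (F.solve 3 (λ a s b → a F.:* (s F.:* b) F.:= s F.:* (a F.:* b)) F.refl (traceProduct L x) _ (powerProduct M x))
        (F.trans (F.*-distribʳ-sum F.elems _ _)
          (sum-cong F.elems (λ c → F.solve 4 (λ k t l m → (k F.:* t) F.:* (l F.:* m) F.:= k F.:* ((t F.:* l) F.:* m)) F.refl
            (traceCoefficient (proj₂ m) c) (Tr (form (digitForm m c) x)) (traceProduct L x) (powerProduct M x)))))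

    power-zero : powerSum (exponents M) F.≈ F.0#
    power-zero = F.trans (sum-cong F.elems (λ x → F.sym (F.trans (F.*-identityˡ _) (powerProduct≈ M x))))
      (mixed M [] (subst (_< K) (≡.sym (ℕ.+-identityʳ (length M))) M<K))

-- Degeneracy, third moments and collinear points

-- Multiples of m on both sides keep the congruence within ℕ; the integer difference is recovered by
-- comparing d with p^i.
degenerate-intro : ∀ p m d i j k → d + j * m ≡ p ^ i + k * m → Degenerate p m d
degenerate-intro p m d i j k e = i , (go (ℕ.≤-total (p ^ i) d))
  where
  go : (p ^ i ≤ d) ⊎ (d ≤ p ^ i) → m ∣ ℤ.∣ + d ℤ.- + (p ^ i) ∣
  go (inj₁ ≤d) rewrite ℤ.m-n≡m⊖n d (p ^ i) | ℤ.⊖-≥ ≤d = ℕ.∣m+n∣m⇒∣n (divides k (difference d (p ^ i) j k ≤d e)) (ℕ.n∣m*n j)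
    where
    difference : ∀ a b j k → b ≤ a → a + j * m ≡ b + k * m → j * m + (a ∸ b) ≡ k * m
    difference a b j k b≤a e = ℕ.+-cancelˡ-≡ b _ _ (≡.trans (ℕ.+-comm b _) (≡.trans (ℕ.+-assoc (j * m) (a ∸ b) b)
      (≡.trans (cong (λ c → j * m + c) (ℕ.m∸n+n≡m b≤a)) (≡.trans (ℕ.+-comm (j * m) a) e))))
  go (inj₂ d≤) rewrite ℤ.m-n≡m⊖n d (p ^ i) | ℤ.∣m⊖n∣≡∣n⊖m∣ d (p ^ i) | ℤ.⊖-≥ d≤ =
    ℕ.∣m+n∣m⇒∣n (divides j (ℕ.+-cancelˡ-≡ d _ _ (≡.trans (ℕ.+-comm d _) (≡.trans (ℕ.+-assoc (k * m) (p ^ i ∸ d) d)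
      (≡.trans (cong (λ c → k * m + c) (ℕ.m∸n+n≡m d≤)) (≡.trans (ℕ.+-comm (k * m) (p ^ i)) (≡.sym e))))))) (ℕ.n∣m*n k)

degenerate-elim : ∀ p m d → Degenerate p m d → ∃[ i ] ∃[ j ] ∃[ k ] (d + j * m ≡ p ^ i + k * m)
degenerate-elim p m d (i , m∣) with ℕ.≤-total (p ^ i) d
... | inj₁ ≤d rewrite ℤ.m-n≡m⊖n d (p ^ i) | ℤ.⊖-≥ ≤d with m∣
...   | divides k e = i , 0 , k , ≡.trans (ℕ.+-identityʳ d) (≡.trans (≡.sym (ℕ.m+[n∸m]≡n ≤d)) (cong (λ c → p ^ i + c) e))
degenerate-elim p m d (i , m∣) | inj₂ d≤ rewrite ℤ.m-n≡m⊖n d (p ^ i) | ℤ.∣m⊖n∣≡∣n⊖m∣ d (p ^ i) | ℤ.⊖-≥ d≤ with m∣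
...   | divides k e = i , k , 0 , ≡.trans (cong (λ c → d + c) (≡.sym e)) (≡.trans (ℕ.m+[n∸m]≡n d≤) (≡.sym (ℕ.+-identityʳ (p ^ i))))

module Collinearity (F : FiniteField) (p n d : ℕ) (p-prime : Prime p)
                    (char-p : FiniteField._≈_ F (natF F p) (FiniteField.0# F))
                    (card : order F ≡ p ^ n) (d≥1 : 1 ≤ d) (d-coprime : gcd d (p ^ n ∸ 1) ≡ 1)
                    (C : CyclotomicRing p) where
  open FiniteFieldTheory F p n p-prime char-p card
  open Trace F p n p-prime char-p card
  open CyclotomicRing C using () renaming (ring to A)
  open PiAdic p-prime C
  open CharacterSums F p n d p-prime char-p card d≥1 d-coprime C
  private
    module F where
      open FiniteField F public
      open SemiringExp semiring public using (^-homo-*; ^-congˡ; ^-assocʳ) renaming (_^_ to _↑_)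
      open CommutativeSemiringExp commutativeSemiring public using (^-distrib-*)
      open IntegerImage.Solver commRing public using (solve; _:+_; _:*_; _:-_; :-_; _:=_; con)
      open RingSum commRing public
      open RingProperties ring public using (-0#≈0#; -‿involutive)

  open F using (_↑_)

  private
    instance
      d≢0 : NonZero d
      d≢0 = ℕ.>-nonZero d≥1

  ↑-mod+ : ∀ {a} k x → 1 ≤ a → x ↑ (a + k * (q ∸ 1)) F.≈ x ↑ a
  ↑-mod+ {suc a} k x _ = F.trans (F.reflexive (cong (x ↑_) (≡.sym (ℕ.+-suc a (k * (q ∸ 1))))))
    (F.trans (F.^-homo-* x a (suc (k * (q ∸ 1)))) (F.trans (F.*-congˡ (↑-mod k x)) (F.*-comm (x ↑ a) x)))

  degenerate-power : Degenerate p (q ∸ 1) d → ∃[ i ] (∀ x → x ↑ d F.≈ x ↑ (p ^ i))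
  degenerate-power deg with degenerate-elim p (q ∸ 1) d deg
  ... | i , j , k , e = i , λ x → F.trans (F.sym (↑-mod+ j x d≥1)) (F.trans (F.reflexive (cong (x ↑_) e)) (↑-mod+ k x (ℕ.m^n>0 p i)))
    where
    instance
      p≢0 : NonZero p
      p≢0 = prime⇒nonZero p-prime

  -- ε = (-1)^d satisfies ε² = 1. If ε = 1, injectivity of x ↦ x^d gives -1 = 1; otherwise ε + 1 =
  -- 0. This treats p = 2 and odd p alike.
  -1↑d : (F.- F.1#) ↑ d F.≈ F.- F.1#
  -1↑d with (ε F.≟ F.1#)
    where
    ε : F.Carrier
    ε = (F.- F.1#) ↑ d
  ... | yes ε≈1 = F.trans ε≈1 (F.sym (↑d-injective (F.trans ε≈1 (F.sym (1↑ d)))))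
  ... | no ε≉1  = F.trans (F.solve 1 (λ e → e F.:= (e F.:+ F.con (+ 1)) F.:- F.con (+ 1)) F.refl ε)
      (F.trans (F.+-congʳ ε+1≈0) (F.+-identityˡ _))
    where
    ε : F.Carrier
    ε = (F.- F.1#) ↑ d
    ε²≈1 : ε F.* ε F.≈ F.1#
    ε²≈1 = F.trans (F.sym (F.^-distrib-* (F.- F.1#) (F.- F.1#) d))
      (F.trans (F.^-congˡ d (F.solve 0 ((F.:- F.con (+ 1)) F.:* (F.:- F.con (+ 1)) F.:= F.con (+ 1)) F.refl)) (1↑ d))
    ε+1≈0 : ε F.+ F.1# F.≈ F.0#
    ε+1≈0 = integral (F.trans (F.solve 1 (λ e → (e F.:- F.con (+ 1)) F.:* (e F.:+ F.con (+ 1)) F.:= e F.:* e F.:- F.con (+ 1)) F.refl ε)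
      (F.trans (F.+-congʳ ε²≈1) (F.-‿inverseʳ F.1#))) (difference-≉0 ε≉1)

  neg-↑d : ∀ x → (F.- x) ↑ d F.≈ F.- (x ↑ d)
  neg-↑d x = F.trans (F.^-congˡ d (F.solve 1 (λ x → F.:- x F.:= (F.:- F.con (+ 1)) F.:* x) F.refl x))
    (F.trans (F.^-distrib-* (F.- F.1#) x d) (F.trans (F.*-congʳ -1↑d)
      (F.solve 1 (λ x → (F.:- F.con (+ 1)) F.:* x F.:= F.:- x) F.refl (x ↑ d))))

  -- An additive power map fixes the prime field, so expanding 1 = 1^d by means of
  -- 1 = -∑ c^(q-2) Tr(c) produces a nonzero power sum of exponent d (q-2) + p^i.
  additive⇒degenerate : (∀ r → (r F.+ F.1#) ↑ d F.≈ r ↑ d F.+ F.1#) → Degenerate p (q ∸ 1) d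
  additive⇒degenerate additive with below-nonzero n _ expansion≉0
    where
    L : F.Carrier → F.Carrier
    L x = x ↑ d

    -- Homogeneity reduces x + y to y (x/y + 1), where the hypothesis applies.
    L-+ : ∀ x y → L (x F.+ y) F.≈ L x F.+ L y
    L-+ x y with y F.≟ F.0#
    ... | yes y≈0 = F.trans (F.^-congˡ d (F.trans (F.+-congˡ y≈0) (F.+-identityʳ x)))
      (F.sym (F.trans (F.+-congˡ (F.trans (F.^-congˡ d y≈0) (0↑ d))) (F.+-identityʳ _)))
    ... | no y≉0 with F.inverse y y≉0
    ...   | v , yv≈1 = F.trans (F.^-congˡ d (F.trans (F.+-congʳ x≈xvy) (F.sym (F.trans (F.distribʳ y _ _) (F.+-congˡ (F.*-identityˡ y))))))
        (F.trans (F.^-distrib-* _ y d) (F.trans (F.*-congʳ (additive (x F.* v))) (F.trans (F.distribʳ (L y) _ _)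
          (F.+-cong (F.trans (F.sym (F.^-distrib-* _ y d)) (F.^-congˡ d (F.sym x≈xvy))) (F.*-identityˡ _)))))
      where
      x≈xvy : x F.≈ x F.* v F.* y
      x≈xvy = F.sym (F.trans (F.*-assoc x v y) (F.trans (F.*-congˡ (F.trans (F.*-comm v y) yv≈1)) (F.*-identityʳ x)))

    L-sum : ∀ xs f → L (sum xs f) F.≈ sum xs (λ x → L (f x))
    L-sum []       f = 0↑ d
    L-sum (x ∷ xs) f = F.trans (L-+ (f x) (sum xs f)) (F.+-congˡ (L-sum xs f))

    L-natF : ∀ k → L (natF F k) F.≈ natF F k
    L-natF zero    = 0↑ d
    L-natF (suc k) = F.trans (L-+ F.1# (natF F k)) (F.+-cong (1↑ d) (L-natF k))

    L-Tr : ∀ x → L (Tr x) F.≈ Tr x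
    L-Tr x = F.trans (F.^-congˡ d (F.sym (natF-trIdx x))) (F.trans (L-natF (trIdx F p n x)) (natF-trIdx x))

    e : ℕ
    e = q ∸ 1 ∸ p ^ (0 ℕ.% n)
      where instance _ = ℕ.>-nonZero n≥1

    expansion : F.1# F.≈ F.- below n (λ i → powerSum (e * d + p ^ i) F.* F.1# ↑ (p ^ i))
    expansion = F.trans (F.sym (1↑ d)) (F.trans (F.^-congˡ d (F.trans (F.sym (F.*-identityʳ F.1#)) (frobenius-as-traces 0 F.1#)))
      (F.trans (L-sum F.elems _) (F.trans (sum-cong F.elems (λ c → F.trans (F.^-distrib-* _ _ d)
        (F.trans (F.*-cong (F.trans (neg-↑d (c ↑ e)) (F.-‿cong (F.^-assocʳ c e d))) (L-Tr _))
          (F.solve 2 (λ a b → (F.:- a) F.:* b F.:= (F.:- F.con (+ 1)) F.:* (a F.:* b)) F.refl (c ↑ (e * d)) (Tr (c F.* F.1#))))))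
      (F.trans (F.sym (F.*-distribˡ-sum F.elems (F.- F.1#) _)) (F.trans (F.*-congˡ (∑-power-trace (e * d) F.1#))
        (F.solve 1 (λ a → (F.:- F.con (+ 1)) F.:* a F.:= F.:- a) F.refl _))))))

    expansion≉0 : ¬ below n (λ i → powerSum (e * d + p ^ i) F.* F.1# ↑ (p ^ i)) F.≈ F.0#
    expansion≉0 z = 1≉0 (F.trans expansion (F.trans (F.-‿cong z) F.-0#≈0#))
  ... | i , i<n , S≉0 with (q ∸ 1) ℕ.∣? ((q ∸ 1 ∸ p ^ (0 ℕ.% n)) * d + p ^ i)
    where instance _ = ℕ.>-nonZero n≥1
  ...   | no ∤   = contradiction (F.trans (F.*-congʳ (powerSum-∤ _ ∤)) (F.zeroˡ _)) S≉0
  -- With e = q - 2, adding d to e d + p^i = k (q - 1) turns it into p^i + d (q - 1) = d + k (q -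
  -- 1).
  ...   | yes (divides k eq) = degenerate-intro p (q ∸ 1) d i k d
      (≡.trans (cong (λ c → d + c) (≡.sym eq)) (≡.trans (rearrange d (e * d) (p ^ i)) (cong (λ c → p ^ i + c) de+d≡)))
    where
    instance
      n≢0 : NonZero n
      n≢0 = ℕ.>-nonZero n≥1
    e : ℕ
    e = q ∸ 1 ∸ p ^ (0 ℕ.% n)
    e+1 : suc e ≡ q ∸ 1
    e+1 = ≡.trans (cong (λ j → suc (q ∸ 1 ∸ p ^ j)) (ℕ.m<n⇒m%n≡m n≥1)) (ℕ.m+[n∸m]≡n (ℕ.∸-monoˡ-≤ 1 q≥2))
    rearrange : ∀ a b c → a + (b + c) ≡ c + (a + b)
    rearrange = ℕ-solve-∀
    de+d≡ : d + e * d ≡ d * (q ∸ 1)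
    de+d≡ = ≡.trans (cong (_* d) e+1) (ℕ.*-comm (q ∸ 1) d)

  ∃? : {P : F.Carrier → Set} → (∀ x → Dec (P x)) → (∀ {x y} → x F.≈ y → P x → P y) → Dec (∃[ x ] P x)
  ∃? {P} P? resp with any? P? F.elems
  ... | yes found = yes (satisfied found)
  ... | no none   = no λ { (x , Px) → none (represent F.elems (F.complete x) Px) }
    where
    represent : ∀ xs {x} → Any (x F.≈_) xs → P x → Any P xs
    represent (y ∷ ys) (here x≈y) Px = here (resp x≈y Px)
    represent (y ∷ ys) (there x∈) Px = there (represent ys x∈ Px)

  private
    -- The points (1 : y : curve y) lie on the curve x^d + y^d + z^d = 0.
    curve : F.Carrier → F.Carrier
    curve y = proj₁ (dth-root (F.- (F.1# F.+ y ↑ d)))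

    curve-spec : ∀ y → curve y ↑ d F.≈ F.- (F.1# F.+ y ↑ d)
    curve-spec y = proj₂ (dth-root (F.- (F.1# F.+ y ↑ d)))

    curve-unique : ∀ {y z} → z ↑ d F.≈ F.- (F.1# F.+ y ↑ d) → z F.≈ curve y
    curve-unique {y} e = ↑d-injective (F.trans e (F.sym (curve-spec y)))

    curve-cong : ∀ {x y} → x F.≈ y → curve x F.≈ curve y
    curve-cong {x} {y} e = curve-unique (F.trans (curve-spec x) (F.-‿cong (F.+-congˡ (F.^-congˡ d e))))

  open CommutativeRing A hiding (zero; ring) renaming (_+_ to _+ᴿ_; _*_ to _*ᴿ_; -_ to -ᴿ_)
  open SemiringMult semiring using (×1-homo-*) renaming (_×_ to _·_)
  open IntegerImage A using (module Solver)
  open Solver using (_:+_; _:*_; _:-_; :-_; _:=_; con; solve)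
  private
    module ∑A where
      open FieldSum F +-commutativeMonoid public
      open RingSum A public

    ∑³ : (F.Carrier → F.Carrier → F.Carrier → Carrier) → Carrier
    ∑³ f = ∑A.∑F (λ x → ∑A.∑F (λ y → ∑A.∑F (λ z → f x y z)))

    ∑³-cong : ∀ {f g} → (∀ x y z → f x y z ≈ g x y z) → ∑³ f ≈ ∑³ g
    ∑³-cong e = ∑A.sum-cong F.elems (λ x → ∑A.sum-cong F.elems (λ y → ∑A.sum-cong F.elems (λ z → e x y z)))

    ∑³-swap : ∀ (f : F.Carrier → F.Carrier → F.Carrier → F.Carrier → Carrier) →
              ∑A.∑F (λ c → ∑³ (f c)) ≈ ∑³ (λ x y z → ∑A.∑F (λ c → f c x y z))
    ∑³-swap f = trans (∑A.sum-swap F.elems F.elems _) (∑A.sum-cong F.elems (λ x →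
      trans (∑A.sum-swap F.elems F.elems _) (∑A.sum-cong F.elems (λ y → ∑A.sum-swap F.elems F.elems _))))

    ∑³-product : ∀ f g h → ∑A.∑F f *ᴿ (∑A.∑F g *ᴿ ∑A.∑F h) ≈ ∑³ (λ x y z → f x *ᴿ (g y *ᴿ h z))
    ∑³-product f g h = trans (∑A.*-distribʳ-sum F.elems _ f) (∑A.sum-cong F.elems (λ x →
      trans (*-congˡ (∑A.*-distribʳ-sum F.elems _ g)) (trans (∑A.*-distribˡ-sum F.elems (f x) _) (∑A.sum-cong F.elems (λ y →
        trans (sym (*-assoc _ _ _)) (trans (∑A.*-distribˡ-sum F.elems _ h) (∑A.sum-cong F.elems (λ z → *-assoc _ _ _))))))))

    δ : F.Carrier → Carrier
    δ x = if does (x F.≟ F.0#) then 1# else 0#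

    δ-yes : ∀ {x} → x F.≈ F.0# → δ x ≈ 1#
    δ-yes {x} x≈0 with x F.≟ F.0#
    ... | yes _  = refl
    ... | no x≉0 = contradiction x≈0 x≉0

    ∑δ : ∑A.∑F δ ≈ 1#
    ∑δ = ∑A.∑F-single F.0# (λ _ → 1#) (λ _ → refl)

    ∑ψ-linear : ∀ s → ∑A.∑F (λ c → ψ (c F.* s)) ≈ q · 1# *ᴿ δ s
    ∑ψ-linear s with s F.≟ F.0#
    ... | yes s≈0 = trans (∑A.sum-cong F.elems (λ c → trans (ψ-cong (F.trans (F.*-congˡ s≈0) (F.zeroʳ c))) ψ-0)) (trans ∑ψ-const (sym (*-identityʳ _)))
    ... | no s≉0  = trans (∑A.sum-cong F.elems (λ c → ψ-cong (F.*-comm c s))) (trans (∑ψ-zero s≉0) (sym (zeroʳ _)))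

  -- Under the trace, x^d = x^(p^i) may be replaced by x. What remains is the linear sum of ψ((1 -
  -- a) x), equal to q at a = 1 and to 0 elsewhere.
  degenerate-weil : Degenerate p (q ∸ 1) d →
                    (∀ a → π^ (n * (p ∸ 1)) ∣ weil a) × (∃[ a ] ¬ π^ suc (n * (p ∸ 1)) ∣ weil a)
  degenerate-weil deg with degenerate-power deg
  ... | i , ↑d≈ = divisible , F.1# , λ d′ → π∤q n (π∣-respects (suc (n * (p ∸ 1))) weil-1 d′)
    where
    linear : ∀ a → weil a ≈ q · 1# *ᴿ δ (F.1# F.- a)
    linear a = trans (∑A.sum-cong F.elems (λ x → trans (ψ-+ _ _) (trans (*-congʳ (ψ-cong-Tr (F.trans (Tr-cong (↑d≈ x)) (Tr-frobenius^ i x))))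
        (trans (sym (ψ-+ _ _)) (ψ-cong (F.solve 2 (λ x a → x F.:- a F.:* x F.:= x F.:* (F.con (+ 1) F.:- a)) F.refl x a))))))
      (∑ψ-linear (F.1# F.- a))
    divisible : ∀ a → π^ (n * (p ∸ 1)) ∣ weil a
    divisible a = let y , e = π∣q n (ℕ.≤-refl {n * (p ∸ 1)}) in
      y *ᴿ δ (F.1# F.- a) , trans (linear a) (trans (*-congʳ e) (*-assoc _ y _))
    weil-1 : weil F.1# ≈ q · 1#
    weil-1 = trans (linear F.1#) (trans (*-congˡ (δ-yes (F.-‿inverseʳ F.1#))) (*-identityʳ _))

  -- Orthogonality turns ∑ ∏ (sums of ψ) into q² times the number of common zeros of
  -- x^d + y^d + z^d and αx + βy + γz; a single common zero would give it valuation 2N.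
  common-zero : ∀ {K} → K ≤ n * (p ∸ 1) → 2 * (n * (p ∸ 1)) < 3 * K → (∀ a → π^ K ∣ weil a) → ∀ α β γ →
    ¬ (∀ x y z → x ↑ d F.+ (y ↑ d F.+ z ↑ d) F.≈ F.0# → α F.* x F.+ (β F.* y F.+ γ F.* z) F.≈ F.0# →
       x F.≈ F.0# × y F.≈ F.0# × z F.≈ F.0#)
  common-zero {K} K≤N 2N<3K weil-divisible α β γ only-zero = π∤q (n + n)
      (π∣-≤ {suc ((n + n) * (p ∸ 1))} {K + (K + K)} bound (π∣-respects (K + (K + K)) T≈q² π∣T))
    where
    E : F.Carrier → F.Carrier → Carrier
    E c b = ∑A.∑F (λ x → ψ (c F.* x ↑ d F.+ b F.* x))

    T : Carrier
    T = ∑A.∑F (λ c → ∑A.∑F (λ b → E c (b F.* α) *ᴿ (E c (b F.* β) *ᴿ E c (b F.* γ))))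

    π∣∑ : ∀ k (xs : List F.Carrier) f → (∀ x → π^ k ∣ f x) → π^ k ∣ ∑A.sum xs f
    π∣∑ k []       f h = π∣-0 k
    π∣∑ k (x ∷ xs) f h = π∣-+ k (h x) (π∣∑ k xs f h)

    π∣T : π^ (K + (K + K)) ∣ T
    π∣T = π∣∑ (K + (K + K)) F.elems _ λ c → π∣∑ (K + (K + K)) F.elems _ λ b → π∣-* K (K + K) (divisible c (b F.* α)) (π∣-* K K (divisible c (b F.* β)) (divisible c (b F.* γ)))
      where
      divisible : ∀ c b → π^ K ∣ E c b
      divisible = binomial-divisible K≤N weil-divisible

    bound : suc ((n + n) * (p ∸ 1)) ≤ K + (K + K)
    bound = ℕ.≤-trans (ℕ.≤-reflexive (cong suc (two n (p ∸ 1)))) (ℕ.≤-trans 2N<3K (ℕ.≤-reflexive (three K)))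
      where
      two : ∀ n m → (n + n) * m ≡ 2 * (n * m)
      two = ℕ-solve-∀
      three : ∀ K → 3 * K ≡ K + (K + K)
      three = ℕ-solve-∀

    S Λ : F.Carrier → F.Carrier → F.Carrier → F.Carrier
    S x y z = x ↑ d F.+ (y ↑ d F.+ z ↑ d)
    Λ x y z = α F.* x F.+ (β F.* y F.+ γ F.* z)

    Q : Carrier
    Q = q · 1# *ᴿ q · 1#

    δ³-vanish : ∀ x y z → ¬ (x F.≈ F.0# × y F.≈ F.0# × z F.≈ F.0#) → Q *ᴿ (δ x *ᴿ (δ y *ᴿ δ z)) ≈ 0#
    δ³-vanish x y z nz with x F.≟ F.0# | y F.≟ F.0# | z F.≟ F.0#
    ... | yes x≈0 | yes y≈0 | yes z≈0 = contradiction (x≈0 , y≈0 , z≈0) nz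
    ... | no _    | _       | _       = trans (*-congˡ (zeroˡ _)) (zeroʳ Q)
    ... | yes _   | no _    | _       = trans (*-congˡ (trans (*-congˡ (zeroˡ _)) (zeroʳ _))) (zeroʳ Q)
    ... | yes _   | yes _   | no _    = trans (*-congˡ (trans (*-congˡ (zeroʳ _)) (zeroʳ _))) (zeroʳ Q)

    count : ∀ x y z → (q · 1# *ᴿ δ (S x y z)) *ᴿ (q · 1# *ᴿ δ (Λ x y z)) ≈ Q *ᴿ (δ x *ᴿ (δ y *ᴿ δ z))
    count x y z with S x y z F.≟ F.0# | Λ x y z F.≟ F.0#
    ... | yes S≈0 | yes Λ≈0 = let x≈0 , y≈0 , z≈0 = only-zero x y z S≈0 Λ≈0 in
      trans (*-cong (*-identityʳ _) (*-identityʳ _)) (sym (trans (*-congˡ (trans (*-cong (δ-yes x≈0)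
        (trans (*-cong (δ-yes y≈0) (δ-yes z≈0)) (*-identityʳ 1#))) (*-identityʳ 1#))) (*-identityʳ Q)))
    ... | no S≉0 | _ = trans (trans (*-congʳ (zeroʳ _)) (zeroˡ _)) (sym (δ³-vanish x y z (λ { (x≈0 , y≈0 , z≈0) → S≉0 (S-0 x≈0 y≈0 z≈0) })))
      where
      S-0 : x F.≈ F.0# → y F.≈ F.0# → z F.≈ F.0# → S x y z F.≈ F.0#
      S-0 x≈0 y≈0 z≈0 = F.trans (F.+-cong (power x≈0) (F.+-cong (power y≈0) (power z≈0))) (F.trans (F.+-identityˡ _) (F.+-identityˡ _))
        where
        power : ∀ {x} → x F.≈ F.0# → x ↑ d F.≈ F.0#
        power x≈0 = F.trans (F.^-congˡ d x≈0) (0↑ d)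
    ... | yes _ | no Λ≉0 = trans (trans (*-congˡ (zeroʳ _)) (zeroʳ _)) (sym (δ³-vanish x y z (λ { (x≈0 , y≈0 , z≈0) → Λ≉0 (Λ-0 x≈0 y≈0 z≈0) })))
      where
      Λ-0 : x F.≈ F.0# → y F.≈ F.0# → z F.≈ F.0# → Λ x y z F.≈ F.0#
      Λ-0 x≈0 y≈0 z≈0 = F.trans (F.+-cong (F.*-congˡ x≈0) (F.+-cong (F.*-congˡ y≈0) (F.*-congˡ z≈0)))
        (F.solve 3 (λ a b c → a F.:* F.con (+ 0) F.:+ (b F.:* F.con (+ 0) F.:+ c F.:* F.con (+ 0)) F.:= F.con (+ 0)) F.refl α β γ)

    expand : ∀ c b → E c (b F.* α) *ᴿ (E c (b F.* β) *ᴿ E c (b F.* γ)) ≈ ∑³ (λ x y z → ψ (c F.* S x y z) *ᴿ ψ (b F.* Λ x y z))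
    expand c b = trans (∑³-product _ _ _) (∑³-cong (λ x y z → trans (*-congˡ (sym (ψ-+ _ _))) (trans (sym (ψ-+ _ _))
      (trans (ψ-cong (F.solve 11 (λ c b a₁ a₂ a₃ x y z X Y Z →
          (c F.:* X F.:+ b F.:* a₁ F.:* x) F.:+ ((c F.:* Y F.:+ b F.:* a₂ F.:* y) F.:+ (c F.:* Z F.:+ b F.:* a₃ F.:* z))
            F.:= c F.:* (X F.:+ (Y F.:+ Z)) F.:+ b F.:* (a₁ F.:* x F.:+ (a₂ F.:* y F.:+ a₃ F.:* z))) F.refl
          c b α β γ x y z (x ↑ d) (y ↑ d) (z ↑ d))) (ψ-+ _ _)))))

    -- Summing over b and c first leaves q² at each common zero (x , y , z), and `only-zero` admits
    -- just the origin.
    T≈q² : T ≈ (p ^ (n + n)) · 1#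
    T≈q² = trans (∑A.sum-cong F.elems (λ c → trans (∑A.sum-cong F.elems (λ b → expand c b)) (∑³-swap _)))
      (trans (∑³-swap _) (trans (∑³-cong (λ x y z → trans (∑A.sum-cong F.elems (λ c → trans (sym (∑A.*-distribˡ-sum F.elems _ _))
          (*-congˡ (∑ψ-linear (Λ x y z))))) (trans (sym (∑A.*-distribʳ-sum F.elems _ _)) (trans (*-congʳ (∑ψ-linear (S x y z))) (count x y z)))))
      (trans factor (trans (sym (×1-homo-* q q)) (reflexive (cong (_· 1#) (≡.sym (ℕ.^-distribˡ-+-* p n n))))))))
      where
      factor : ∑³ (λ x y z → Q *ᴿ (δ x *ᴿ (δ y *ᴿ δ z))) ≈ Q
      factor = trans (∑³-cong (λ x y z → sym (*-assoc Q (δ x) _))) (trans (sym (∑³-product (λ x → Q *ᴿ δ x) δ δ))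
        (trans (*-cong (trans (sym (∑A.*-distribˡ-sum F.elems Q δ)) (trans (*-congˡ ∑δ) (*-identityʳ Q)))
          (trans (*-cong ∑δ ∑δ) (*-identityʳ 1#))) (*-identityʳ Q)))

  -- Suppose (r+1)^d ≠ r^d + 1. Each line (x - r y) + a (x + y + z) = 0 through the point
  -- (r : 1 : -r-1) off the curve meets the curve in some (1 : y : z) with y ≠ -1, and y
  -- determines a: an injection from F to F ∖ {-1}.
  additive : ∀ {K} → K ≤ n * (p ∸ 1) → 2 * (n * (p ∸ 1)) < 3 * K → (∀ a → π^ K ∣ weil a) →
             ∀ r → (r F.+ F.1#) ↑ d F.≈ r ↑ d F.+ F.1#
  additive {K} K≤N 2N<3K weil-divisible r with ((r F.+ F.1#) ↑ d) F.≟ (r ↑ d F.+ F.1#)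
  ... | yes e   = e
  -- -1 and the slopes are q + 1 distinct elements of F, yet each is a root of x^q - x.
  ... | no off-curve = contradiction (All.universal fermat′ (F.- F.1# ∷ map slope F.elems))
      (too-many-fixed-points (q ∸ 2) (F.- F.1# ∷ map slope F.elems)
        (ℕ.≤-reflexive (cong suc (≡.trans q-2+2 (≡.trans (≡.sym card) (≡.sym (length-map slope F.elems))))))
        (Allₚ.map⁺ (All.universal (λ a e → slope≉-1 a (F.sym e)) F.elems)
          ∷ AllPairsₚ.map⁺ (AllPairs.map (λ {a} {b} a≉b e → a≉b (slope-injective a b e)) F.distinct)))
    where
    q-2+2 : 2 + (q ∸ 2) ≡ q
    q-2+2 = ℕ.m+[n∸m]≡n q≥2

    fermat′ : ∀ x → x ↑ (2 + (q ∸ 2)) F.≈ x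
    fermat′ x = F.trans (F.reflexive (cong (x ↑_) q-2+2)) (fermat x)

    r≉0 : ¬ r F.≈ F.0#
    r≉0 r≈0 = off-curve (F.trans (F.^-congˡ d (F.trans (F.+-congʳ r≈0) (F.+-identityˡ F.1#))) (F.trans (1↑ d)
      (F.sym (F.trans (F.+-congʳ (F.trans (F.^-congˡ d r≈0) (0↑ d))) (F.+-identityˡ F.1#)))))

    r+1≉0 : ¬ r F.+ F.1# F.≈ F.0#
    r+1≉0 r+1≈0 = off-curve (F.trans (F.^-congˡ d r+1≈0) (F.trans (0↑ d) (F.sym (F.trans
      (F.+-congʳ (F.trans (F.^-congˡ d r≈-1) -1↑d)) (F.-‿inverseˡ F.1#)))))
      where
      r≈-1 : r F.≈ F.- F.1#
      r≈-1 = F.trans (F.solve 1 (λ r → r F.:= (r F.:+ F.con (+ 1)) F.:- F.con (+ 1)) F.refl r)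
        (F.trans (F.+-congʳ r+1≈0) (F.+-identityˡ _))

    line : F.Carrier → F.Carrier → F.Carrier
    line a y = (F.1# F.- r F.* y) F.+ a F.* (F.1# F.+ y F.+ curve y)

    Meets : F.Carrier → F.Carrier → Set
    Meets a y = line a y F.≈ F.0#

    line-cong : ∀ a {y y′} → y F.≈ y′ → line a y F.≈ line a y′
    line-cong a e = F.+-cong (F.+-congˡ (F.-‿cong (F.*-congˡ e))) (F.*-congˡ (F.+-cong (F.+-congˡ e) (curve-cong e)))

    -- A common zero with x ≠ 0 rescales to one with x = 1; one with x = 0 has z = -y and then r y = 0.
    meets : ∀ a → ∃[ y ] Meets a y
    meets a with ∃? (λ y → line a y F.≟ F.0#) (λ e m → F.trans (F.sym (line-cong a e)) m)
    ... | yes found = found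
    -- The coefficients of x, y, z in (x - r y) + a (x + y + z).
    ... | no none   = contradiction only-zero (common-zero K≤N 2N<3K weil-divisible (F.1# F.+ a) (a F.- r) a)
      where
      only-zero : ∀ x y z → x ↑ d F.+ (y ↑ d F.+ z ↑ d) F.≈ F.0# →
                  (F.1# F.+ a) F.* x F.+ ((a F.- r) F.* y F.+ a F.* z) F.≈ F.0# → x F.≈ F.0# × y F.≈ F.0# × z F.≈ F.0#
      only-zero x y z S≈0 Λ≈0 with x F.≟ F.0#
      ... | yes x≈0 = x≈0 , y≈0 , F.trans z≈-y (F.trans (F.-‿cong y≈0) F.-0#≈0#)
        where
        z≈-y : z F.≈ F.- y
        z≈-y = ↑d-injective (F.trans (F.solve 3 (λ X Y Z → Z F.:= (X F.:+ (Y F.:+ Z)) F.:- X F.:- Y) F.refl (x ↑ d) (y ↑ d) (z ↑ d))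
          (F.trans (F.+-congʳ (F.+-cong S≈0 (F.-‿cong (F.trans (F.^-congˡ d x≈0) (0↑ d)))))
          (F.trans (F.solve 1 (λ Y → F.con (+ 0) F.:- F.con (+ 0) F.:- Y F.:= F.:- Y) F.refl (y ↑ d)) (F.sym (neg-↑d y)))))
        y≈0 : y F.≈ F.0#
        y≈0 = integral {r} (F.trans (F.solve 4 (λ r a x y → r F.:* y F.:= (F.con (+ 1) F.:+ a) F.:* x
              F.:- ((F.con (+ 1) F.:+ a) F.:* x F.:+ ((a F.:- r) F.:* y F.:+ a F.:* (F.:- y)))) F.refl r a x y)
          (F.trans (F.+-cong (F.trans (F.*-congˡ x≈0) (F.zeroʳ _)) (F.-‿cong (F.trans (F.+-congˡ (F.+-congˡ (F.*-congˡ (F.sym z≈-y)))) Λ≈0)))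
            (F.-‿inverseʳ F.0#))) r≉0
      ... | no x≉0 with F.inverse x x≉0
      ...   | v , xv≈1 = contradiction (v F.* y , (begin
          line a (v F.* y)  ≈⟨ F.+-congˡ (F.*-congˡ (F.+-congˡ (F.sym curve≈))) ⟩
          (F.1# F.- r F.* (v F.* y)) F.+ a F.* (F.1# F.+ v F.* y F.+ v F.* z)  ≈⟨ F.+-cong (F.+-congʳ (F.sym xv≈1)) (F.*-congˡ (F.+-congʳ (F.+-congʳ (F.sym xv≈1)))) ⟩
          (x F.* v F.- r F.* (v F.* y)) F.+ a F.* (x F.* v F.+ v F.* y F.+ v F.* z)
            ≈⟨ F.solve 6 (λ x y z v r a → (x F.:* v F.:- r F.:* (v F.:* y)) F.:+ a F.:* (x F.:* v F.:+ v F.:* y F.:+ v F.:* z)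
                F.:= v F.:* ((F.con (+ 1) F.:+ a) F.:* x F.:+ ((a F.:- r) F.:* y F.:+ a F.:* z))) F.refl x y z v r a ⟩
          v F.* ((F.1# F.+ a) F.* x F.+ ((a F.- r) F.* y F.+ a F.* z))  ≈⟨ F.trans (F.*-congˡ Λ≈0) (F.zeroʳ v) ⟩
          F.0#  ∎)) none
        where
        open SetoidReasoning F.setoid
        curve≈ : v F.* z F.≈ curve (v F.* y)
        curve≈ = curve-unique (begin
          (v F.* z) ↑ d  ≈⟨ F.^-distrib-* v z d ⟩
          v ↑ d F.* z ↑ d
            ≈⟨ F.solve 4 (λ V X Y Z → V F.:* Z F.:= V F.:* (X F.:+ (Y F.:+ Z)) F.:- (X F.:* V F.:+ V F.:* Y)) F.refl (v ↑ d) (x ↑ d) (y ↑ d) (z ↑ d) ⟩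
          v ↑ d F.* (x ↑ d F.+ (y ↑ d F.+ z ↑ d)) F.- (x ↑ d F.* v ↑ d F.+ v ↑ d F.* y ↑ d)
            ≈⟨ F.+-cong (F.trans (F.*-congˡ S≈0) (F.zeroʳ _)) (F.-‿cong (F.+-cong
                (F.trans (F.sym (F.^-distrib-* x v d)) (F.trans (F.^-congˡ d xv≈1) (1↑ d))) (F.sym (F.^-distrib-* v y d)))) ⟩
          F.0# F.- (F.1# F.+ (v F.* y) ↑ d)  ≈⟨ F.+-identityˡ _ ⟩
          F.- (F.1# F.+ (v F.* y) ↑ d)  ∎)

    slope : F.Carrier → F.Carrier
    slope a = proj₁ (meets a)

    -- Over y = -1 the curve has z = 0, so 1 + y + z vanishes and the line form takes the value r +
    -- 1, whatever a is.
    slope≉-1 : ∀ a → ¬ slope a F.≈ F.- F.1#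
    slope≉-1 a y≈-1 = r+1≉0 (begin
      r F.+ F.1#  ≈⟨ F.solve 2 (λ r a → r F.:+ F.con (+ 1) F.:=
          (F.con (+ 1) F.:- r F.:* (F.:- F.con (+ 1))) F.:+ a F.:* (F.con (+ 1) F.:+ (F.:- F.con (+ 1)) F.:+ F.con (+ 0))) F.refl r a ⟩
      (F.1# F.- r F.* (F.- F.1#)) F.+ a F.* (F.1# F.+ F.- F.1# F.+ F.0#)  ≈⟨ F.+-congˡ (F.*-congˡ (F.+-congˡ curve-1)) ⟩
      line a (F.- F.1#)  ≈⟨ line-cong a (F.sym y≈-1) ⟩
      line a (slope a)  ≈⟨ proj₂ (meets a) ⟩
      F.0#  ∎)
      where
      open SetoidReasoning F.setoid
      curve-1 : F.0# F.≈ curve (F.- F.1#)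
      curve-1 = curve-unique (F.trans (0↑ d) (F.sym (F.trans (F.-‿cong (F.trans (F.+-congˡ -1↑d) (F.-‿inverseʳ F.1#))) F.-0#≈0#)))

    -- The point (r : 1 : -r-1) would lie on the curve.
    sum≉0 : ∀ a y → Meets a y → ¬ F.1# F.+ y F.+ curve y F.≈ F.0#
    sum≉0 a y m s≈0 = off-curve (begin
      (r F.+ F.1#) ↑ d  ≈⟨ F.^-congˡ d (F.trans (F.+-congˡ (F.sym ry≈1)) (F.solve 2 (λ r y → r F.:+ r F.:* y F.:= r F.:* (F.con (+ 1) F.:+ y)) F.refl r y)) ⟩
      (r F.* (F.1# F.+ y)) ↑ d  ≈⟨ F.^-distrib-* r _ d ⟩
      r ↑ d F.* (F.1# F.+ y) ↑ d  ≈⟨ F.*-congˡ 1+y↑d ⟩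
      r ↑ d F.* (F.1# F.+ y ↑ d)  ≈⟨ F.trans (F.distribˡ (r ↑ d) F.1# (y ↑ d)) (F.+-cong (F.*-identityʳ _) (F.sym (F.^-distrib-* r y d))) ⟩
      r ↑ d F.+ (r F.* y) ↑ d  ≈⟨ F.+-congˡ (F.trans (F.^-congˡ d ry≈1) (1↑ d)) ⟩
      r ↑ d F.+ F.1#  ∎)
      where
      open SetoidReasoning F.setoid
      ry≈1 : r F.* y F.≈ F.1#
      ry≈1 = F.trans (F.solve 4 (λ r y a s → r F.:* y F.:= F.con (+ 1) F.:- ((F.con (+ 1) F.:- r F.:* y) F.:+ a F.:* s) F.:+ a F.:* s) F.refl r y a (F.1# F.+ y F.+ curve y))
        (F.trans (F.+-cong (F.+-congˡ (F.-‿cong m)) (F.trans (F.*-congˡ s≈0) (F.zeroʳ a)))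
          (F.solve 0 (F.con (+ 1) F.:- F.con (+ 0) F.:+ F.con (+ 0) F.:= F.con (+ 1)) F.refl))
      1+y≈ : F.1# F.+ y F.≈ F.- curve y
      1+y≈ = F.trans (F.solve 2 (λ s z → s F.:= (s F.:+ z) F.:- z) F.refl (F.1# F.+ y) (curve y)) (F.trans (F.+-congʳ s≈0) (F.+-identityˡ _))
      1+y↑d : (F.1# F.+ y) ↑ d F.≈ F.1# F.+ y ↑ d
      1+y↑d = F.trans (F.^-congˡ d 1+y≈) (F.trans (neg-↑d (curve y)) (F.trans (F.-‿cong (curve-spec y)) (F.-‿involutive _)))

    -- At a fixed y the line equation is linear in a, with coefficient 1 + y + z ≠ 0.
    slope-injective : ∀ a b → slope a F.≈ slope b → a F.≈ b
    slope-injective a b e = *-cancelˡ a b (sum≉0 a y (proj₂ (meets a))) (begin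
      s F.* a  ≈⟨ F.solve 3 (λ s a t → s F.:* a F.:= (t F.:+ a F.:* s) F.:- t) F.refl s a (F.1# F.- r F.* y) ⟩
      line a y F.- (F.1# F.- r F.* y)  ≈⟨ F.+-congʳ (F.trans (proj₂ (meets a)) (F.sym (F.trans (line-cong b e) (proj₂ (meets b))))) ⟩
      line b y F.- (F.1# F.- r F.* y)  ≈⟨ F.solve 3 (λ s a t → (t F.:+ a F.:* s) F.:- t F.:= s F.:* a) F.refl s b (F.1# F.- r F.* y) ⟩
      s F.* b  ∎)
      where
      open SetoidReasoning F.setoid
      y s : F.Carrier
      y = slope a
      s = F.1# F.+ y F.+ curve y

  divisible⇒degenerate : ∀ {K} → K ≤ n * (p ∸ 1) → 2 * (n * (p ∸ 1)) < 3 * K → (∀ a → π^ K ∣ weil a) → Degenerate p (q ∸ 1) d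
  divisible⇒degenerate K≤N 2N<3K weil-divisible = additive⇒degenerate (additive K≤N 2N<3K weil-divisible)

-- Small multiples modulo p - 1

≤-of-sum : ∀ {a b} k → a + k ≡ b → a ≤ b
≤-of-sum {a} k e = subst (a ≤_) e (ℕ.m≤m+n a k)

-- Writing e for -d modulo m = p-1, a point (x , e x mod m) with x + y ≤ ⌈m/3⌉. For e > m/2 take
-- x = ⌊m/(m-e)⌋; for e < m/2 take x = 1 + 2 ⌊e/(m-2e)⌋.
small-multiple : ∀ m e → 2 ∣ m → ¬ 3 ∣ suc m → Coprime e m → e < m → ¬ suc e ≡ m →
                 (2 * e + 2 ≡ m) ⊎ (∃[ x ] ∃[ y ] ∃[ j ] (1 ≤ x × e * x ≡ y + j * m × 3 * (x + y) ≤ m + 2))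
small-multiple m e 2∣m 3∤m+1 coprime e<m e+1≢m with ℕ.<-cmp (2 * e) m
... | tri≈ _ 2e≡m _ = contradiction (≡.trans (cong suc e≡1) (≡.trans (cong (2 *_) (≡.sym e≡1)) 2e≡m)) e+1≢m
  where
  e≡1 : e ≡ 1
  e≡1 = coprime (ℕ.∣-refl , divides 2 (≡.sym 2e≡m))
... | tri< 2e<m _ _ with m ∸ 2 * e in c≡
...   | zero = contradiction c≡ (ℕ.m>n⇒m∸n≢0 2e<m)
...   | suc zero = contradiction (ℕ.∣⇒≤ (ℕ.∣m+n∣m⇒∣n (subst (2 ∣_) (≡.trans (≡.sym (ℕ.m+[n∸m]≡n (ℕ.<⇒≤ 2e<m))) (cong (λ c → 2 * e + c) c≡)) 2∣m) (ℕ.m∣m*n e)))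
      (λ { (s≤s ()) })
...   | suc (suc zero) = inj₁ (≡.trans (cong (λ c → 2 * e + c) (≡.sym c≡)) (ℕ.m+[n∸m]≡n (ℕ.<⇒≤ 2e<m)))
-- With c = m - 2e one has 2e ≡ -c (mod m), so raising x by 2 lowers the residue of e x by c: from e
-- at x = 1, ⌊e/c⌋ such steps lead to e mod c.
...   | suc (suc (suc c′)) = inj₂ (1 + 2 * t , y , t , s≤s z≤n ,
        ≡.trans ex (cong (λ k → y + t * k) m≡) , subst (λ k → 3 * (1 + 2 * t + y) ≤ k + 2) m≡ (≤-of-sum (z + 2 * (t * c′)) size))
  where
  c t y z : ℕ
  c = 3 + c′
  t = e ℕ./ c
  y = e ℕ.% c
  z = c ∸ suc y
  y+z : suc y + z ≡ c
  y+z = ℕ.m+[n∸m]≡n (ℕ.m%n<n e c)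
  e≡ : e ≡ y + t * c
  e≡ = ℕ.m≡m%n+[m/n]*n e c
  m≡ : c + 2 * e ≡ m
  m≡ = ≡.trans (ℕ.+-comm c (2 * e)) (≡.trans (cong (λ c → 2 * e + c) (≡.sym c≡)) (ℕ.m+[n∸m]≡n (ℕ.<⇒≤ 2e<m)))
  ex : e * (1 + 2 * t) ≡ y + t * (c + 2 * e)
  ex = ≡.trans (identity₁ e t) (≡.trans (cong (_+ 2 * (e * t)) e≡) (identity₂ y t c e))
    where
    identity₁ : ∀ e t → e * (1 + 2 * t) ≡ e + 2 * (e * t)
    identity₁ = ℕ-solve-∀
    identity₂ : ∀ y t c e → y + t * c + 2 * (e * t) ≡ y + t * (c + 2 * e)
    identity₂ = ℕ-solve-∀
  size : 3 * (1 + 2 * t + y) + (z + 2 * (t * c′)) ≡ c + 2 * e + 2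
  size = ≡.trans (identity t y z c′) (cong₂ (λ a b → a + 2 * b + 2) y+z (≡.sym e≡))
    where
    identity : ∀ t y z c′ → 3 * (1 + 2 * t + y) + (z + 2 * (t * c′)) ≡ suc y + z + 2 * (y + t * (3 + c′)) + 2
    identity = ℕ-solve-∀
small-multiple m e 2∣m 3∤m+1 coprime e<m e+1≢m | tri> _ _ m<2e =
  inj₂ (go (m ∸ e) (ℕ.m∸n+n≡m (ℕ.<⇒≤ e<m)))
  where
  Goal : Set
  Goal = ∃[ x ] ∃[ y ] ∃[ j ] (1 ≤ x × e * x ≡ y + j * m × 3 * (x + y) ≤ m + 2)

  -- m is even; were b = m - e even, 2 would divide both e and m. This rules out b = 2 and b = 4
  -- below.
  b-odd : ∀ b → b + e ≡ m → ¬ 2 ∣ b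
  b-odd b b+e≡m 2∣b with coprime (ℕ.∣m+n∣m⇒∣n (subst (2 ∣_) (≡.sym b+e≡m) 2∣m) 2∣b , 2∣m)
  ... | ()

  2b<m : ∀ b → b + e ≡ m → b + b < m
  2b<m b b+e≡m = subst (b + b <_) b+e≡m (ℕ.+-monoʳ-< b (ℕ.+-cancelʳ-< e b e
    (subst₂ _<_ (≡.sym b+e≡m) (cong (λ k → e + k) (ℕ.+-identityʳ e)) m<2e)))

  -- Modulo m, e ≡ -b, so y = m - x b has the residue of e x.
  solution : ∀ b x y → b + e ≡ m → y + x * b ≡ m → 1 ≤ x → 3 * (x + y) ≤ m + 2 → Goal
  solution b (suc x) y b+e≡m m≡ 1≤x size = suc x , y , x , 1≤x ,
    ℕ.+-cancelˡ-≡ (suc x * b) _ _ (≡.trans (identity₁ x b e) (≡.trans (cong (suc x *_) b+e≡m)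
      (≡.trans (cong (_+ x * m) (≡.sym m≡)) (identity₂ y (suc x * b) (x * m))))) , size
    where
    identity₁ : ∀ x b e → suc x * b + e * suc x ≡ suc x * (b + e)
    identity₁ = ℕ-solve-∀
    identity₂ : ∀ a b c → a + b + c ≡ b + (a + c)
    identity₂ = ℕ-solve-∀

  divide : ∀ b .{{_ : NonZero b}} → b + e ≡ m → (∀ x y → y + x * b ≡ m → y < b → 3 * (x + y) ≤ m + 2) → 1 ≤ m ℕ./ b → Goal
  divide b b+e≡m size x≥1 = solution b (m ℕ./ b) (m ℕ.% b) b+e≡m m≡ x≥1 (size (m ℕ./ b) (m ℕ.% b) m≡ (ℕ.m%n<n m b))
    where
    m≡ : m ℕ.% b + (m ℕ./ b) * b ≡ m
    m≡ = ≡.sym (ℕ.m≡m%n+[m/n]*n m b)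

  b≤m : ∀ b .{{_ : NonZero b}} → b + e ≡ m → 1 ≤ m ℕ./ b
  b≤m b b+e≡m = ℕ.m≥n⇒m/n>0 (subst (b ≤_) b+e≡m (ℕ.m≤m+n b e))

  go : ∀ b → b + e ≡ m → Goal
  go 0 e≡m     = contradiction e≡m (ℕ.<⇒≢ e<m)
  go 1 e+1≡m   = contradiction e+1≡m e+1≢m
  go 2 2+e≡m   = contradiction (divides 1 ≡.refl) (b-odd 2 2+e≡m)
  go 4 4+e≡m   = contradiction (divides 2 ≡.refl) (b-odd 4 4+e≡m)
  -- Only m ≡ 1 (mod 3) is left: residue 0 contradicts coprimality with e, residue 2 contradicts 3 ∤
  -- m + 1. The bound is then attained.
  go 3 3+e≡m   = divide 3 3+e≡m size (b≤m 3 3+e≡m)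
    where
    size : ∀ x y → y + x * 3 ≡ m → y < 3 → 3 * (x + y) ≤ m + 2
    size x 0 m≡ _ with coprime (ℕ.∣m+n∣m⇒∣n (subst (3 ∣_) (≡.trans m≡ (≡.sym 3+e≡m)) (ℕ.n∣m*n x)) ℕ.∣-refl , divides x (≡.sym m≡))
    ... | ()
    size x 1 m≡ _ = ℕ.≤-reflexive (≡.trans (identity x) (cong (_+ 2) m≡))
      where
      identity : ∀ x → 3 * (x + 1) ≡ 1 + x * 3 + 2
      identity = ℕ-solve-∀
    size x 2 m≡ _ = contradiction (divides (suc x) (cong suc (≡.sym m≡))) 3∤m+1
    size x (suc (suc (suc y))) m≡ (s≤s (s≤s (s≤s ())))
  go b@(suc (suc (suc (suc (suc b′))))) b+e≡m = divide b b+e≡m size (b≤m b b+e≡m)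
    where
    size : ∀ x y → y + x * b ≡ m → y < b → 3 * (x + y) ≤ m + 2
    size 0 y m≡ y<b = contradiction (ℕ.≤-<-trans (ℕ.≤-reflexive (≡.trans (≡.sym m≡) (ℕ.+-identityʳ y))) y<b)
      (ℕ.≤⇒≯ (ℕ.≤-trans (ℕ.m≤m+n b b) (ℕ.<⇒≤ (2b<m b b+e≡m))))
    size 1 y m≡ y<b = contradiction (2b<m b b+e≡m) (ℕ.≤⇒≯ (subst (_≤ b + b) m≡
      (ℕ.+-mono-≤ (ℕ.<⇒≤ y<b) (ℕ.≤-reflexive (ℕ.+-identityʳ b)))))
    -- y = b - 1 alone would exceed the bound, and there m + 1 = 3 b.
    size 2 y m≡ y<b with ℕ.m≤n⇒m<n∨m≡n y<b
    ... | inj₂ y+1≡b = contradiction (divides b (≡.trans (cong suc (≡.sym m≡)) (≡.trans (cong (_+ 2 * b) y+1≡b) (identity b)))) 3∤m+1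
      where
      identity : ∀ b → b + 2 * b ≡ b * 3
      identity = ℕ-solve-∀
    ... | inj₁ y+2≤b = ≤-of-sum (2 * (b ∸ (2 + y))) (≡.trans (identity y (b ∸ (2 + y)))
        (≡.trans (cong (λ k → y + 2 * k + 2) (ℕ.m+[n∸m]≡n y+2≤b)) (cong (_+ 2) m≡)))
      where
      identity : ∀ y z → 3 * (2 + y) + 2 * z ≡ y + 2 * (2 + y + z) + 2
      identity = ℕ-solve-∀
    size (suc (suc (suc x′))) y m≡ y<b = ≤-of-sum (2 * z + (2 * x′ + b′ + x′ * b′)) (ℕ.+-cancelʳ-≡ 2 _ _
        (≡.trans (identity₁ x′ y z b′) (≡.trans (cong (λ k → 3 * (3 + x′) + y + 2 * k + (2 * x′ + b′ + x′ * b′)) y+z)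
          (≡.trans (identity₂ x′ y b′) (cong (λ k → k + 2 + 2) m≡)))))
      where
      z : ℕ
      z = b ∸ suc y
      y+z : suc y + z ≡ b
      y+z = ℕ.m+[n∸m]≡n y<b
      identity₁ : ∀ x′ y z b′ → 3 * (3 + x′ + y) + (2 * z + (2 * x′ + b′ + x′ * b′)) + 2 ≡ 3 * (3 + x′) + y + 2 * (suc y + z) + (2 * x′ + b′ + x′ * b′)
      identity₁ = ℕ-solve-∀
      identity₂ : ∀ x′ y b′ → 3 * (3 + x′) + y + 2 * (5 + b′) + (2 * x′ + b′ + x′ * b′) ≡ y + (3 + x′) * (5 + b′) + 2 + 2
      identity₂ = ℕ-solve-∀

-- Digit lists and short multiples

-- A number is encoded by a list of exponents, with repetitions allowed; the length of the list
-- bounds its base p digit sum from above.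
val : ℕ → List ℕ → ℕ
val p []       = 0
val p (u ∷ us) = p ^ u + val p us

val-++ : ∀ p us vs → val p (us ++ vs) ≡ val p us + val p vs
val-++ p []       vs = ≡.refl
val-++ p (u ∷ us) vs = ≡.trans (cong (λ a → p ^ u + a) (val-++ p us vs)) (≡.sym (ℕ.+-assoc (p ^ u) _ _))

val-shift : ∀ p s us → val p (map (s ℕ.+_) us) ≡ p ^ s * val p us
val-shift p s []       = ≡.sym (ℕ.*-zeroʳ (p ^ s))
val-shift p s (u ∷ us) = ≡.trans (cong₂ _+_ (ℕ.^-distribˡ-+-* p s u) (val-shift p s us)) (≡.sym (ℕ.*-distribˡ-+ (p ^ s) (p ^ u) _))

val-replicate : ∀ p k u → val p (replicate k u) ≡ k * p ^ u
val-replicate p zero    u = ≡.refl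
val-replicate p (suc k) u = cong (λ a → p ^ u + a) (val-replicate p k u)

-- With J = val p us and J′ = val p vs, d J + J′ is a positive multiple of p^w - 1, and the base p
-- digit sums of J and J′ add up to at most L.
ShortMultiple : ℕ → ℕ → ℕ → ℕ → Set
ShortMultiple p d w L = ∃[ us ] ∃[ vs ] ∃[ c ]
  (1 ≤ val p us × d * val p us + val p vs + c ≡ c * p ^ w × length us + length vs ≤ L)

repeat-digits : ℕ → ℕ → List ℕ → List ℕ
repeat-digits w zero    us = []
repeat-digits w (suc r) us = us ++ map (w ℕ.+_) (repeat-digits w r us)

length-repeat : ∀ w r us → length (repeat-digits w r us) ≡ r * length us
length-repeat w zero    us = ≡.refl
length-repeat w (suc r) us = ≡.trans (length-++ us) (cong (λ a → length us + a) (≡.trans (length-map (w ℕ.+_) (repeat-digits w r us)) (length-repeat w r us)))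

val-repeat : ∀ p w r us → val p (repeat-digits w (suc r) us) ≡ val p us + p ^ w * val p (repeat-digits w r us)
val-repeat p w r us = ≡.trans (val-++ p us _) (cong (λ a → val p us + a) (val-shift p w (repeat-digits w r us)))

-- With Q = p^w, repeating the digit blocks r times multiplies J and J′ by (Q^r - 1)/(Q - 1). The
-- cofactor c stays the same and the weight grows by the factor r.
repeat-multiple : ∀ p d w {L} r → 1 ≤ r → ShortMultiple p d w L → ShortMultiple p d (w * r) (r * L)
repeat-multiple p d w {L} r@(suc r′) _ (us , vs , c , us≥1 , e , short) =
  repeat-digits w r us , repeat-digits w r vs , c ,
  subst (1 ≤_) (≡.sym (val-repeat p w r′ us)) (ℕ.≤-trans us≥1 (ℕ.m≤m+n _ _)) ,
  ≡.trans (multiple r) (cong (c *_) (ℕ.^-*-assoc p w r)) ,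
  ℕ.≤-trans (ℕ.≤-reflexive (≡.trans (cong₂ _+_ (length-repeat w r us) (length-repeat w r vs)) (≡.sym (ℕ.*-distribˡ-+ r (length us) (length vs)))))
             (ℕ.*-monoʳ-≤ r short)
  where
  Q : ℕ
  Q = p ^ w
  multiple : ∀ r → d * val p (repeat-digits w r us) + val p (repeat-digits w r vs) + c ≡ c * Q ^ r
  multiple zero    = ≡.trans (cong (λ a → a + 0 + c) (ℕ.*-zeroʳ d)) (≡.sym (ℕ.*-identityʳ c))
  multiple (suc r) = begin
    d * val p (repeat-digits w (suc r) us) + val p (repeat-digits w (suc r) vs) + c
      ≡⟨ cong₂ (λ a b → d * a + b + c) (val-repeat p w r us) (val-repeat p w r vs) ⟩
    d * (J + Q * Jᵣ) + (J′ + Q * J′ᵣ) + c  ≡⟨ split d J Jᵣ J′ J′ᵣ Q c ⟩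
    (d * J + J′ + c) + Q * (d * Jᵣ + J′ᵣ)  ≡⟨ cong (_+ Q * (d * Jᵣ + J′ᵣ)) e ⟩
    c * Q + Q * (d * Jᵣ + J′ᵣ)  ≡⟨ join c Q (d * Jᵣ + J′ᵣ) ⟩
    Q * (d * Jᵣ + J′ᵣ + c)  ≡⟨ cong (Q *_) (multiple r) ⟩
    Q * (c * Q ^ r)  ≡⟨ assoc Q c (Q ^ r) ⟩
    c * (Q * Q ^ r)  ∎
    where
    open ≡.≡-Reasoning
    J J′ Jᵣ J′ᵣ : ℕ
    J = val p us
    J′ = val p vs
    Jᵣ = val p (repeat-digits w r us)
    J′ᵣ = val p (repeat-digits w r vs)
    split : ∀ d J Jᵣ J′ J′ᵣ Q c → d * (J + Q * Jᵣ) + (J′ + Q * J′ᵣ) + c ≡ (d * J + J′ + c) + Q * (d * Jᵣ + J′ᵣ)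
    split = ℕ-solve-∀
    join : ∀ c Q x → c * Q + Q * x ≡ Q * (x + c)
    join = ℕ-solve-∀
    assoc : ∀ Q c R → Q * (c * R) ≡ c * (Q * R)
    assoc = ℕ-solve-∀

weaken-multiple : ∀ p d w {L L′} → L ≤ L′ → ShortMultiple p d w L → ShortMultiple p d w L′
weaken-multiple p d w L≤L′ (us , vs , c , us≥1 , e , short) = us , vs , c , us≥1 , e , ℕ.≤-trans short L≤L′

constant-multiple : ∀ p d x y c → 1 ≤ x → d * x + y + c ≡ c * p → ShortMultiple p d 1 (x + y)
constant-multiple p d x y c x≥1 e = replicate x 0 , replicate y 0 , c ,
  subst (1 ≤_) (≡.sym (val-0 x)) x≥1 ,
  ≡.trans (cong₂ (λ a b → d * a + b + c) (val-0 x) (val-0 y)) (≡.trans e (cong (c *_) (≡.sym (ℕ.^-identityʳ p)))) ,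
  ℕ.≤-reflexive (cong₂ _+_ (length-replicate x) (length-replicate y))
  where
  val-0 : ∀ k → val p (replicate k 0) ≡ k
  val-0 k = ≡.trans (val-replicate p k 0) (ℕ.*-identityʳ k)

two-digit-multiple : ∀ p d A B C D c → 1 ≤ A → d * (A + p * B) + (C + p * D) + c ≡ c * (p * p) →
                     ShortMultiple p d 2 (A + B + (C + D))
two-digit-multiple p d A B C D c A≥1 e = digits A B , digits C D , c ,
  subst (1 ≤_) (≡.sym (val-digits A B)) (ℕ.≤-trans A≥1 (ℕ.m≤m+n A _)) ,
  ≡.trans (cong₂ (λ a b → d * a + b + c) (val-digits A B) (val-digits C D)) (≡.trans e (cong (λ a → c * (p * a)) (≡.sym (ℕ.*-identityʳ p)))) ,
  ℕ.≤-reflexive (cong₂ _+_ (length-digits A B) (length-digits C D))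
  where
  digits : ℕ → ℕ → List ℕ
  digits x y = replicate x 0 ++ replicate y 1
  length-digits : ∀ x y → length (digits x y) ≡ x + y
  length-digits x y = ≡.trans (length-++ (replicate x 0)) (cong₂ _+_ (length-replicate x) (length-replicate y))
  val-digits : ∀ x y → val p (digits x y) ≡ x + p * y
  val-digits x y = ≡.trans (val-++ p (replicate x 0) (replicate y 1)) (cong₂ _+_
    (≡.trans (val-replicate p x 0) (ℕ.*-identityʳ x))
    (≡.trans (val-replicate p y 1) (≡.trans (cong (y *_) (ℕ.*-identityʳ p)) (ℕ.*-comm y p))))

halve : ∀ k → (∃[ h ] (k ≡ 2 * h)) ⊎ (∃[ h ] (k ≡ suc (2 * h)))
halve zero    = inj₁ (0 , ≡.refl)
halve (suc k) with halve k
... | inj₁ (h , e) = inj₂ (h , cong suc e)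
... | inj₂ (h , e) = inj₁ (suc h , ≡.trans (cong suc e) (≡.sym (ℕ.*-suc 2 h)))

-- The exceptional residue class over the field of order p²

module Exceptional (M : ℕ) where
  private
    p : ℕ
    p = suc (4 * M)

  -- d = 1 + 2M t with t odd. The digits A, B of J and C, D of J′ satisfy A + B + C + D = 2M,
  -- A - B = X and A + C = α; then d J + J′ = 2M (p + 1) (1 + w + t B), and B ∈ {0 , 1} is chosen
  -- to make the last factor even.
  solve-digits : ∀ s X w α → 1 ≤ X → suc (2 * s) * X ≡ suc (2 * α) + (p + 1) * w → X < α → α < 2 * M →
                 ShortMultiple p (1 + 2 * M * suc (2 * s)) 2 (2 * M)
  solve-digits s X w α X≥1 tX≡ X<α α<2M = weaken-multiple p d 2 (ℕ.≤-reflexive weight)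
    (two-digit-multiple p d (X + B) B C D c (ℕ.≤-trans X≥1 (ℕ.m≤m+n X B)) equation)
    where
    t d : ℕ
    t = suc (2 * s)
    d = 1 + 2 * M * t

    choice : ∃[ B ] ∃[ c ] (B ≤ 1 × 1 + w + t * B ≡ 2 * c)
    choice with halve w
    ... | inj₁ (h , w≡) = 1 , 1 + h + s , ℕ.≤-refl , ≡.trans (cong (λ w → 1 + w + t * 1) w≡) (even h s)
      where
      even : ∀ h s → 1 + 2 * h + suc (2 * s) * 1 ≡ 2 * (1 + h + s)
      even = ℕ-solve-∀
    ... | inj₂ (h , w≡) = 0 , 1 + h , z≤n , ≡.trans (cong (λ w → 1 + w + t * 0) w≡) (even h t)
      where
      even : ∀ h t → 1 + suc (2 * h) + t * 0 ≡ 2 * (1 + h)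
      even = ℕ-solve-∀

    B c C D : ℕ
    B = proj₁ choice
    c = proj₁ (proj₂ choice)
    C = α ∸ (X + B)
    D = 2 * M ∸ (α + B)

    B≤1 : B ≤ 1
    B≤1 = proj₁ (proj₂ (proj₂ choice))

    α≡ : X + B + C ≡ α
    α≡ = ℕ.m+[n∸m]≡n (ℕ.≤-trans (ℕ.+-monoʳ-≤ X B≤1) (subst (_≤ α) (ℕ.+-comm 1 X) X<α))

    2M≡ : α + B + D ≡ 2 * M
    2M≡ = ℕ.m+[n∸m]≡n (ℕ.≤-trans (ℕ.+-monoʳ-≤ α B≤1) (subst (_≤ 2 * M) (ℕ.+-comm 1 α) α<2M))

    weight : X + B + B + (C + D) ≡ 2 * M
    weight = ≡.trans (rearrange X B C D) (≡.trans (cong (λ a → a + B + D) α≡) 2M≡)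
      where
      rearrange : ∀ X B C D → X + B + B + (C + D) ≡ X + B + C + B + D
      rearrange = ℕ-solve-∀

    equation : d * (X + B + p * B) + (C + p * D) + c ≡ c * (p * p)
    equation = begin
      d * (X + B + p * B) + (C + p * D) + c
        ≡⟨ expand M t X B C D c ⟩
      (X + B + C) + B + D + 4 * M * (B + D) + 2 * M * (t * X) + 2 * M * (t * B * (p + 1)) + c
        ≡⟨ cong₂ (λ a τ → a + B + D + 4 * M * (B + D) + 2 * M * τ + 2 * M * (t * B * (p + 1)) + c) α≡ tX≡ ⟩
      α + B + D + 4 * M * (B + D) + 2 * M * (suc (2 * α) + (p + 1) * w) + 2 * M * (t * B * (p + 1)) + c
        ≡⟨ collect M t B D α w c ⟩
      (α + B + D) + 4 * M * (α + B + D) + 2 * M + 2 * M * (p + 1) * (w + t * B) + c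
        ≡⟨ cong (λ a → a + 4 * M * a + 2 * M + 2 * M * (p + 1) * (w + t * B) + c) 2M≡ ⟩
      2 * M + 4 * M * (2 * M) + 2 * M + 2 * M * (p + 1) * (w + t * B) + c
        ≡⟨ factor M w (t * B) c ⟩
      2 * M * (p + 1) * (1 + w + t * B) + c
        ≡⟨ cong (λ a → 2 * M * (p + 1) * a + c) (proj₂ (proj₂ (proj₂ choice))) ⟩
      2 * M * (p + 1) * (2 * c) + c
        ≡⟨ square M c ⟩
      c * (p * p) ∎
      where
      open ≡.≡-Reasoning
      expand : ∀ M t X B C D c → (1 + 2 * M * t) * (X + B + suc (4 * M) * B) + (C + suc (4 * M) * D) + c ≡
               (X + B + C) + B + D + 4 * M * (B + D) + 2 * M * (t * X) + 2 * M * (t * B * (suc (4 * M) + 1)) + c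
      expand = ℕ-solve-∀
      collect : ∀ M t B D α w c →
        α + B + D + 4 * M * (B + D) + 2 * M * (suc (2 * α) + (suc (4 * M) + 1) * w) + 2 * M * (t * B * (suc (4 * M) + 1)) + c ≡
        (α + B + D) + 4 * M * (α + B + D) + 2 * M + 2 * M * (suc (4 * M) + 1) * (w + t * B) + c
      collect = ℕ-solve-∀
      factor : ∀ M w x c → 2 * M + 4 * M * (2 * M) + 2 * M + 2 * M * (suc (4 * M) + 1) * (w + x) + c ≡
               2 * M * (suc (4 * M) + 1) * (1 + w + x) + c
      factor = ℕ-solve-∀
      square : ∀ M c → 2 * M * (suc (4 * M) + 1) * (2 * c) + c ≡ c * (suc (4 * M) * suc (4 * M))
      square = ℕ-solve-∀

  -- The residue T of t modulo p + 1 is odd; X = 1 serves unless T ∈ {3 , p}, when X = 3 does.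
  multiple : ∀ s → 3 ≤ M → ¬ (suc (2 * M) ∣ 1 + 2 * M * suc (2 * s)) →
             ShortMultiple p (1 + 2 * M * suc (2 * s)) 2 (2 * M)
  multiple s 3≤M ∤d = by-residue (s ℕ.% h) (ℕ.m%n<n s h) (ℕ.m≡m%n+[m/n]*n s h)
    where
    h k : ℕ
    h = suc (2 * M)
    k = s ℕ./ h

    by-residue : ∀ s₀ → s₀ < h → s ≡ s₀ + k * h → ShortMultiple p (1 + 2 * M * suc (2 * s)) 2 (2 * M)
    -- T = 1: modulo 2M + 1, 2M ≡ -1 and t ≡ 1, so 2M + 1 divides d.
    by-residue zero _ s≡ = contradiction (divides (1 + 4 * M * k) (≡.trans (cong (λ s → 1 + 2 * M * suc (2 * s)) s≡) (identity M k))) ∤d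
      where
      identity : ∀ M k → 1 + 2 * M * suc (2 * (k * suc (2 * M))) ≡ (1 + 4 * M * k) * suc (2 * M)
      identity = ℕ-solve-∀
    -- T = 3: X = 1 would give α = 1, against X < α, whereas 3 T = 9 gives α = 4, which is below 2M
    -- because M ≥ 3.
    by-residue (suc zero) _ s≡ = solve-digits s 3 (3 * k) 4 (s≤s z≤n) (≡.trans (cong (λ s → suc (2 * s) * 3) s≡) (identity M k))
      ℕ.≤-refl (ℕ.≤-trans (ℕ.n≤1+n 5) (ℕ.*-monoʳ-≤ 2 3≤M))
      where
      identity : ∀ M k → suc (2 * (1 + k * suc (2 * M))) * 3 ≡ suc (2 * 4) + (suc (4 * M) + 1) * (3 * k)
      identity = ℕ-solve-∀
    by-residue (suc (suc s′)) s₀<h s≡ with ℕ.m≤n⇒m<n∨m≡n (ℕ.≤-pred s₀<h)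
    ... | inj₁ s₀<2M = solve-digits s 1 k (2 + s′) ℕ.≤-refl (≡.trans (cong (λ s → suc (2 * s) * 1) s≡) (identity M k s′)) (s≤s (s≤s z≤n)) s₀<2M
      where
      identity : ∀ M k s′ → suc (2 * (2 + s′ + k * suc (2 * M))) * 1 ≡ suc (2 * (2 + s′)) + (suc (4 * M) + 1) * k
      identity = ℕ-solve-∀
    -- T = p ≡ -1 (mod p + 1): X = 1 would give α = 2M, just too large, whereas 3 T ≡ -3 gives α =
    -- 2M - 1.
    ... | inj₂ s₀≡2M = solve-digits s 3 (2 + 3 * k) (suc s′) (s≤s z≤n)
        (≡.trans (cong (λ s → suc (2 * s) * 3) s≡) (≡.trans (identity₁ M k s′) (≡.trans
          (cong (λ a → suc (2 * suc s′) + (2 * a + 2 * a + 4) + (p + 1) * (3 * k)) s₀≡2M) (identity₂ M k (suc (2 * suc s′))))))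
        (ℕ.≤-pred (subst (5 ≤_) (≡.sym s₀≡2M) (ℕ.≤-trans (ℕ.n≤1+n 5) (ℕ.*-monoʳ-≤ 2 3≤M)))) (ℕ.≤-reflexive s₀≡2M)
      where
      identity₁ : ∀ M k s′ → suc (2 * (2 + s′ + k * suc (2 * M))) * 3 ≡ suc (2 * suc s′) + (2 * (2 + s′) + 2 * (2 + s′) + 4) + (suc (4 * M) + 1) * (3 * k)
      identity₁ = ℕ-solve-∀
      identity₂ : ∀ M k τ → τ + (2 * (2 * M) + 2 * (2 * M) + 4) + (suc (4 * M) + 1) * (3 * k) ≡ τ + (suc (4 * M) + 1) * (2 + 3 * k)
      identity₂ = ℕ-solve-∀

  -- For p = 5 take J = 2 and J′ ∈ {2 , 10}.
  multiple-5 : ∀ s → M ≡ 1 → ¬ (3 ∣ 1 + 2 * M * suc (2 * s)) → ShortMultiple p (1 + 2 * M * suc (2 * s)) 2 4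
  multiple-5 s ≡.refl ∤d = by-residue (s ℕ.% 3) (ℕ.m%n<n s 3) (ℕ.m≡m%n+[m/n]*n s 3)
    where
    k : ℕ
    k = s ℕ./ 3
    by-residue : ∀ s₀ → s₀ < 3 → s ≡ s₀ + k * 3 → ShortMultiple 5 (1 + 2 * suc (2 * s)) 2 4
    by-residue 0 _ s≡ = contradiction (divides (1 + 4 * k) (≡.trans (cong (λ s → 1 + 2 * suc (2 * s)) s≡) (identity k))) ∤d
      where
      identity : ∀ k → 1 + 2 * suc (2 * (k * 3)) ≡ (1 + 4 * k) * 3
      identity = ℕ-solve-∀
    by-residue 1 _ s≡ = two-digit-multiple 5 (1 + 2 * suc (2 * s)) 2 0 0 2 (1 + k) (s≤s z≤n)
      (≡.trans (cong (λ s → (1 + 2 * suc (2 * s)) * (2 + 5 * 0) + (0 + 5 * 2) + (1 + k)) s≡) (identity k))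
      where
      identity : ∀ k → (1 + 2 * suc (2 * (1 + k * 3))) * (2 + 5 * 0) + (0 + 5 * 2) + (1 + k) ≡ (1 + k) * (5 * 5)
      identity = ℕ-solve-∀
    by-residue 2 _ s≡ = two-digit-multiple 5 (1 + 2 * suc (2 * s)) 2 0 2 0 (1 + k) (s≤s z≤n)
      (≡.trans (cong (λ s → (1 + 2 * suc (2 * s)) * (2 + 5 * 0) + (2 + 5 * 0) + (1 + k)) s≡) (identity k))
      where
      identity : ∀ k → (1 + 2 * suc (2 * (2 + k * 3))) * (2 + 5 * 0) + (2 + 5 * 0) + (1 + k) ≡ (1 + k) * (5 * 5)
      identity = ℕ-solve-∀
    by-residue (suc (suc (suc _))) (s≤s (s≤s (s≤s ()))) _

-- Niho exponents over quadratic extensions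

private
  split-digit : ∀ {m} a b → a ≤ m → b ≤ m → ∃[ A ] ∃[ B ] ∃[ C ] ∃[ D ] (A + C ≡ a × A + D ≡ b × A + B + C + D ≡ m)
  split-digit {m} a b a≤m b≤m with ℕ.≤-total a b
  ... | inj₁ a≤b = a , m ∸ b , 0 , b ∸ a , ℕ.+-identityʳ a , ℕ.m+[n∸m]≡n a≤b ,
    ≡.trans (rearrange a (m ∸ b) (b ∸ a)) (≡.trans (cong (_+ (m ∸ b)) (ℕ.m+[n∸m]≡n a≤b)) (ℕ.m+[n∸m]≡n b≤m))
    where
    rearrange : ∀ a x y → a + x + 0 + y ≡ a + y + x
    rearrange = ℕ-solve-∀
  ... | inj₂ b≤a = b , m ∸ a , a ∸ b , 0 , ℕ.m+[n∸m]≡n b≤a , ℕ.+-identityʳ b ,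
    ≡.trans (rearrange b (m ∸ a) (a ∸ b)) (≡.trans (cong (_+ (m ∸ a)) (ℕ.m+[n∸m]≡n b≤a)) (ℕ.m+[n∸m]≡n a≤m))
    where
    rearrange : ∀ a x y → a + x + y + 0 ≡ a + y + x
    rearrange = ℕ-solve-∀

-- Digit by digit, A = min(α , β), B = p-1 - max(α , β), C = α - A and D = β - A.
split-digits : ∀ p′ k α β → α < suc p′ ^ k → β < suc p′ ^ k → ∃[ as ] ∃[ bs ] ∃[ cs ] ∃[ ds ]
  (val (suc p′) as + val (suc p′) cs ≡ α × val (suc p′) as + val (suc p′) ds ≡ β ×
   suc (val (suc p′) as + val (suc p′) bs + val (suc p′) cs + val (suc p′) ds) ≡ suc p′ ^ k ×
   length as + length bs + length cs + length ds ≡ k * p′)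
split-digits p′ zero    zero zero _ _ = [] , [] , [] , [] , ≡.refl , ≡.refl , ≡.refl , ≡.refl
split-digits p′ zero    (suc α) _ (s≤s ()) _
split-digits p′ zero    zero (suc β) _ (s≤s ())
split-digits p′ (suc k) α β α< β<
  with split-digit (α ℕ.% suc p′) (β ℕ.% suc p′) (ℕ.≤-pred (ℕ.m%n<n α (suc p′))) (ℕ.≤-pred (ℕ.m%n<n β (suc p′)))
     | split-digits p′ k (α ℕ./ suc p′) (β ℕ./ suc p′)
         (ℕ.m<n*o⇒m/o<n (subst (α <_) (ℕ.*-comm (suc p′) (suc p′ ^ k)) α<)) (ℕ.m<n*o⇒m/o<n (subst (β <_) (ℕ.*-comm (suc p′) (suc p′ ^ k)) β<))
... | A , B , C , D , AC , AD , ABCD | as , bs , cs , ds , ac , ad , abcd , len =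
  prepend A as , prepend B bs , prepend C cs , prepend D ds ,
  pair A as C cs AC ac (ℕ.m≡m%n+[m/n]*n α p) , pair A as D ds AD ad (ℕ.m≡m%n+[m/n]*n β p) ,
  total , ≡.trans lengths (cong₂ _+_ ABCD len)
  where
  p : ℕ
  p = suc p′
  prepend : ℕ → List ℕ → List ℕ
  prepend x us = replicate x 0 ++ map (1 ℕ.+_) us
  val-prepend : ∀ x us → val p (prepend x us) ≡ x + val p us * p
  val-prepend x us = ≡.trans (val-++ p (replicate x 0) _) (cong₂ _+_ (≡.trans (val-replicate p x 0) (ℕ.*-identityʳ x))
    (≡.trans (val-shift p 1 us) (≡.trans (cong (_* val p us) (ℕ.*-identityʳ p)) (ℕ.*-comm p (val p us)))))
  length-prepend : ∀ x us → length (prepend x us) ≡ x + length us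
  length-prepend x us = ≡.trans (length-++ (replicate x 0)) (cong₂ _+_ (length-replicate x) (length-map (1 ℕ.+_) us))
  pair : ∀ X xs Y ys {a b γ} → X + Y ≡ a → val p xs + val p ys ≡ b → γ ≡ a + b * p → val p (prepend X xs) + val p (prepend Y ys) ≡ γ
  pair X xs Y ys XY xy γ≡ = ≡.trans (cong₂ _+_ (val-prepend X xs) (val-prepend Y ys))
    (≡.trans (rearrange X (val p xs) Y (val p ys) p) (≡.trans (cong₂ (λ a b → a + b * p) XY xy) (≡.sym γ≡)))
    where
    rearrange : ∀ X x Y y p → X + x * p + (Y + y * p) ≡ X + Y + (x + y) * p
    rearrange = ℕ-solve-∀
  total : suc (val p (prepend A as) + val p (prepend B bs) + val p (prepend C cs) + val p (prepend D ds)) ≡ p ^ suc k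
  total = ≡.trans (cong suc (cong₂ _+_ (cong₂ _+_ (cong₂ _+_ (val-prepend A as) (val-prepend B bs)) (val-prepend C cs)) (val-prepend D ds)))
    (≡.trans (cong suc (rearrange A (val p as) B (val p bs) C (val p cs) D (val p ds) p))
    (≡.trans (cong (λ a → suc (a + (val p as + val p bs + val p cs + val p ds) * p)) ABCD) (≡.trans (cong (_* p) abcd) (ℕ.*-comm (p ^ k) p))))
    where
    rearrange : ∀ A a B b C c D d p → A + a * p + (B + b * p) + (C + c * p) + (D + d * p) ≡ A + B + C + D + (a + b + c + d) * p
    rearrange = ℕ-solve-∀
  lengths : length (prepend A as) + length (prepend B bs) + length (prepend C cs) + length (prepend D ds) ≡
            A + B + C + D + (length as + length bs + length cs + length ds)
  lengths = ≡.trans (cong₂ _+_ (cong₂ _+_ (cong₂ _+_ (length-prepend A as) (length-prepend B bs)) (length-prepend C cs)) (length-prepend D ds))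
    (rearrange A (length as) B (length bs) C (length cs) D (length ds))
    where
    rearrange : ∀ A a B b C c D d → A + a + (B + b) + (C + c) + (D + d) ≡ A + B + C + D + (a + b + c + d)
    rearrange = ℕ-solve-∀

-- Q = p^m = 1 + S and t = 1 + α + v (Q + 1). With β = Q - α the splitting of (α , β) into A, B, C, D,
-- J = A + Q B and J′ = C + Q D gives d J + J′ = (Q² - 1) (1 + v + t B) for d = 1 + t S.
niho-multiple : ∀ p′ m S α β v → suc p′ ^ m ≡ suc S → α + β ≡ suc S → 1 ≤ α → 1 ≤ β →
                ShortMultiple (suc p′) (1 + (suc α + v * (S + 2)) * S) (m + m) (m * p′)
niho-multiple p′ m S α β v Q≡ α+β≡ α≥1 β≥1 with split-digits p′ m α β
  (subst (α <_) (≡.trans α+β≡ (≡.sym Q≡)) (ℕ.m<m+n α β≥1)) (subst (β <_) (≡.trans α+β≡ (≡.sym Q≡)) (ℕ.m<n+m β α≥1))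
... | as , bs , cs , ds , ac , ad , abcd , len =
  as ++ map (m ℕ.+_) bs , cs ++ map (m ℕ.+_) ds , 1 + v + t * B ,
  subst (1 ≤_) (≡.sym (val-block as bs)) (ℕ.≤-trans (subst (1 ≤_) (≡.sym A≡) (s≤s z≤n)) (ℕ.m≤m+n A _)) ,
  ≡.trans (cong₂ (λ a b → (1 + t * S) * a + b + (1 + v + t * B)) (≡.trans (val-block as bs) (cong (_+ suc S * B) A≡)) (val-block cs ds))
    (≡.trans equation (cong ((1 + v + t * B) *_) (≡.sym (≡.trans (ℕ.^-distribˡ-+-* p m m) (cong₂ _*_ Q≡ Q≡))))) ,
  ℕ.≤-reflexive (≡.trans (cong₂ _+_ (length-block as bs) (length-block cs ds)) (≡.trans (≡.sym (ℕ.+-assoc (length as + length bs) _ _)) len))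
  where
  p t A B C D : ℕ
  p = suc p′
  t = suc α + v * (S + 2)
  A = val p as
  B = val p bs
  C = val p cs
  D = val p ds
  val-block : ∀ xs ys → val p (xs ++ map (m ℕ.+_) ys) ≡ val p xs + suc S * val p ys
  val-block xs ys = ≡.trans (val-++ p xs _) (cong (λ a → val p xs + a) (≡.trans (val-shift p m ys) (cong (_* val p ys) Q≡)))
  length-block : ∀ xs ys → length (xs ++ map (m ℕ.+_) ys) ≡ length xs + length ys
  length-block xs ys = ≡.trans (length-++ xs) (cong (λ a → length xs + a) (length-map (m ℕ.+_) ys))
  S≡ : A + B + C + D ≡ S
  S≡ = ℕ.suc-injective (≡.trans abcd Q≡)
  -- α + β counts A twice and C, D once, and equals Q = 1 + A + B + C + D.
  A≡ : A ≡ suc B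
  A≡ = ℕ.+-cancelʳ-≡ (A + C + D) A (suc B) (≡.trans (lhs A C D) (≡.trans (cong₂ _+_ ac ad) (≡.trans α+β≡
    (≡.trans (cong suc (≡.sym S≡)) (rhs A B C D)))))
    where
    lhs : ∀ A C D → A + (A + C + D) ≡ A + C + (A + D)
    lhs = ℕ-solve-∀
    rhs : ∀ A B C D → suc (A + B + C + D) ≡ suc B + (A + C + D)
    rhs = ℕ-solve-∀
  S≡′ : suc B + B + C + D ≡ S
  S≡′ = ≡.trans (cong (λ a → a + B + C + D) (≡.sym A≡)) S≡
  equation : (1 + t * S) * (suc B + suc S * B) + (C + suc S * D) + (1 + v + t * B) ≡ (1 + v + t * B) * (suc S * suc S)
  equation = begin
    (1 + t * S) * (suc B + suc S * B) + (C + suc S * D) + (1 + v + t * B)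
      ≡⟨ expand t S B C D (1 + v + t * B) ⟩
    (suc B + B + C + D) + S * (B + D) + S * t + S * (S + 2) * (t * B) + (1 + v + t * B)
      ≡⟨ cong₂ (λ s a → s + S * (B + D) + S * (suc a + v * (S + 2)) + S * (S + 2) * (t * B) + (1 + v + t * B)) S≡′
           (≡.trans (≡.sym ac) (cong (_+ C) A≡)) ⟩
    S + S * (B + D) + S * (suc (suc B + C) + v * (S + 2)) + S * (S + 2) * (t * B) + (1 + v + t * B)
      ≡⟨ collect S B C D v (t * B) ⟩
    S * (2 + (suc B + B + C + D)) + S * (S + 2) * (v + t * B) + (1 + v + t * B)
      ≡⟨ cong (λ s → S * (2 + s) + S * (S + 2) * (v + t * B) + (1 + v + t * B)) S≡′ ⟩
    S * (2 + S) + S * (S + 2) * (v + t * B) + (1 + v + t * B)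
      ≡⟨ factor S v (t * B) ⟩
    (1 + v + t * B) * (suc S * suc S)  ∎
    where
    open ≡.≡-Reasoning
    expand : ∀ t S B C D c → (1 + t * S) * (suc B + suc S * B) + (C + suc S * D) + c ≡
             (suc B + B + C + D) + S * (B + D) + S * t + S * (S + 2) * (t * B) + c
    expand = ℕ-solve-∀
    collect : ∀ S B C D v x → S + S * (B + D) + S * (suc (suc B + C) + v * (S + 2)) + S * (S + 2) * x + (1 + v + x) ≡
              S * (2 + (suc B + B + C + D)) + S * (S + 2) * (v + x) + (1 + v + x)
    collect = ℕ-solve-∀
    factor : ∀ S v x → S * (2 + S) + S * (S + 2) * (v + x) + (1 + v + x) ≡ (1 + v + x) * (suc S * suc S)
    factor = ℕ-solve-∀

-- A factor p^i of the exponent is absorbed into J by shifting its digits, which keeps their number.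
twist-multiple : ∀ p .{{_ : NonZero p}} d w {L} i → ShortMultiple p (d * p ^ i) w L → ShortMultiple p d w L
twist-multiple p d w i (us , vs , c , us≥1 , e , short) = map (i ℕ.+_) us , vs , c ,
  subst (1 ≤_) (≡.sym (val-shift p i us)) (ℕ.*-mono-≤ (ℕ.m^n>0 p i) us≥1) ,
  ≡.trans (cong (λ a → a + val p vs + c) (≡.trans (cong (d *_) (val-shift p i us)) (≡.sym (ℕ.*-assoc d (p ^ i) (val p us))))) e ,
  subst (λ l → l + length vs ≤ _) (≡.sym (length-map (i ℕ.+_) us)) short

power-one : ∀ p .{{_ : NonZero p}} w i → ∃[ g ] (p ^ (w * i) ≡ 1 + g * (p ^ w ∸ 1))
power-one p w zero    = 0 , cong (p ^_) (ℕ.*-zeroʳ w)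
power-one p w (suc i) with power-one p w i
... | g , e = suc g + g * R , ≡.trans (cong (p ^_) (ℕ.*-suc w i)) (≡.trans (ℕ.^-distribˡ-+-* p w (w * i))
  (≡.trans (cong₂ _*_ (≡.sym (ℕ.m+[n∸m]≡n (ℕ.m^n>0 p w))) e) (identity R g)))
  where
  R : ℕ
  R = p ^ w ∸ 1
  identity : ∀ R g → (1 + R) * (1 + g * R) ≡ 1 + (suc g + g * R) * R
  identity = ℕ-solve-∀

-- Since p^(w i) ≡ 1 (mod p^w - 1), multiplication by p^(i (w - 1)) undoes the twist by p^i.
untwist-degenerate : ∀ p .{{_ : NonZero p}} w d i a v → 1 ≤ w → d * p ^ i ≡ p ^ a + v * (p ^ w ∸ 1) → Degenerate p (p ^ w ∸ 1) d
untwist-degenerate p w@(suc w′) d i a v _ e with power-one p w i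
... | g , p^wi≡ = degenerate-intro p R d (a + i * w′) (d * g) (v * p ^ (i * w′)) (begin
    d + d * g * R  ≡⟨ identity₁ d g R ⟩
    d * (1 + g * R)  ≡⟨ cong (d *_) (≡.sym p^wi≡) ⟩
    d * p ^ (w * i)  ≡⟨ cong (d *_) (≡.trans (cong (p ^_) (≡.trans (ℕ.*-comm w i) (ℕ.*-suc i w′))) (ℕ.^-distribˡ-+-* p i (i * w′))) ⟩
    d * (p ^ i * p ^ (i * w′))  ≡⟨ ≡.sym (ℕ.*-assoc d (p ^ i) _) ⟩
    d * p ^ i * p ^ (i * w′)  ≡⟨ cong (_* p ^ (i * w′)) e ⟩
    (p ^ a + v * R) * p ^ (i * w′)  ≡⟨ identity₂ (p ^ a) v R (p ^ (i * w′)) ⟩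
    p ^ a * p ^ (i * w′) + v * p ^ (i * w′) * R  ≡⟨ cong (_+ v * p ^ (i * w′) * R) (≡.sym (ℕ.^-distribˡ-+-* p a (i * w′))) ⟩
    p ^ (a + i * w′) + v * p ^ (i * w′) * R  ∎)
  where
  open ≡.≡-Reasoning
  R : ℕ
  R = p ^ w ∸ 1
  identity₁ : ∀ d g R → d + d * g * R ≡ d * (1 + g * R)
  identity₁ = ℕ-solve-∀
  identity₂ : ∀ a v R x → (a + v * R) * x ≡ a * x + v * x * R
  identity₂ = ℕ-solve-∀

-- Let Q = p^m. From d ≡ p^i (mod Q - 1), the twist by p^(i (m - 1)) gives d′ = 1 + t (Q - 1). The
-- residues t ≡ 0 and t ≡ 1 (mod Q + 1) make d′ ≡ 1 and d′ ≡ Q modulo Q² - 1, both degenerate;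
-- `niho-multiple` handles the others.
quadratic-multiple : ∀ p′ m d → 1 ≤ p′ → 1 ≤ m → 1 ≤ d → Degenerate (suc p′) (suc p′ ^ m ∸ 1) d →
                     ¬ Degenerate (suc p′) (suc p′ ^ (m + m) ∸ 1) d → ShortMultiple (suc p′) d (m + m) (m * p′)
quadratic-multiple p′ m@(suc m′) d p′≥1 m≥1 d≥1 degenerate nondegenerate with degenerate-elim (suc p′) (suc p′ ^ m ∸ 1) d degenerate
... | i , j , k , e with power-one (suc p′) m i
...   | g , p^mi≡ = twist-multiple p d (m + m) i′ (by-residue (t ℕ.% (S + 2)) (ℕ.m%n<n t (S + 2)) (ℕ.m≡m%n+[m/n]*n t (S + 2)))
  where
  p S i′ d′ : ℕ
  p = suc p′
  S = p ^ m ∸ 1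
  i′ = i * m′
  d′ = d * p ^ i′

  instance
    S+2≢0 : NonZero (S + 2)
    S+2≢0 = ℕ.>-nonZero (ℕ.≤-trans (s≤s z≤n) (ℕ.m≤n+m 2 S))

  Q≡ : p ^ m ≡ suc S
  Q≡ = ≡.sym (ℕ.m+[n∸m]≡n (ℕ.m^n>0 p m))

  d′≥1 : 1 ≤ d′
  d′≥1 = ℕ.*-mono-≤ d≥1 (ℕ.m^n>0 p i′)

  congruence : d′ + j * p ^ i′ * S ≡ 1 + (g + k * p ^ i′) * S
  congruence = begin
    d * p ^ i′ + j * p ^ i′ * S  ≡⟨ identity₁ d j (p ^ i′) S ⟩
    (d + j * S) * p ^ i′  ≡⟨ cong (_* p ^ i′) e ⟩
    (p ^ i + k * S) * p ^ i′  ≡⟨ identity₂ (p ^ i) k (p ^ i′) S ⟩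
    p ^ i * p ^ i′ + k * p ^ i′ * S  ≡⟨ cong (_+ k * p ^ i′ * S) (≡.trans (≡.sym (ℕ.^-distribˡ-+-* p i i′))
                                                  (≡.trans (cong (p ^_) (≡.trans (≡.sym (ℕ.*-suc i m′)) (ℕ.*-comm i m))) p^mi≡)) ⟩
    1 + g * S + k * p ^ i′ * S  ≡⟨ identity₃ g k (p ^ i′) S ⟩
    1 + (g + k * p ^ i′) * S  ∎
    where
    open ≡.≡-Reasoning
    identity₁ : ∀ d j x S → d * x + j * x * S ≡ (d + j * S) * x
    identity₁ = ℕ-solve-∀
    identity₂ : ∀ a k x S → (a + k * S) * x ≡ a * x + k * x * S
    identity₂ = ℕ-solve-∀
    identity₃ : ∀ g k x S → 1 + g * S + k * x * S ≡ 1 + (g + k * x) * S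
    identity₃ = ℕ-solve-∀

  S∣d′-1 : S ∣ d′ ∸ 1
  S∣d′-1 = ℕ.∣m+n∣m⇒∣n (divides (g + k * p ^ i′) (ℕ.suc-injective (≡.trans (≡.trans (cong suc (ℕ.+-comm (j * p ^ i′ * S) (d′ ∸ 1)))
    (cong (_+ j * p ^ i′ * S) (ℕ.m+[n∸m]≡n d′≥1))) congruence))) (ℕ.n∣m*n (j * p ^ i′))

  t : ℕ
  t = ℕ.quotient S∣d′-1

  d′≡ : d′ ≡ 1 + t * S
  d′≡ = ≡.trans (≡.sym (ℕ.m+[n∸m]≡n d′≥1)) (cong suc (ℕ._∣_.equality S∣d′-1))

  Q²≡ : p ^ (m + m) ∸ 1 ≡ S * (S + 2)
  Q²≡ = cong (_∸ 1) (≡.trans (ℕ.^-distribˡ-+-* p m m) (≡.trans (cong₂ _*_ Q≡ Q≡) (identity S)))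
    where
    identity : ∀ S → suc S * suc S ≡ suc (S * (S + 2))
    identity = ℕ-solve-∀

  by-residue : ∀ t₀ → t₀ < S + 2 → t ≡ t₀ + (t ℕ./ (S + 2)) * (S + 2) → ShortMultiple p d′ (m + m) (m * p′)
  by-residue zero _ t≡ = contradiction (untwist-degenerate p (m + m) d i′ 0 v (ℕ.≤-trans m≥1 (ℕ.m≤m+n m m))
      (≡.trans d′≡ (≡.trans (cong (λ t → 1 + t * S) t≡) (≡.trans (identity v S) (cong (λ a → 1 + v * a) (≡.sym Q²≡)))))) nondegenerate
    where
    v : ℕ
    v = t ℕ./ (S + 2)
    identity : ∀ v S → 1 + v * (S + 2) * S ≡ 1 + v * (S * (S + 2))
    identity = ℕ-solve-∀
  by-residue (suc zero) _ t≡ = contradiction (untwist-degenerate p (m + m) d i′ m v (ℕ.≤-trans m≥1 (ℕ.m≤m+n m m))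
      (≡.trans d′≡ (≡.trans (cong (λ t → 1 + t * S) t≡) (≡.trans (identity v S) (cong₂ (λ a b → a + v * b) (≡.sym Q≡) (≡.sym Q²≡)))))) nondegenerate
    where
    v : ℕ
    v = t ℕ./ (S + 2)
    identity : ∀ v S → 1 + (1 + v * (S + 2)) * S ≡ suc S + v * (S * (S + 2))
    identity = ℕ-solve-∀
  by-residue (suc α@(suc α′)) t₀< t≡ = subst (λ d → ShortMultiple p d (m + m) (m * p′)) (≡.sym (≡.trans d′≡ (cong (λ t → 1 + t * S) t≡)))
    (niho-multiple p′ m S α (suc S ∸ α) v Q≡ (ℕ.m+[n∸m]≡n (ℕ.<⇒≤ α<)) (s≤s z≤n) (ℕ.m<n⇒0<n∸m α<))
    where
    v : ℕ
    v = t ℕ./ (S + 2)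
    α< : α < suc S
    α< = ℕ.≤-pred (subst (suc (suc α) ≤_) (ℕ.+-comm S 2) t₀<)

-- Classification over the prime field

-- `small-multiple` is applied to e ≡ -d (mod p - 1). For p = 2 and p = 3 every d prime to p - 1 is
-- degenerate over 𝔽_p, which supplies its side conditions.
prime-field-multiple : ∀ m d → Prime (suc m) → Coprime d m → ¬ Degenerate (suc m) m d →
  2 ≤ m × ((∃[ L ] (ShortMultiple (suc m) d 1 L × 3 * L ≤ m + 2)) ⊎
           (∃[ M ] ∃[ s ] (m ≡ 4 * M × d ≡ 1 + 2 * M * suc (2 * s) × ShortMultiple (suc m) d 1 (2 * M))))
prime-field-multiple zero    d p-prime _ _ = contradiction (prime≥2 p-prime) λ { (s≤s ()) }
prime-field-multiple m@(suc m′) d p-prime coprime nondegenerate = 2≤m , classify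
  where
  prime-divisor : ∀ k → k ∣ suc m → 2 ≤ k → k ≡ suc m
  prime-divisor k k∣p 2≤k with prime⇒irreducible p-prime k∣p
  ... | inj₁ k≡1 = contradiction (subst (2 ≤_) k≡1 2≤k) λ { (s≤s ()) }
  ... | inj₂ k≡p = k≡p

  m≢1 : ¬ 1 ≡ m
  m≢1 1≡m = nondegenerate (subst (λ m → Degenerate (suc m) m d) 1≡m (degenerate-intro 2 1 d 0 1 d (identity d)))
    where
    identity : ∀ d → d + 1 * 1 ≡ 1 + d * 1
    identity = ℕ-solve-∀

  2∣m : 2 ∣ m
  2∣m with halve m
  ... | inj₁ (h , m≡) = divides h (≡.trans m≡ (ℕ.*-comm 2 h))
  ... | inj₂ (h , m≡) = contradiction (ℕ.suc-injective (prime-divisor 2 (divides (suc h) (≡.trans (cong suc m≡) (identity h))) ℕ.≤-refl)) m≢1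
    where
    identity : ∀ h → suc (suc (2 * h)) ≡ suc h * 2
    identity = ℕ-solve-∀

  2≤m : 2 ≤ m
  2≤m = ℕ.∣⇒≤ 2∣m

  r K e : ℕ
  r = d ℕ.% m
  K = d ℕ./ m
  e = m ∸ r

  d≡ : d ≡ r + K * m
  d≡ = ℕ.m≡m%n+[m/n]*n d m

  r<m : r < m
  r<m = ℕ.m%n<n d m

  r+e : r + e ≡ m
  r+e = ℕ.m+[n∸m]≡n (ℕ.<⇒≤ r<m)

  r≥1 : 1 ≤ r
  r≥1 = ℕ.n≢0⇒n>0 λ r≡0 → m≢1 (≡.sym (coprime (divides K (≡.trans d≡ (cong (_+ K * m) r≡0)) , ℕ.∣-refl)))

  e<m : e < m
  e<m = ℕ.∸-monoʳ-< r≥1 (ℕ.<⇒≤ r<m)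

  d+e : d + e ≡ suc K * m
  d+e = ≡.trans (cong (_+ e) d≡) (≡.trans (rearrange r (K * m) e) (cong (_+ K * m) r+e))
    where
    rearrange : ∀ r x e → r + x + e ≡ r + e + x
    rearrange = ℕ-solve-∀

  e-coprime : Coprime e m
  e-coprime {i} (i∣e , i∣m) = coprime (ℕ.∣m+n∣m⇒∣n (subst (i ∣_) (≡.trans (≡.sym d+e) (ℕ.+-comm d e)) (ℕ.∣n⇒∣m*n (suc K) i∣m)) i∣e , i∣m)

  e+1≢m : ¬ suc e ≡ m
  e+1≢m e+1≡m = nondegenerate (degenerate-intro (suc m) m d 0 0 K
    (≡.trans (ℕ.+-identityʳ d) (≡.trans d≡ (cong (_+ K * m) (ℕ.+-cancelʳ-≡ e r 1 (≡.trans r+e (≡.sym e+1≡m)))))))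

  3∤p : ¬ 3 ∣ suc m
  3∤p 3∣p = e+1≢m (ℕ.≤-antisym e<m (subst (_≤ suc e) (ℕ.suc-injective (prime-divisor 3 3∣p (s≤s (s≤s z≤n)))) (s≤s (ℕ.m<n⇒0<n∸m r<m))))

  classify : (∃[ L ] (ShortMultiple (suc m) d 1 L × 3 * L ≤ m + 2)) ⊎
             (∃[ M ] ∃[ s ] (m ≡ 4 * M × d ≡ 1 + 2 * M * suc (2 * s) × ShortMultiple (suc m) d 1 (2 * M)))
  classify with small-multiple m e 2∣m 3∤p e-coprime e<m e+1≢m
  ... | inj₂ (x , y , j , x≥1 , ex≡ , size) = inj₁ (x + y ,
        constant-multiple (suc m) d x y c x≥1 (≡.trans (cong (_+ c) (ℕ._∣_.equality m∣)) (≡.trans (ℕ.+-comm _ c) (≡.sym (ℕ.*-suc c m)))) , size)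
    where
    m∣ : m ∣ d * x + y
    m∣ = ℕ.∣m+n∣m⇒∣n (divides (suc K * x) (≡.trans (rearrange j m (d * x) y) (≡.trans (cong (λ a → d * x + a) (≡.sym ex≡))
      (≡.trans (≡.sym (ℕ.*-distribʳ-+ x d e)) (≡.trans (cong (_* x) d+e) (assoc (suc K) m x)))))) (ℕ.n∣m*n j)
      where
      rearrange : ∀ j m a y → j * m + (a + y) ≡ a + (y + j * m)
      rearrange = ℕ-solve-∀
      assoc : ∀ K m x → K * m * x ≡ K * x * m
      assoc = ℕ-solve-∀
    c : ℕ
    c = ℕ.quotient m∣
  ... | inj₁ 2e+2≡m with halve e
  ...   | inj₁ (h , e≡) = contradiction (e-coprime (divides h (≡.trans e≡ (ℕ.*-comm 2 h)) , 2∣m)) λ ()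
  -- Here e = m/2 - 1 is odd, so 4 divides m, and the point (1 , e) has weight m/2.
  ...   | inj₂ (h , e≡) = inj₂ (suc h , K , m≡ , d≡′ ,
          subst (ShortMultiple (suc m) d 1) (≡.trans (cong suc e≡) (identity₀ h))
            (constant-multiple (suc m) d 1 e (suc K) ℕ.≤-refl (≡.trans (cong (_+ suc K) (≡.trans (cong (_+ e) (ℕ.*-identityʳ d)) d+e))
              (≡.trans (ℕ.+-comm _ (suc K)) (≡.sym (ℕ.*-suc (suc K) m))))))
    where
    identity₀ : ∀ h → suc (suc (2 * h)) ≡ 2 * suc h
    identity₀ = ℕ-solve-∀
    m≡ : m ≡ 4 * suc h
    m≡ = ≡.trans (≡.sym 2e+2≡m) (≡.trans (cong (λ e → 2 * e + 2) e≡) (identity h))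
      where
      identity : ∀ h → 2 * suc (2 * h) + 2 ≡ 4 * suc h
      identity = ℕ-solve-∀
    d≡′ : d ≡ 1 + 2 * suc h * suc (2 * K)
    d≡′ = ℕ.+-cancelʳ-≡ e _ _ (≡.trans d+e (≡.trans (cong (suc K *_) m≡) (≡.trans (identity K h)
      (cong (λ a → 1 + 2 * suc h * suc (2 * K) + a) (≡.sym e≡)))))
      where
      identity : ∀ K h → suc K * (4 * suc h) ≡ 1 + 2 * suc h * suc (2 * K) + suc (2 * h)
      identity = ℕ-solve-∀

-- For p = 5 the allowance 2⌈4/3⌉ = 4 exceeds 2M and leaves room for a separate construction; M = 2
-- would mean p = 9; from M = 3 on, the weight 2M is used, which is at most 2⌈4M/3⌉.
exceptional-multiple : ∀ M s → 1 ≤ M → Prime (suc (4 * M)) → ¬ (suc (2 * M) ∣ 1 + 2 * M * suc (2 * s)) →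
  ∃[ L ] (ShortMultiple (suc (4 * M)) (1 + 2 * M * suc (2 * s)) 2 L × L ≤ 2 * ((4 * M + 2) / 3) × L ≤ 4 * M)
exceptional-multiple 1 s _ _ ∤d = 4 , Exceptional.multiple-5 1 s ≡.refl ∤d , ℕ.≤-refl , ℕ.≤-refl
exceptional-multiple 2 s _ p-prime _ with prime⇒irreducible p-prime {3} (divides 3 ≡.refl)
... | inj₁ ()
... | inj₂ ()
exceptional-multiple M@(suc (suc (suc M′))) s _ _ ∤d = 2 * M , Exceptional.multiple M s (s≤s (s≤s (s≤s z≤n))) ∤d ,
  ℕ.*-monoʳ-≤ 2 M≤ , ℕ.*-monoˡ-≤ M {2} {4} (s≤s (s≤s z≤n))
  where
  identity : ∀ M → M * 3 + (M + 2) ≡ 4 * M + 2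
  identity = ℕ-solve-∀
  M≤ : M ≤ (4 * M + 2) / 3
  M≤ = subst (_≤ (4 * M + 2) / 3) (ℕ.m*n/n≡m M 3) (ℕ./-monoˡ-≤ 3 (≤-of-sum {M * 3} {4 * M + 2} (M + 2) (identity M)))

-- Assembly of the bounds

polynomialRing : ∀ p → AugmentedRing p
polynomialRing p = record
  { base     = ℤ[X]
  ; X        = X
  ; Φₚ       = Φ p
  ; aug      = eval₁
  ; aug-cong = eval₁-cong
  ; aug-+    = eval₁-⊕
  ; aug-*    = eval₁-⊛
  ; aug-neg  = eval₁-neg
  ; aug-1    = ≡.refl
  ; aug-X    = ≡.refl
  ; aug-Φ    = eval₁-Φ p
  ; root     = λ f e → divπ f , π∣-of-root f e
  ; regular  = π-regular
  ; [1-X]*Φ  = P.trans (π*Φ p) (P.+-congˡ {P.1#} (P.-‿cong (monomial-↑ p)))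
  }
  where
  open Evaluation
  module P = CommutativeRing ℤ[X]
  eval₁-neg : ∀ f → eval₁ (P.- f) ≡ ℤ.- eval₁ f
  eval₁-neg []      = ≡.refl
  eval₁-neg (a ∷ f) = ≡.trans (cong (λ c → ℤ.- a ℤ.+ c) (eval₁-neg f)) (≡.sym (ℤ.neg-distrib-+ a (eval₁ f)))

1-mod-4 : ∀ m → 2 ≤ m → suc m % 4 ≡ 1 → 4 ≤ m
1-mod-4 (suc (suc (suc (suc m)))) _ _ = s≤s (s≤s (s≤s (s≤s z≤n)))
1-mod-4 1 (s≤s ()) _
1-mod-4 2 _ ()
1-mod-4 3 _ ()

module WeilSums (F : FiniteField) (p n d : ℕ) (p-prime : Prime p)
                (char-p : FiniteField._≈_ F (natF F p) (FiniteField.0# F))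
                (card : order F ≡ p ^ n) (d≥1 : 1 ≤ d) (d-coprime : gcd d (p ^ n ∸ 1) ≡ 1)
                (C : CyclotomicRing p) where
  private
    module F = FiniteField F
    module A = CommutativeRing (CyclotomicRing.ring C)

  open FiniteFieldTheory F p n p-prime char-p card
  open PiAdic p-prime C
  open CharacterSums F p n d p-prime char-p card d≥1 d-coprime C
  open DigitSums F p n d p-prime char-p card d≥1 d-coprime C
  open Collinearity F p n d p-prime char-p card d≥1 d-coprime C

  N : ℕ
  N = n * (p ∸ 1)

  N≥1 : 1 ≤ N
  N≥1 = ℕ.*-mono-≤ n≥1 (ℕ.∸-monoˡ-≤ 1 (prime≥2 p-prime))

  private
    instance
      p≢0 : NonZero p
      p≢0 = prime⇒nonZero p-prime

  Represents : Set
  Represents = ∀ k a → (πDiv p k (W F p n d a) → π^ k ∣ weil a) × (π^ k ∣ weil a → πDiv p k (W F p n d a))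

  module Bounds (represents : Represents) where
    AllDivisible : ℕ → Set
    AllDivisible k = ∀ a → π^ suc k ∣ weil a

    -- The valuation condition is decidable, so an a can be found by search.
    find : ∀ k → ¬ AllDivisible k → ∃[ a ] ValLe p (W F p n d a) k
    find k ¬all with ∃? {λ a → ¬ π^ suc k ∣ weil a} (λ a → ¬? (π∣? (suc k) (weil a)))
                        (λ {a} {b} a≈b ∤a π∣b → ∤a (π∣-respects (suc k) (weil-cong b a (F.sym a≈b)) π∣b))
      where
      open FieldSum F A.+-commutativeMonoid using () renaming (sum-cong to sumA-cong)
      weil-cong : ∀ a b → a F.≈ b → weil a A.≈ weil b
      weil-cong a b a≈b = sumA-cong F.elems (λ x → ψ-cong (F.+-congˡ (F.-‿cong (F.*-congʳ a≈b))))
    ... | yes (a , ∤a) = a , λ div → ∤a (proj₁ (represents (suc k) a) div)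
    ... | no none      = contradiction (λ a → decidable-stable (π∣? (suc k) (weil a)) (λ ∤a → none (a , ∤a))) ¬all

    degenerate-case : Degenerate p (q ∸ 1) d →
      (∀ a → ValGe p (W F p n d a) N) × (∃[ a ] ValLe p (W F p n d a) N)
    degenerate-case degenerate = let divisible , a , ∤a = degenerate-weil degenerate in
      (λ a → proj₂ (represents N a) (divisible a)) , a , λ div → ∤a (proj₁ (represents (suc N) a) div)

    -- K = ⌊2N/3⌋ + 1 is the least exponent with 3 K > 2 N.
    two-thirds : ¬ Degenerate p (q ∸ 1) d → ∃[ a ] ∃[ k ] (ValLe p (W F p n d a) k × 3 * k ≤ 2 * N)
    two-thirds nondegenerate = let a , val = find k (λ all → nondegenerate (divisible⇒degenerate k<N 2N<3K all)) in a , k , val , 3k≤2N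
      where
      k : ℕ
      k = 2 * N / 3
      3k≤2N : 3 * k ≤ 2 * N
      3k≤2N = subst (_≤ 2 * N) (ℕ.*-comm k 3) (ℕ.m/n*n≤m (2 * N) 3)
      2N<3K : 2 * N < 3 * suc k
      2N<3K = subst₂ _<_ (≡.sym (ℕ.m≡m%n+[m/n]*n (2 * N) 3)) (rearrange k) (ℕ.+-monoˡ-< (k * 3) (ℕ.m%n<n (2 * N) 3))
        where
        rearrange : ∀ k → 3 + k * 3 ≡ 3 * suc k
        rearrange = ℕ-solve-∀
      k<N : k < N
      k<N = ℕ.*-cancelˡ-< 3 k N (ℕ.≤-<-trans 3k≤2N (ℕ.*-monoˡ-< N {{ℕ.>-nonZero N≥1}} {2} {3} ℕ.≤-refl))

    -- A multiple found over the subfield of degree w is repeated r = n/w times. `AllDivisible k`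
    -- means divisibility by π^(k+1), so a list of k digits still counts as short.
    short-multiple : ∀ {w r L k} → ShortMultiple p d w L → w * r ≡ n → 1 ≤ r → r * L ≤ k → k < N → ¬ AllDivisible k
    short-multiple {w} {r} {L} {k} short wr≡n r≥1 rL≤k k<N all with subst (λ w → ShortMultiple p d w (r * L)) wr≡n (repeat-multiple p d w r r≥1 short)
    ... | us , vs , c , us≥1 , e , len = no-short-multiple k<N all digits
          (s≤s (ℕ.≤-trans (ℕ.≤-reflexive length-digits) (ℕ.≤-trans len rL≤k)))
          (subst (1 ≤_) (≡.sym value) (ℕ.≤-trans (ℕ.*-mono-≤ d≥1 us≥1) (ℕ.m≤m+n _ _)))
          (divides c (≡.trans value (ℕ.+-cancelʳ-≡ c _ _ (≡.trans e (≡.trans (cong (c *_) (≡.sym (ℕ.m+[n∸m]≡n (ℕ.<⇒≤ q≥2))))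
            (≡.trans (ℕ.*-suc c (q ∸ 1)) (ℕ.+-comm c _)))))))
      where
      tagged : Bool → ℕ → Bool × ℕ
      tagged b u = b , u
      digits : List (Bool × ℕ)
      digits = map (tagged true) us ++ map (tagged false) vs
      length-digits : length digits ≡ length us + length vs
      length-digits = ≡.trans (length-++ (map (tagged true) us)) (cong₂ _+_ (length-map (tagged true) us) (length-map (tagged false) vs))
      value : exponents digits ≡ d * val p us + val p vs
      value = go us
        where
        falses : ∀ vs → exponents (map (tagged false) vs) ≡ val p vs
        falses []       = ≡.refl
        falses (v ∷ vs) = cong (λ a → p ^ v + a) (falses vs)
        go : ∀ us → exponents (map (tagged true) us ++ map (tagged false) vs) ≡ d * val p us + val p vs
        go []       = ≡.trans (falses vs) (cong (_+ val p vs) (≡.sym (ℕ.*-zeroʳ d)))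
        go (u ∷ us) = ≡.trans (cong (λ a → d * p ^ u + a) (go us)) (≡.trans (≡.sym (ℕ.+-assoc (d * p ^ u) _ _))
          (cong (_+ val p vs) (≡.sym (ℕ.*-distribˡ-+ d (p ^ u) (val p us)))))

    private
      m : ℕ
      m = p ∸ 1

      p≡ : suc m ≡ p
      p≡ = ℕ.m+[n∸m]≡n (ℕ.<⇒≤ (prime≥2 p-prime))

      m≥1 : 1 ≤ m
      m≥1 = ℕ.∸-monoˡ-≤ 1 (prime≥2 p-prime)

      power-divides : ∀ w {r} → w * r ≡ n → (p ^ w ∸ 1) ∣ (q ∸ 1)
      power-divides w {r} wr≡n with power-one p w r
      ... | g , e = divides g (cong (_∸ 1) (≡.trans (cong (p ^_) (≡.sym wr≡n)) e))

      coprime-divisor : ∀ {k} → k ∣ d → k ∣ (q ∸ 1) → k ≡ 1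
      coprime-divisor k∣d k∣q-1 = gcd≡1⇒coprime d-coprime (k∣d , k∣q-1)

    -- Climb the tower of quadratic extensions until d becomes nondegenerate.
    half-of-power : ¬ Degenerate p (q ∸ 1) d → Degenerate p m d → ∃[ j ] n ≡ 2 ^ j →
                    ∃[ a ] ∃[ k ] (ValLe p (W F p n d a) k × 2 * k ≤ N)
    half-of-power nondegenerate degenerate (j , n≡) =
      let a , val = find (N / 2) (λ all → climb all j 0 (≡.trans n≡ (≡.sym (ℕ.+-identityʳ (2 ^ j))))
                      (subst (λ Q → Degenerate p (Q ∸ 1) d) (≡.sym (ℕ.*-identityʳ p)) degenerate))
      in a , N / 2 , val , subst (_≤ N) (ℕ.*-comm (N / 2) 2) (ℕ.m/n*n≤m N 2)
      where
      -- d is degenerate over the subfield of degree 2^s, and i quadratic steps remain. Reaching F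
      -- contradicts nondegeneracy; a step that loses degeneracy supplies a short multiple.
      climb : AllDivisible (N / 2) → ∀ i s → n ≡ 2 ^ s * 2 ^ i → Degenerate p (p ^ (2 ^ s) ∸ 1) d → ⊥
      climb all zero    s n≡ deg = nondegenerate (subst (λ w → Degenerate p (p ^ w ∸ 1) d) (≡.sym (≡.trans n≡ (ℕ.*-identityʳ (2 ^ s)))) deg)
      climb all (suc i) s n≡ deg = short-multiple {w} {r} {2 ^ s * m} (subst (λ p → ShortMultiple p d w (2 ^ s * m)) p≡
          (quadratic-multiple m (2 ^ s) d m≥1 (ℕ.m^n>0 2 s) d≥1
            (subst (λ p → Degenerate p (p ^ (2 ^ s) ∸ 1) d) (≡.sym p≡) deg)
            (λ deg′ → climb all i (suc s) (≡.trans n≡ (next (2 ^ s) (2 ^ i)))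
              (subst₂ (λ p w → Degenerate p (p ^ w ∸ 1) d) p≡ (cong (λ a → 2 ^ s + a) (≡.sym (ℕ.+-identityʳ (2 ^ s)))) deg′))))
          (≡.trans (twice (2 ^ s) r) (≡.sym n≡)) (ℕ.m^n>0 2 i)
          (subst (_≤ N / 2) (ℕ.m*n/n≡m (r * (2 ^ s * m)) 2) (ℕ./-monoˡ-≤ 2 (ℕ.≤-reflexive (≡.trans (total r (2 ^ s) m) (cong (_* m) (≡.sym n≡))))))
          (ℕ.m/n<m N 2 {{ℕ.>-nonZero N≥1}} ℕ.≤-refl) all
        where
        w r : ℕ
        w = 2 ^ s + 2 ^ s
        r = 2 ^ i
        next : ∀ a b → a * (2 * b) ≡ 2 * a * b
        next = ℕ-solve-∀
        twice : ∀ a r → (a + a) * r ≡ a * (2 * r)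
        twice = ℕ-solve-∀
        total : ∀ r a m → r * (a * m) * 2 ≡ a * (2 * r) * m
        total = ℕ-solve-∀

    private
      classification : ¬ Degenerate p m d → 2 ≤ m ×
        ((∃[ L ] (ShortMultiple p d 1 L × 3 * L ≤ m + 2)) ⊎
         (∃[ M ] ∃[ s ] (m ≡ 4 * M × d ≡ 1 + 2 * M * suc (2 * s) × ShortMultiple p d 1 (2 * M))))
      classification nondegenerate = subst (λ p → 2 ≤ m ×
        ((∃[ L ] (ShortMultiple p d 1 L × 3 * L ≤ m + 2)) ⊎
         (∃[ M ] ∃[ s ] (m ≡ 4 * M × d ≡ 1 + 2 * M * suc (2 * s) × ShortMultiple p d 1 (2 * M))))) p≡
        (prime-field-multiple m d (subst Prime (≡.sym p≡) p-prime)
          (λ { (k∣d , k∣m) → coprime-divisor k∣d (ℕ.∣-trans k∣m (subst (λ Q → (Q ∸ 1) ∣ (q ∸ 1)) (ℕ.*-identityʳ p) (power-divides 1 (ℕ.*-identityˡ n)))) })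
          (λ deg → nondegenerate (subst (λ p → Degenerate p m d) p≡ deg)))

      from-prime-field : ∀ {L} → ShortMultiple p d 1 L → L < m → ∃[ a ] ValLe p (W F p n d a) (n * L)
      from-prime-field {L} short L<m = find (n * L) (short-multiple {1} {n} {L} short (ℕ.*-identityˡ n) n≥1 ℕ.≤-refl
        (ℕ.*-monoʳ-< n {{ℕ.>-nonZero n≥1}} L<m))

      halving : ∀ {L} → ShortMultiple p d 1 L → 2 * L ≤ m → ∃[ a ] ∃[ k ] (ValLe p (W F p n d a) k × 2 * k ≤ N)
      halving {L} short 2L≤m = let a , val = from-prime-field short L<m in a , n * L , val ,
          ℕ.≤-trans (ℕ.≤-reflexive (rearrange n L)) (ℕ.*-monoʳ-≤ n 2L≤m)
        where
        L<m : L < m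
        L<m = ℕ.*-cancelˡ-< 2 L m (ℕ.≤-<-trans 2L≤m (ℕ.m<m+n m (ℕ.≤-trans m≥1 (ℕ.m≤m+n m 0))))
        rearrange : ∀ n L → 2 * (n * L) ≡ n * (2 * L)
        rearrange = ℕ-solve-∀

    -- In the exceptional alternative the weight per digit is m/2. Otherwise it is at most (m +
    -- 2)/3, which does not exceed m/2 once m ≥ 4, and p ≡ 1 (mod 4) ensures that.
    prime-field-half : ¬ Degenerate p m d → p % 4 ≡ 1 → ∃[ a ] ∃[ k ] (ValLe p (W F p n d a) k × 2 * k ≤ N)
    prime-field-half nondegenerate p%4≡1 with classification nondegenerate
    ... | 2≤m , inj₂ (M , s , m≡ , d≡ , short) = halving short (subst (2 * (2 * M) ≤_) (≡.sym m≡) (ℕ.≤-reflexive (rearrange M)))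
      where
      rearrange : ∀ M → 2 * (2 * M) ≡ 4 * M
      rearrange = ℕ-solve-∀
    ... | 2≤m , inj₁ (L , short , 3L≤) = halving short (ℕ.*-cancelˡ-≤ 3 (ℕ.≤-trans (ℕ.≤-reflexive (rearrange₁ L))
          (ℕ.≤-trans (ℕ.*-monoʳ-≤ 2 3L≤) (ℕ.≤-trans (ℕ.≤-reflexive (rearrange₂ m)) (ℕ.≤-trans (ℕ.+-monoʳ-≤ (2 * m) 4≤m) (ℕ.≤-reflexive (rearrange₃ m)))))))
      where
      4≤m : 4 ≤ m
      4≤m = 1-mod-4 m 2≤m (subst (λ p → p % 4 ≡ 1) (≡.sym p≡) p%4≡1)
      rearrange₁ : ∀ L → 3 * (2 * L) ≡ 2 * (3 * L)
      rearrange₁ = ℕ-solve-∀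
      rearrange₂ : ∀ m → 2 * (m + 2) ≡ 2 * m + 4
      rearrange₂ = ℕ-solve-∀
      rearrange₃ : ∀ m → 2 * m + m ≡ 3 * m
      rearrange₃ = ℕ-solve-∀

    private
      quadratic-field-multiple : ∀ M s r → m ≡ 4 * M → d ≡ 1 + 2 * M * suc (2 * s) → n ≡ 2 * r →
                                 ∃[ L ] (ShortMultiple p d 2 L × L ≤ 2 * ((m + 2) / 3) × L ≤ m)
      quadratic-field-multiple M s r m≡ d≡ n≡ = transport (exceptional-multiple M s M≥1 (subst Prime (≡.sym p≡1+4M) p-prime) ∤d)
        where
        p≡1+4M : suc (4 * M) ≡ p
        p≡1+4M = ≡.trans (cong suc (≡.sym m≡)) p≡
        M≥1 : 1 ≤ M
        M≥1 = ℕ.n≢0⇒n>0 λ M≡0 → ℕ.<⇒≱ m≥1 (ℕ.≤-reflexive (≡.trans m≡ (cong (4 *_) M≡0)))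
        square : ∀ M → suc (4 * M) * (suc (4 * M) * 1) ≡ suc (8 * M * suc (2 * M))
        square = ℕ-solve-∀
        2M+1∣ : suc (2 * M) ∣ (p ^ 2 ∸ 1)
        2M+1∣ = divides (8 * M) (≡.trans (cong (λ p → p * (p * 1) ∸ 1) (≡.sym p≡1+4M)) (cong (_∸ 1) (square M)))
        -- 2M + 1 = (p + 1)/2 divides p² - 1, hence q - 1 as n is even, and d is coprime to q - 1.
        ∤d : ¬ suc (2 * M) ∣ 1 + 2 * M * suc (2 * s)
        ∤d ∣d = ℕ.<⇒≢ (s≤s (ℕ.≤-trans M≥1 (ℕ.m≤m+n M (M + 0)))) (≡.sym (coprime-divisor (subst (suc (2 * M) ∣_) (≡.sym d≡) ∣d)
          (ℕ.∣-trans 2M+1∣ (power-divides 2 {r} (≡.sym n≡)))))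
        transport : ∃[ L ] (ShortMultiple (suc (4 * M)) (1 + 2 * M * suc (2 * s)) 2 L × L ≤ 2 * ((4 * M + 2) / 3) × L ≤ 4 * M) →
                    ∃[ L ] (ShortMultiple p d 2 L × L ≤ 2 * ((m + 2) / 3) × L ≤ m)
        transport (L , short , L≤ , L≤m) = L , subst₂ (λ p d → ShortMultiple p d 2 L) p≡1+4M (≡.sym d≡) short ,
          subst (λ m → L ≤ 2 * ((m + 2) / 3)) (≡.sym m≡) L≤ , subst (L ≤_) (≡.sym m≡) L≤m

      even-degree : ∀ M s r → m ≡ 4 * M → d ≡ 1 + 2 * M * suc (2 * s) → n ≡ 2 * r →
                    ∃[ a ] ∃[ k ] (ValLe p (W F p n d a) k × k ≤ ((m + 2) / 3) * n)
      even-degree M s r m≡ d≡ n≡ = let L , short , L≤ , L≤m = quadratic-field-multiple M s r m≡ d≡ n≡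
                                       a , val = find (r * L) (short-multiple {2} {r} {L} short (≡.sym n≡) r≥1 ℕ.≤-refl (rL<N L≤m)) in
        a , r * L , val , ℕ.≤-trans (ℕ.*-monoʳ-≤ r L≤) (ℕ.≤-reflexive (≡.trans (rearrange r ((m + 2) / 3)) (cong ((m + 2) / 3 *_) (≡.sym n≡))))
        where
        rearrange : ∀ r x → r * (2 * x) ≡ x * (2 * r)
        rearrange = ℕ-solve-∀
        r≥1 : 1 ≤ r
        r≥1 = ℕ.n≢0⇒n>0 λ r≡0 → ℕ.<⇒≱ n≥1 (ℕ.≤-reflexive (≡.trans n≡ (cong (2 *_) r≡0)))
        rL<N : ∀ {L} → L ≤ m → r * L < N
        rL<N {L} L≤m = subst (r * L <_) (cong (_* m) (≡.sym n≡)) (ℕ.≤-<-trans (ℕ.*-monoʳ-≤ r L≤m)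
          (ℕ.*-monoˡ-< m {{ℕ.>-nonZero m≥1}} {r} {2 * r} (ℕ.m<m+n r (ℕ.≤-trans r≥1 (ℕ.m≤m+n r 0)))))

    -- The exceptional alternative forces p ≡ 1 (mod 4), so n must be even and F contains the field
    -- of order p², where a better multiple exists.
    prime-field-third : ¬ Degenerate p m d → ¬ (p % 4 ≡ 1 × n % 2 ≡ 1) →
                        ∃[ a ] ∃[ k ] (ValLe p (W F p n d a) k × k ≤ ((m + 2) / 3) * n)
    prime-field-third nondegenerate not-odd with classification nondegenerate
    ... | 2≤m , inj₁ (L , short , 3L≤) = let a , val = from-prime-field short L<m in a , n * L , val ,
          subst (n * L ≤_) (ℕ.*-comm n _) (ℕ.*-monoʳ-≤ n (subst (_≤ (m + 2) / 3) (ℕ.m*n/n≡m L 3)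
            (ℕ./-monoˡ-≤ 3 (subst (_≤ m + 2) (ℕ.*-comm 3 L) 3L≤))))
      where
      L<m : L < m
      L<m = ℕ.*-cancelˡ-< 3 L m (ℕ.≤-<-trans 3L≤ (subst (m + 2 <_) (rearrange m) (ℕ.+-monoʳ-< m (ℕ.≤-trans (s≤s 2≤m) (ℕ.+-monoˡ-≤ m m≥1)))))
        where
        rearrange : ∀ m → m + (m + m) ≡ 3 * m
        rearrange = ℕ-solve-∀
    ... | 2≤m , inj₂ (M , s , m≡ , d≡ , _) with halve n
    ...   | inj₂ (h , n≡) = contradiction (p%4≡1 , n%2≡1) not-odd
      where
      p%4≡1 : p % 4 ≡ 1
      p%4≡1 = ≡.trans (cong (_% 4) (≡.trans (≡.sym p≡) (≡.trans (cong suc m≡) (cong suc (ℕ.*-comm 4 M))))) (ℕ.[m+kn]%n≡m%n 1 M 4)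
      n%2≡1 : n % 2 ≡ 1
      n%2≡1 = ≡.trans (cong (_% 2) (≡.trans n≡ (cong suc (ℕ.*-comm 2 h)))) (ℕ.[m+kn]%n≡m%n 1 h 2)
    ...   | inj₁ (r , n≡) = even-degree M s r m≡ d≡ n≡

-- Translation to the polynomial definitions

module Representation (F : FiniteField) (p n d : ℕ) (p-prime : Prime p)
                      (char-p : FiniteField._≈_ F (natF F p) (FiniteField.0# F))
                      (card : order F ≡ p ^ n) (d≥1 : 1 ≤ d) (d-coprime : gcd d (p ^ n ∸ 1) ≡ 1) where
  C : CyclotomicRing p
  C = Cyclotomic.ℤ[ζ] p-prime (polynomialRing p)

  private
    module F where
      open FiniteField F public
      open SemiringExp semiring public using () renaming (_^_ to _↑_)
    module A = CommutativeRing (CyclotomicRing.ring C)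

  open FiniteFieldTheory F p n p-prime char-p card using (pow≡↑)
  open CyclotomicRing C using (π̂)
  open PiAdic p-prime C using (π^_∣_; π∣-respects)
  open CharacterSums F p n d p-prime char-p card d≥1 d-coprime C using (ψ; weil)
  open Quotient ℤ[X] (Φ p) using (modulo; ≈⇒~)
  open SemiringExp A.semiring using () renaming (_^_ to _↑_)

  πpow-↑ : ∀ k → πpow k ≡ π̂ ↑ k
  πpow-↑ zero    = ≡.refl
  πpow-↑ (suc k) = cong (π ⊛_) (πpow-↑ k)

  W≈weil : ∀ a → W F p n d a A.≈ weil a
  W≈weil a = go F.elems
    where
    open ListSum A.+-commutativeMonoid using () renaming (sum to sumA)
    monomial-ζ : ∀ s → monomial s A.≈ Evaluation.X ↑ s
    monomial-ζ s = A.trans (≈⇒~ (Evaluation.monomial-↑ s)) (A.reflexive (Quotient.↑-agree ℤ[X] (Φ p) Evaluation.X s))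
    term : F.Carrier → Poly
    term x = monomial (trIdx F p n (pow F x d F.- a F.* x))
    term≈ψ : ∀ x → term x A.≈ ψ (x F.↑ d F.- a F.* x)
    term≈ψ x = A.trans (monomial-ζ (trIdx F p n (pow F x d F.- a F.* x))) (A.reflexive (cong (λ y → ψ (y F.- a F.* x)) (pow≡↑ x d)))
    go : ∀ xs → foldr _⊕_ [] (map term xs) A.≈ sumA xs (λ x → ψ (x F.↑ d F.- a F.* x))
    go []       = A.refl
    go (x ∷ xs) = A.+-cong {term x} {ψ (x F.↑ d F.- a F.* x)} {foldr _⊕_ [] (map term xs)} {sumA xs (λ x → ψ (x F.↑ d F.- a F.* x))}
      (term≈ψ x) (go xs)

  divisible⇔πDiv : ∀ k w → (πDiv p k w → π^ k ∣ w) × (π^ k ∣ w → πDiv p k w)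
  divisible⇔πDiv k w =
    (λ { (y , z , e) → y , subst (λ f → w A.≈ f ⊛ y) (πpow-↑ k) (modulo z (coeffwise e)) }) ,
    (λ { (y , e) → unpack y (subst (λ f → w A.≈ f ⊛ y) (≡.sym (πpow-↑ k)) e) })
    where
    unpack : ∀ y → w A.≈ πpow k ⊛ y → πDiv p k w
    unpack y (modulo z e) = y , z , coeff-≡ e

  represents : ∀ k a → (πDiv p k (W F p n d a) → π^ k ∣ weil a) × (π^ k ∣ weil a → πDiv p k (W F p n d a))
  represents k a =
    (λ div → π∣-respects k (W≈weil a) (proj₁ (divisible⇔πDiv k (W F p n d a)) div)) ,
    (λ π∣ → proj₂ (divisible⇔πDiv k (W F p n d a)) (π∣-respects k (A.sym (W≈weil a)) π∣))

theorem1p1 : (F : FiniteField) (p n d : ℕ) → Prime p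
    → FiniteField._≈_ F (natF F p) (FiniteField.0# F)
    → order F ≡ p ^ n
    → 1 ≤ d → gcd d (p ^ n ∸ 1) ≡ 1
    → (Degenerate p (p ^ n ∸ 1) d
    → (∀ a → ValGe p (W F p n d a) (n * (p ∸ 1)))
    × (∃[ a ] ValLe p (W F p n d a) (n * (p ∸ 1))))
    × (¬ Degenerate p (p ^ n ∸ 1) d → Degenerate p (p ∸ 1) d
    → ((∃[ j ] n ≡ 2 ^ j)
    → ∃[ a ] ∃[ k ] (ValLe p (W F p n d a) k × 2 * k ≤ n * (p ∸ 1)))
    × (¬ (∃[ j ] n ≡ 2 ^ j)
    → ∃[ a ] ∃[ k ] (ValLe p (W F p n d a) k × 3 * k ≤ 2 * (n * (p ∸ 1)))))
    × (¬ Degenerate p (p ∸ 1) d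
    → ((p % 4 ≡ 1 × n % 2 ≡ 1)
    → ∃[ a ] ∃[ k ] (ValLe p (W F p n d a) k × 2 * k ≤ n * (p ∸ 1)))
    × (¬ (p % 4 ≡ 1 × n % 2 ≡ 1)
    → ∃[ a ] ∃[ k ] (ValLe p (W F p n d a) k × k ≤ ((p ∸ 1 + 2) / 3) * n)))
theorem1p1 F p n d p-prime char-p card d≥1 d-coprime =
    degenerate-case
  , (λ nondegenerate degenerate → half-of-power nondegenerate degenerate , λ _ → two-thirds nondegenerate)
  , (λ nondegenerate → (λ { (p%4≡1 , _) → prime-field-half nondegenerate p%4≡1 }) , prime-field-third nondegenerate)
  where
  open Representation F p n d p-prime char-p card d≥1 d-coprime
  open WeilSums.Bounds F p n d p-prime char-p card d≥1 d-coprime C represents
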